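{- Let $\Phi=\{\phi_1,\dots,\phi_l\}$ be a finite collection of contracting similarities of $\mathbb{R}^n$ satisfying the open set condition, let $K\subset\mathbb{R}^n$ be the unique non-empty compact set with $K=\bigcup_{i=1}^l\phi_i(K)$, and let $d$ be the box counting dimension of $K$. Then $K$ satisfies the local scaling property with respect to $\kappa=\frac{d}{n}$; that is, there exist constants $c_3,c_4,r_1>0$ such that for any $0<r<r_1$, any $0<\delta<r$ and any $x\in K$, $$c_3\,\delta^{n-d}\,r^{d}\le\mathcal{H}^n(B(x,r)\cap\Delta(K,\delta))\le c_4\,\delta^{n-d}\,r^{d}.$$
   Context: A contracting similarity $\phi_i:\mathbb{R}^n\to\mathbb{R}^n$ is a map with $|\phi_i(x)-\phi_i(y)|=r_i|x-y|$ for all $x,y\in\mathbb{R}^n$, where $0<r_i<1$. $\Phi$ satisfies the open set condition if there exists a non-empty open set $O\subset\mathbb{R}^n$ such that $\phi_i(O)\subset O$ for each $1\le i\le l$ and $\phi_i(O)\cap\phi_j(O)=\emptyset$ whenever $i\ne j$. $\mathcal{H}^n$ is $n$-dimensional Hausdorff measure on $\mathbb{R}^n$ (a constant multiple of Lebesgue measure on Borel sets). For $F\subset\mathbb{R}^n$ and $\delta\ge0$, $\Delta(F,\delta):=\{x\in\mathbb{R}^n:d(x,F)<\delta\}$ (where $d(x,F)$ is the distance from $x$ to $F$). The box counting dimension of a bounded set $F$ is $n-\lim_{\delta\to0}\frac{\log\mathcal{H}^n(\Delta(F,\delta))}{\log\delta}$, when this limit exists (it does for $K$). A set $F\subset\mathbb{R}^n$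 satisfies the local scaling property with respect to $\kappa$ if there exist $c_3,c_4,r_1>0$ such that $c_3\delta^{n-\kappa n}r^{\kappa n}\le\mathcal{H}^n(B(x,r)\cap\Delta(F,\delta))\le c_4\delta^{n-\kappa n}r^{\kappa n}$ for all $0<r<r_1$, $\delta<r$ and $x\in F$. -}

module Defs where

open import Algebra.Bundles using (CommutativeRing; Semiring)
open import Algebra.Structures using (IsCommutativeRing)
open import Axiom.ExcludedMiddle using (ExcludedMiddle)
open import Data.Fin.Base using (Fin; toℕ)
open import Data.List.Base using (List)
open import Data.List.Relation.Unary.Any using (Any)
open import Data.Nat.Base using (ℕ; _!) renaming (_≤_ to _≤ℕ_)
open import Data.Product using (∃; ∃-syntax; _×_; _,_; proj₁)
open import Data.Sum.Base using ([_,_]′)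
open import Data.Vec.Base using (Vec; lookup)
open import Data.Vec.Functional using (foldr)
open import Level using (0ℓ; Level)
open import Relation.Binary.Core using (Rel)
open import Relation.Binary.PropositionalEquality using (_≡_; _≢_)
open import Relation.Binary.Structures using (IsTotalOrder)
open import Relation.Nullary using (yes; no)
open import Relation.Nullary.Construct.Add.Supremum using (_⁺; [_]; ⊤⁺)
open import Relation.Unary using (Pred; _∈_; _⊆_; _≐_; _∩_; _⊥_; ⋃; Satisfiable)

-- agda-stdlib has no real numbers: ℝ is an arbitrary complete ordered field,
-- which classically is unique up to isomorphism.
record CompleteOrderedField : Set₁ where
  infix  8 -_ _⁻¹
  infixl 7 _*_
  infixl 6 _+_
  infix  4 _≤_
  field
    Carrier : Set
    _≤_     : Rel Carrier 0ℓ
    _+_ _*_ : Carrier → Carrier → Carrier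
    -_      : Carrier → Carrier
    0# 1#   : Carrier
    -- the value of 0# ⁻¹ is unspecified
    _⁻¹     : Carrier → Carrier

    isCommutativeRing : IsCommutativeRing _≡_ _+_ _*_ -_ 0# 1#
    isTotalOrder      : IsTotalOrder _≡_ _≤_
    0≢1               : 0# ≢ 1#
    *-inverseʳ        : ∀ x → x ≢ 0# → x * x ⁻¹ ≡ 1#
    +-monoˡ-≤         : ∀ z {x y} → x ≤ y → x + z ≤ y + z
    *-nonNeg          : ∀ {x y} → 0# ≤ x → 0# ≤ y → 0# ≤ x * y

  UpperBound : ∀ {ℓ} → Pred Carrier ℓ → Pred Carrier ℓ
  UpperBound P b = ∀ x → P x → x ≤ b

  IsLUB : ∀ {ℓ} → Pred Carrier ℓ → Pred Carrier ℓ
  IsLUB P s = UpperBound P s × (∀ b → UpperBound P b → s ≤ b)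

  field
    complete : (P : Pred Carrier 0ℓ) → ∃⟨ P ⟩ → ∃⟨ UpperBound P ⟩ → ∃⟨ IsLUB P ⟩

  commutativeRing : CommutativeRing 0ℓ 0ℓ
  commutativeRing = record { isCommutativeRing = isCommutativeRing }

-- The mathematics is classical, so excluded middle is an explicit parameter.
module Analysis (lem : ∀ {ℓ} → ExcludedMiddle ℓ) (R : CompleteOrderedField) where

  open CompleteOrderedField R renaming (Carrier to ℝ)
  open IsTotalOrder isTotalOrder using (total)
  open import Relation.Binary.Construct.NonStrictToStrict _≡_ _≤_ using (_<_)
  open import Relation.Binary.Construct.Add.Supremum.NonStrict _≤_ using (_≤⁺_)
  open import Relation.Binary.Construct.Add.Supremum.Strict _<_ using (_<⁺_)
  open import Algebra.Definitions.RawSemiring (Semiring.rawSemiring (CommutativeRing.semiring commutativeRing)) using (sum; _^_) renaming (_×_ to _·_)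

  private variable
    ℓ : Level
    n l : ℕ

  infixl 7 _÷_
  infixl 6 _-_
  infixr 8 _^ʳ_ _^⁺_
  infixl 6 _+⁺_

  _-_ _÷_ : ℝ → ℝ → ℝ
  x - y = x + (- y)
  x ÷ y = x * y ⁻¹

  fromℕ : ℕ → ℝ
  fromℕ k = k · 1#

  abs : ℝ → ℝ
  abs x = [ (λ _ → x) , (λ _ → - x) ]′ (total 0# x)

  -- The element satisfying P, with junk value 0 if there is none; it is applied
  -- only to predicates with at most one solution.
  the : Pred ℝ ℓ → ℝ
  the P with lem {P = ∃⟨ P ⟩}
  ... | yes (x , _) = x
  ... | no _        = 0#

  -- 0 unless P is non-empty and bounded above
  sup : Pred ℝ ℓ → ℝ
  sup P = the (IsLUB P)

  _⟶_ : (ℕ → ℝ) → ℝ → Set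
  a ⟶ L = ∀ ε → 0# < ε → ∃[ N ] (∀ k → N ≤ℕ k → abs (a k - L) < ε)

  sqrt : ℝ → ℝ
  sqrt x = sup (λ t → t ^ 2 ≤ x)

  exp : ℝ → ℝ
  exp x = the (λ L → (λ k → sum {k} (λ i → x ^ toℕ i ÷ fromℕ (toℕ i !))) ⟶ L)

  -- meaningful for positive x only
  log : ℝ → ℝ
  log x = sup (λ y → exp y ≤ x)

  -- real powers of a positive base
  _^ʳ_ : ℝ → ℝ → ℝ
  x ^ʳ y = exp (y * log x)

  -- [0,∞] is represented by the elements of ℝ ⁺ that are ≥ 0, with ⊤⁺ as ∞.
  -- The operations below are used on such elements only.

  _+⁺_ : ℝ ⁺ → ℝ ⁺ → ℝ ⁺
  [ x ] +⁺ [ y ] = [ x + y ]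
  [ _ ] +⁺ ⊤⁺    = ⊤⁺
  ⊤⁺    +⁺ _     = ⊤⁺

  -- used with exponent ≥ 1 only
  _^⁺_ : ℝ ⁺ → ℕ → ℝ ⁺
  [ x ] ^⁺ k = [ x ^ k ]
  ⊤⁺    ^⁺ k = ⊤⁺

  -- supremum in [0,∞]; in particular sup⁺ ∅ = 0
  sup⁺ : Pred (ℝ ⁺) ℓ → ℝ ⁺
  sup⁺ P with lem {P = ∃[ b ] (∀ x → P x → x ≤⁺ [ b ])}
  ... | yes _ = [ sup (λ r → P [ r ]) ]
  ... | no _  = ⊤⁺

  -- infimum in [0,∞], as the greatest lower bound; in particular inf⁺ ∅ = ∞
  inf⁺ : Pred (ℝ ⁺) ℓ → ℝ ⁺
  inf⁺ P = sup⁺ (λ x → [ 0# ] ≤⁺ x × (∀ y → P y → x ≤⁺ y))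

  series⁺ : (ℕ → ℝ ⁺) → ℝ ⁺
  series⁺ a = sup⁺ (λ s → ∃[ k ] s ≡ foldr _+⁺_ [ 0# ] {k} (λ i → a (toℕ i)))

  -- finite part of an element of [0,∞], with junk value 0 at ∞
  toReal : ℝ ⁺ → ℝ
  toReal [ x ] = x
  toReal ⊤⁺    = 0#

  Point : ℕ → Set
  Point n = Vec ℝ n

  Subset : ℕ → Set₁
  Subset n = Pred (Point n) 0ℓ

  dist : Point n → Point n → ℝ
  dist x y = sqrt (sum (λ i → (lookup x i - lookup y i) ^ 2))

  Ball : Point n → ℝ → Subset n
  Ball x r y = dist x y < r

  IsOpen : Subset n → Set
  IsOpen O = ∀ x → x ∈ O → ∃[ ε ] 0# < ε × Ball x ε ⊆ O

  IsCompact : Subset n → Set₁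
  IsCompact {n} K = (I : Set) (U : I → Subset n) → (∀ i → IsOpen (U i)) → K ⊆ ⋃ I U →
    ∃[ is ] (∀ {x} → x ∈ K → Any (λ i → x ∈ U i) is)

  IsBounded : Subset n → Set
  IsBounded F = ∃[ b ] (∀ x y → x ∈ F → y ∈ F → dist x y ≤ b)

  diam : Subset n → ℝ ⁺
  diam U = sup⁺ (λ s → ∃[ x ] ∃[ y ] x ∈ U × y ∈ U × s ≡ [ dist x y ])

  distTo : Point n → Subset n → ℝ ⁺
  distTo x F = inf⁺ (λ s → ∃[ y ] y ∈ F × s ≡ [ dist x y ])

  Δ : Subset n → ℝ → Subset n
  Δ F δ x = distTo x F <⁺ [ δ ]

  ℋ-pre : ℝ → Subset n → ℝ ⁺
  ℋ-pre {n} ε A = inf⁺ (λ s → ∃[ U ] A ⊆ ⋃ ℕ U × (∀ i → diam (U i) ≤⁺ [ ε ]) ×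
    s ≡ series⁺ (λ i → diam {n} (U i) ^⁺ n))

  -- n-dimensional Hausdorff (outer) measure on ℝⁿ, for n ≥ 1, without a normalising
  -- constant; the limit as ε → 0 is a supremum since ℋ-pre is decreasing in ε.
  ℋ : Subset n → ℝ ⁺
  ℋ A = sup⁺ (λ s → ∃[ ε ] 0# < ε × s ≡ ℋ-pre ε A)

  Limit₀₊ : (ℝ → ℝ) → ℝ → Set
  Limit₀₊ f L = ∀ ε → 0# < ε → ∃[ η ] 0# < η × (∀ δ → 0# < δ → δ < η → abs (f δ - L) < ε)

  -- toReal meets no junk value here: Δ F δ is bounded, so its measure is finite.
  IsBoxDimension : Subset n → ℝ → Set
  IsBoxDimension {n} F d = IsBounded F ×
    (∃[ L ] Limit₀₊ (λ δ → log (toReal (ℋ (Δ F δ))) ÷ log δ) L × d ≡ fromℕ n - L)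

  LocalScaling : Subset n → ℝ → Set
  LocalScaling {n} F κ =
    ∃[ c₃ ] ∃[ c₄ ] ∃[ r₁ ] 0# < c₃ × 0# < c₄ × 0# < r₁ ×
    (∀ r δ x → 0# < r → r < r₁ → 0# < δ → δ < r → x ∈ F →
      [ c₃ * (δ ^ʳ (fromℕ n - κ * fromℕ n) * r ^ʳ (κ * fromℕ n)) ] ≤⁺ ℋ (Ball x r ∩ Δ F δ) ×
      ℋ (Ball x r ∩ Δ F δ) ≤⁺ [ c₄ * (δ ^ʳ (fromℕ n - κ * fromℕ n) * r ^ʳ (κ * fromℕ n)) ])

  IsContractingSimilarity : (Point n → Point n) → Set
  IsContractingSimilarity φ = ∃[ r ] 0# < r × r < 1# × (∀ x y → dist (φ x) (φ y) ≡ r * dist x y)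

  image : (Point n → Point n) → Subset n → Subset n
  image φ A y = ∃[ x ] x ∈ A × φ x ≡ y

  OpenSetCondition : (Fin l → Point n → Point n) → Set₁
  OpenSetCondition φ = ∃[ O ] ∃⟨ O ⟩ × IsOpen O × (∀ i → image (φ i) O ⊆ O) ×
    (∀ i j → i ≢ j → image (φ i) O ⊥ image (φ j) O)

  IsAttractor : (Fin l → Point n → Point n) → Subset n → Set₁
  IsAttractor {l} φ K = ∃⟨ K ⟩ × IsCompact K × K ≐ ⋃ (Fin l) (λ i → image (φ i) K)

{-# OPTIONS --safe #-}

-- Let s be the solution of Σ rᵢˢ = 1, and stop every composition of the maps φᵢ as soon as its ratio drops to ρ
-- or less. The numbers ratioˢ over the stopped compositions add up to 1, so K is the union of about ρ⁻ˢ pieces of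
-- size ρ, and each of these consists of about (ρ/δ)ˢ pieces of size δ. A similarity of ℝⁿ is surjective; hence the
-- stopped compositions map a ball contained in the open set O onto disjoint balls, which have radius comparable to ρ
-- and lie near the corresponding pieces. So only boundedly many pieces of size ρ come near a ball of radius ρ.
-- Balls around the pieces of size δ cover Δ(K,δ), while the disjoint balls obtained from O at a small multiple of
-- the scale δ lie inside Δ(K,δ); this bounds ℋ(B(x,r) ∩ Δ(K,δ)) above and below by multiples of (r/δ)ˢδⁿ.
-- The same bounds for ℋ(Δ(K,δ)) show that s is the box dimension. About ℋ one needs only that, up to constant
-- factors, N balls of radius ρ have measure at most Nρⁿ, and at least Nρⁿ if their centres are ρ-separated.
module Submission where

open import Defs
open import Algebra.Bundles using (CommutativeRing)
open import Algebra.Solver.Ring.AlmostCommutativeRing using (fromCommutativeRing; _-Raw-AlmostCommutative⟶_)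
open import Axiom.ExcludedMiddle using (ExcludedMiddle)
open import Data.Empty using (⊥; ⊥-elim)
open import Data.Fin.Base using (Fin; zero; suc; toℕ)
open import Data.Integer.Base as ℤ using (ℤ; -[1+_]; 0ℤ; 1ℤ)
import Data.Integer.Properties as ℤₚ
open import Data.List.Base as List using (List; []; _∷_; length; concatMap; upTo)
import Data.List.Properties as Listₚ
open import Data.List.Relation.Unary.All as All using (All; []; _∷_)
import Data.List.Relation.Unary.All.Properties as Allₚ
open import Data.List.Relation.Unary.AllPairs as AllPairs using (AllPairs; []; _∷_)
import Data.List.Relation.Unary.AllPairs.Properties as AllPairsₚ
open import Data.List.Relation.Unary.Any as Any using (Any; here; there)
import Data.List.Relation.Unary.Any.Properties as Anyₚ
open import Data.Maybe.Base using (Maybe; just; nothing)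
open import Data.Nat.Base as ℕ using (ℕ; zero; suc; z≤n; s≤s; NonZero; _!)
import Data.Nat.Properties as ℕₚ
open import Data.Product using (∃; ∃-syntax; _×_; _,_; proj₁; proj₂)
open import Data.Sum.Base using (_⊎_; inj₁; inj₂; [_,_]′)
open import Data.Unit.Base using (⊤)
open import Data.Vec.Base as Vec using (Vec; []; _∷_; lookup; tabulate)
import Data.Vec.Functional as Vector
import Data.Vec.Properties as Vecₚ
open import Function.Base using (_∘_; id)
open import Level using (0ℓ)
open import Relation.Binary.PropositionalEquality using (_≡_; _≢_; refl; sym; trans; cong; cong₂; subst; subst₂; module ≡-Reasoning)
open import Relation.Nullary using (¬_; Dec; yes; no)
open import Relation.Nullary.Construct.Add.Supremum using (_⁺; ⊤⁺) renaming ([_] to ⟨_⟩)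
open import Relation.Nullary.Decidable using (decidable-stable; ¬?)
open import Relation.Unary using (Pred; _∈_; _⊆_; _∩_; ⋃) renaming (_⊥_ to _⟂_)

-- No volume is computed: neither additivity of ℋ nor its relation to Lebesgue measure enters. The
-- obstacle is the lower bound for ℋ, where an arbitrary countable cover has to be beaten. Counting
-- replaces volume there: a fine grid of mesh h puts about (a/h)ⁿ points into each cube of side a,
-- while a set of small diameter can hold only few of them, so the members of a cover must have a
-- large sum of diamⁿ. Bolzano-Weierstrass makes the cover finite, although its members are
-- arbitrary sets, at the price of a summable thickening. All comparisons between pieces of K and
-- balls from O use three lengths: a bound D for distances within K, the radius a of a ball in O,
-- and the distance e from a fixed point of K to the centre of that ball. Intermediate values are
-- found without continuity. Surjectivity of exp and the solution s of Moran's equation come from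
-- the same device: the supremum of a set of arguments, and an explicit shift of it that contradicts
-- a strict inequality.

module Development (lem : ∀ {ℓ} → ExcludedMiddle ℓ) (R : CompleteOrderedField) where

  open CompleteOrderedField R renaming (Carrier to ℝ)
  open Analysis lem R
  open import Relation.Binary.Structures using (IsTotalOrder)
  open IsTotalOrder isTotalOrder using (total; antisym) renaming (refl to ≤-refl; trans to ≤-trans; reflexive to ≤-reflexive)
  open import Relation.Binary.Construct.NonStrictToStrict _≡_ _≤_ using (_<_; <⇒≤)
  import Relation.Binary.Construct.NonStrictToStrict _≡_ _≤_ as Strict
  open CommutativeRing commutativeRing using (semiring; commutativeSemiring; +-commutativeMonoid; +-monoid; +-comm; +-assoc; +-identityˡ; +-identityʳ; *-comm; *-assoc; *-identityˡ; *-identityʳ; zeroˡ; zeroʳ; distribˡ; distribʳ; -‿inverseˡ; -‿inverseʳ)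
  open import Algebra.Definitions.RawSemiring (Algebra.Bundles.Semiring.rawSemiring semiring) using (sum; _^_; _×′_) renaming (_×_ to _·_)

  -- Integer coefficients for the ring solver

  module IntegerCoefficients where
    open import Algebra.Properties.Ring (CommutativeRing.ring commutativeRing)
    open import Algebra.Properties.Semiring.Mult.TCOptimised semiring
      using (1+×; ×-homo-+; ×1-homo-*)

    -- With `×′` instead of `·`, the constants `con 0ℤ` and `con 1ℤ` denote `0#` and `1#` by
    -- computation, so solved identities match the goals as they stand. The coefficients are
    -- integers because the solver has to recognise equal ones.
    ⟦_⟧ : ℤ → ℝ
    ⟦ ℤ.+ n ⟧      = n ×′ 1#
    ⟦ -[1+ n ] ⟧ = - (suc n ×′ 1#)

    ⟦-_⟧ : ∀ i → ⟦ ℤ.- i ⟧ ≡ - ⟦ i ⟧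
    ⟦- ℤ.+ zero ⟧  = sym -0#≈0#
    ⟦- ℤ.+ suc n ⟧ = refl
    ⟦- -[1+ n ] ⟧ = sym (-‿involutive _)

    ⊖-homo : ∀ m n → ⟦ m ℤ.⊖ n ⟧ ≡ m ×′ 1# - n ×′ 1#
    ⊖-homo zero zero = sym (-‿inverseʳ 0#)
    ⊖-homo zero (suc n) = sym (+-identityˡ _)
    ⊖-homo (suc m) zero = sym (trans (cong ((suc m ×′ 1#) +_) -0#≈0#) (+-identityʳ _))
    ⊖-homo (suc m) (suc n) = begin
      ⟦ suc m ℤ.⊖ suc n ⟧       ≡⟨ cong ⟦_⟧ (ℤₚ.[1+m]⊖[1+n]≡m⊖n m n) ⟩
      ⟦ m ℤ.⊖ n ⟧               ≡⟨ ⊖-homo m n ⟩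
      a - b                     ≡⟨ cong (_- b) (sym (+-identityʳ a)) ⟩
      a + 0# - b                ≡⟨ cong (λ z → a + z - b) (sym (-‿inverseʳ 1#)) ⟩
      a + (1# - 1#) - b         ≡⟨ cong (_- b) (sym (+-assoc a 1# (- 1#))) ⟩
      a + 1# - 1# - b           ≡⟨ +-assoc (a + 1#) (- 1#) (- b) ⟩
      (a + 1#) + (- 1# + - b)   ≡⟨ cong₂ _+_ (+-comm a 1#) (-‿+-comm 1# b) ⟩
      (1# + a) - (1# + b)       ≡⟨ cong₂ _-_ (sym (1+× m 1#)) (sym (1+× n 1#)) ⟩
      suc m ×′ 1# - suc n ×′ 1# ∎
      where
      open ≡-Reasoning
      a = m ×′ 1#
      b = n ×′ 1#

    +-homo : ∀ i j → ⟦ i ℤ.+ j ⟧ ≡ ⟦ i ⟧ + ⟦ j ⟧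
    +-homo (ℤ.+ m) (ℤ.+ n) = ×-homo-+ 1# m n
    +-homo (ℤ.+ m) -[1+ n ] = ⊖-homo m (suc n)
    +-homo -[1+ m ] (ℤ.+ n) = trans (⊖-homo n (suc m)) (+-comm _ _)
    +-homo -[1+ m ] -[1+ n ] = begin
      - (suc (suc (m ℕ.+ n)) ×′ 1#)     ≡⟨ cong (λ k → - (suc k ×′ 1#)) (sym (ℕₚ.+-suc m n)) ⟩
      - ((suc m ℕ.+ suc n) ×′ 1#)       ≡⟨ cong -_ (×-homo-+ 1# (suc m) (suc n)) ⟩
      - (suc m ×′ 1# + suc n ×′ 1#)     ≡⟨ sym (-‿+-comm _ _) ⟩
      - (suc m ×′ 1#) + - (suc n ×′ 1#) ∎
      where open ≡-Reasoning

    *-homo : ∀ i j → ⟦ i ℤ.* j ⟧ ≡ ⟦ i ⟧ * ⟦ j ⟧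
    *-homo (ℤ.+ m) (ℤ.+ n) = trans (cong ⟦_⟧ (sym (ℤₚ.pos-* m n))) (×1-homo-* m n)
    *-homo (ℤ.+ m) -[1+ n ] = begin
      ⟦ ℤ.+ m ℤ.* -[1+ n ] ⟧        ≡⟨ cong ⟦_⟧ (sym (ℤₚ.neg-distribʳ-* (ℤ.+ m) (ℤ.+ suc n))) ⟩
      ⟦ ℤ.- (ℤ.+ m ℤ.* ℤ.+ suc n) ⟧ ≡⟨ ⟦- ℤ.+ m ℤ.* ℤ.+ suc n ⟧ ⟩
      - ⟦ ℤ.+ m ℤ.* ℤ.+ suc n ⟧     ≡⟨ cong -_ (*-homo (ℤ.+ m) (ℤ.+ suc n)) ⟩
      - (⟦ ℤ.+ m ⟧ * ⟦ ℤ.+ suc n ⟧) ≡⟨ -‿distribʳ-* _ _ ⟩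
      ⟦ ℤ.+ m ⟧ * ⟦ -[1+ n ] ⟧      ∎
      where open ≡-Reasoning
    *-homo -[1+ m ] (ℤ.+ n) = begin
      ⟦ -[1+ m ] ℤ.* ℤ.+ n ⟧        ≡⟨ cong ⟦_⟧ (sym (ℤₚ.neg-distribˡ-* (ℤ.+ suc m) (ℤ.+ n))) ⟩
      ⟦ ℤ.- (ℤ.+ suc m ℤ.* ℤ.+ n) ⟧ ≡⟨ ⟦- ℤ.+ suc m ℤ.* ℤ.+ n ⟧ ⟩
      - ⟦ ℤ.+ suc m ℤ.* ℤ.+ n ⟧     ≡⟨ cong -_ (*-homo (ℤ.+ suc m) (ℤ.+ n)) ⟩
      - (⟦ ℤ.+ suc m ⟧ * ⟦ ℤ.+ n ⟧) ≡⟨ -‿distribˡ-* _ _ ⟩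
      ⟦ -[1+ m ] ⟧ * ⟦ ℤ.+ n ⟧      ∎
      where open ≡-Reasoning
    *-homo -[1+ m ] -[1+ n ] = begin
      (suc m ℕ.* suc n) ×′ 1# ≡⟨ ×1-homo-* (suc m) (suc n) ⟩
      x * y                   ≡⟨ sym (-‿involutive _) ⟩
      - - (x * y)             ≡⟨ cong -_ (-‿distribˡ-* x y) ⟩
      - ((- x) * y)           ≡⟨ -‿distribʳ-* (- x) y ⟩
      (- x) * (- y)           ∎
      where
      open ≡-Reasoning
      x = suc m ×′ 1#
      y = suc n ×′ 1#

    morphism : CommutativeRing.rawRing ℤₚ.+-*-commutativeRing -Raw-AlmostCommutative⟶ fromCommutativeRing commutativeRing
    morphism = record
      { ⟦_⟧ = ⟦_⟧ ; +-homo = +-homo ; *-homo = *-homo ; -‿homo = ⟦-_⟧ ; 0-homo = refl ; 1-homo = refl }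

    _coeff≟_ : ∀ i j → Maybe (⟦ i ⟧ ≡ ⟦ j ⟧)
    i coeff≟ j with i ℤₚ.≟ j
    ... | yes i≡j = just (cong ⟦_⟧ i≡j)
    ... | no  _   = nothing

  open import Algebra.Solver.Ring (CommutativeRing.rawRing ℤₚ.+-*-commutativeRing) (fromCommutativeRing commutativeRing)
    IntegerCoefficients.morphism IntegerCoefficients._coeff≟_
    using (solve; _:=_; _:+_; _:*_; _:-_; :-_; _:^_; con)


  open import Algebra.Properties.Ring (CommutativeRing.ring commutativeRing)
    using (-0#≈0#; -‿involutive; -‿distribˡ-*; -‿distribʳ-*; -‿+-comm)
  open import Algebra.Properties.Semiring.Exp semiring using (^-homo-*; ^-assocʳ)
  open import Algebra.Properties.CommutativeSemiring.Exp commutativeSemiring using (^-distrib-*)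
  open import Algebra.Properties.Semiring.Mult semiring using (×-homo-+; ×1-homo-*)
  open import Algebra.Properties.CommutativeMonoid.Sum +-commutativeMonoid
    using (∑-distrib-+; ∑-comm; sum-cong-≗; sum-init-last; sum-replicate)
  open import Algebra.Properties.Semiring.Sum semiring using (*-distribˡ-sum; *-distribʳ-sum)

  -- Strict and non-strict order

  <-irrefl : ∀ {x} → ¬ (x < x)
  <-irrefl (_ , x≢x) = x≢x refl

  <-trans : ∀ {x y z} → x < y → y < z → x < z
  <-trans = Strict.<-trans (IsTotalOrder.isPartialOrder isTotalOrder)

  <-≤-trans : ∀ {x y z} → x < y → y ≤ z → x < z
  <-≤-trans = Strict.<-≤-trans sym ≤-trans antisym (subst (_ ≤_))

  ≤-<-trans : ∀ {x y z} → x ≤ y → y < z → x < z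
  ≤-<-trans = Strict.≤-<-trans ≤-trans antisym (subst (_≤ _))

  <⇒≱ : ∀ {x y} → x < y → ¬ (y ≤ x)
  <⇒≱ = Strict.<⇒≱ antisym

  ≰⇒> : ∀ {x y} → ¬ (x ≤ y) → y < x
  ≰⇒> = Strict.≰⇒> sym ≤-reflexive total

  ≤-or-> : ∀ x y → x ≤ y ⊎ y < x
  ≤-or-> x y with lem {P = x ≤ y}
  ... | yes x≤y = inj₁ x≤y
  ... | no  x≰y = inj₂ (≰⇒> x≰y)

  ≮⇒≥ : ∀ {x y} → ¬ (x < y) → y ≤ x
  ≮⇒≥ {x} {y} x≮y with ≤-or-> y x
  ... | inj₁ y≤x = y≤x
  ... | inj₂ x<y = ⊥-elim (x≮y x<y)

  module ≤-Reasoning where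
    open import Relation.Binary.Reasoning.Base.Triple (IsTotalOrder.isPreorder isTotalOrder) (Strict.<-asym antisym) <-trans
      (subst (_ <_) , subst (_< _)) <⇒≤ <-≤-trans ≤-<-trans public

  ≤-respʳ : ∀ {x y z} → y ≡ z → x ≤ y → x ≤ z
  ≤-respʳ refl x≤y = x≤y

  ≤-respˡ : ∀ {x y z} → x ≡ y → x ≤ z → y ≤ z
  ≤-respˡ refl x≤z = x≤z

  <-respʳ : ∀ {x y z} → y ≡ z → x < y → x < z
  <-respʳ refl x<y = x<y

  <-respˡ : ∀ {x y z} → x ≡ y → x < z → y < z
  <-respˡ refl x<z = x<z

  -- Ordered rings

  +-monoʳ-≤ : ∀ z {x y} → x ≤ y → z + x ≤ z + y
  +-monoʳ-≤ z x≤y = subst₂ _≤_ (+-comm _ z) (+-comm _ z) (+-monoˡ-≤ z x≤y)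

  +-mono-≤ : ∀ {x y u v} → x ≤ y → u ≤ v → x + u ≤ y + v
  +-mono-≤ x≤y u≤v = ≤-trans (+-monoˡ-≤ _ x≤y) (+-monoʳ-≤ _ u≤v)

  -- These two reduce an inequality to another one together with a ring identity.
  ≤-shift : ∀ {a b c d} → a ≤ b → d - c ≡ b - a → c ≤ d
  ≤-shift {a} {b} {c} {d} a≤b eq = subst₂ _≤_
    (solve 2 (λ a c → a :+ (c :- a) := c) refl a c)
    (trans (solve 3 (λ a b c → b :+ (c :- a) := c :+ (b :- a)) refl a b c)
      (trans (cong (c +_) (sym eq)) (solve 2 (λ c d → c :+ (d :- c) := d) refl c d)))
    (+-monoˡ-≤ (c - a) a≤b)

  <-shift : ∀ {a b c d} → a < b → d - c ≡ b - a → c < d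
  <-shift {a} {b} {c} {d} (a≤b , a≢b) eq = ≤-shift a≤b eq , λ c≡d → a≢b
    (trans (solve 2 (λ a b → a := b :- (b :- a)) refl a b)
      (trans (cong (λ z → b - z) (trans (sym eq) (cong (λ z → d - z) c≡d)))
        (solve 2 (λ b d → b :- (d :- d) := b) refl b d)))

  +-mono-<-≤ : ∀ {x y u v} → x < y → u ≤ v → x + u < y + v
  +-mono-<-≤ {x} {y} {u} {v} x<y u≤v = <-≤-trans
    (<-shift x<y (solve 3 (λ x y u → y :+ u :- (x :+ u) := y :- x) refl x y u)) (+-monoʳ-≤ y u≤v)

  +-mono-≤-< : ∀ {x y u v} → x ≤ y → u < v → x + u < y + v
  +-mono-≤-< x≤y u<v = subst₂ _<_ (+-comm _ _) (+-comm _ _) (+-mono-<-≤ u<v x≤y)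

  +-mono-< : ∀ {x y u v} → x < y → u < v → x + u < y + v
  +-mono-< x<y u<v = +-mono-<-≤ x<y (<⇒≤ u<v)

  0≤y-x : ∀ {x y} → x ≤ y → 0# ≤ y - x
  0≤y-x {x} {y} h = ≤-shift h (solve 2 (λ x y → y :- x :- con 0ℤ := y :- x) refl x y)

  0<y-x : ∀ {x y} → x < y → 0# < y - x
  0<y-x {x} {y} h = <-shift h (solve 2 (λ x y → y :- x :- con 0ℤ := y :- x) refl x y)

  x≤y-of-0≤y-x : ∀ {x y} → 0# ≤ y - x → x ≤ y
  x≤y-of-0≤y-x {x} {y} h = ≤-shift h (solve 2 (λ x y → y :- x := y :- x :- con 0ℤ) refl x y)

  neg-mono-≤ : ∀ {x y} → x ≤ y → - y ≤ - x
  neg-mono-≤ {x} {y} h = ≤-shift h (solve 2 (λ x y → :- x :- :- y := y :- x) refl x y)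

  neg-mono-< : ∀ {x y} → x < y → - y < - x
  neg-mono-< {x} {y} h = <-shift h (solve 2 (λ x y → :- x :- :- y := y :- x) refl x y)

  0≤-x : ∀ {x} → x ≤ 0# → 0# ≤ - x
  0≤-x h = ≤-respˡ -0#≈0# (neg-mono-≤ h)

  x≤x+y : ∀ x {y} → 0# ≤ y → x ≤ x + y
  x≤x+y x 0≤y = ≤-respˡ (+-identityʳ x) (+-monoʳ-≤ x 0≤y)

  x<x+y : ∀ x {y} → 0# < y → x < x + y
  x<x+y x 0<y = <-respˡ (+-identityʳ x) (+-mono-≤-< ≤-refl 0<y)

  y≤x+y : ∀ {x} y → 0# ≤ x → y ≤ x + y
  y≤x+y y 0≤x = ≤-respʳ (+-comm y _) (x≤x+y y 0≤x)

  +-nonNeg : ∀ {x y} → 0# ≤ x → 0# ≤ y → 0# ≤ x + y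
  +-nonNeg 0≤x 0≤y = ≤-trans 0≤x (x≤x+y _ 0≤y)

  +-pos : ∀ {x y} → 0# < x → 0# ≤ y → 0# < x + y
  +-pos 0<x 0≤y = <-≤-trans 0<x (x≤x+y _ 0≤y)

  *-monoˡ-≤ : ∀ {z x y} → 0# ≤ z → x ≤ y → z * x ≤ z * y
  *-monoˡ-≤ {z} {x} {y} 0≤z x≤y = ≤-shift (*-nonNeg 0≤z (0≤y-x x≤y))
    (solve 3 (λ x y z → z :* y :- z :* x := z :* (y :- x) :- con 0ℤ) refl x y z)

  *-monoʳ-≤ : ∀ {z x y} → 0# ≤ z → x ≤ y → x * z ≤ y * z
  *-monoʳ-≤ 0≤z x≤y = subst₂ _≤_ (*-comm _ _) (*-comm _ _) (*-monoˡ-≤ 0≤z x≤y)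

  *-mono-≤ : ∀ {x y u v} → 0# ≤ x → 0# ≤ v → x ≤ y → u ≤ v → x * u ≤ y * v
  *-mono-≤ 0≤x 0≤v x≤y u≤v = ≤-trans (*-monoˡ-≤ 0≤x u≤v) (*-monoʳ-≤ 0≤v x≤y)

  square-nonNeg : ∀ x → 0# ≤ x * x
  square-nonNeg x with total 0# x
  ... | inj₁ 0≤x = *-nonNeg 0≤x 0≤x
  ... | inj₂ x≤0 = ≤-respʳ (solve 1 (λ x → (:- x) :* (:- x) := x :* x) refl x)
                     (*-nonNeg (0≤-x x≤0) (0≤-x x≤0))

  0≤1 : 0# ≤ 1#
  0≤1 = ≤-respʳ (*-identityˡ 1#) (square-nonNeg 1#)

  0<1 : 0# < 1#
  0<1 = 0≤1 , 0≢1

  -- Fields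

  >⇒≢0 : ∀ {x} → 0# < x → x ≢ 0#
  >⇒≢0 (_ , 0≢x) x≡0 = 0≢x (sym x≡0)

  *-cancelˡ : ∀ z {x y} → z ≢ 0# → z * x ≡ z * y → x ≡ y
  *-cancelˡ z {x} {y} z≢0 eq = begin
    x              ≡⟨ lemma x ⟩
    z ⁻¹ * (z * x) ≡⟨ cong (z ⁻¹ *_) eq ⟩
    z ⁻¹ * (z * y) ≡⟨ lemma y ⟨
    y              ∎
    where
    open ≡-Reasoning
    lemma : ∀ x → x ≡ z ⁻¹ * (z * x)
    lemma x = begin
      x              ≡⟨ *-identityˡ x ⟨
      1# * x         ≡⟨ cong (_* x) (*-inverseʳ z z≢0) ⟨
      z * z ⁻¹ * x   ≡⟨ solve 3 (λ z i x → z :* i :* x := i :* (z :* x)) refl _ _ _ ⟩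
      z ⁻¹ * (z * x) ∎

  *-pos : ∀ {x y} → 0# < x → 0# < y → 0# < x * y
  *-pos {x} {y} 0<x 0<y = *-nonNeg (<⇒≤ 0<x) (<⇒≤ 0<y) , λ 0≡xy →
    >⇒≢0 0<y (*-cancelˡ x (>⇒≢0 0<x) (trans (sym 0≡xy) (sym (zeroʳ x))))

  *-monoˡ-< : ∀ {z x y} → 0# < z → x < y → z * x < z * y
  *-monoˡ-< {z} {x} {y} 0<z x<y = <-shift (*-pos 0<z (0<y-x x<y))
    (solve 3 (λ x y z → z :* y :- z :* x := z :* (y :- x) :- con 0ℤ) refl x y z)

  *-monoʳ-< : ∀ {z x y} → 0# < z → x < y → x * z < y * z
  *-monoʳ-< 0<z x<y = subst₂ _<_ (*-comm _ _) (*-comm _ _) (*-monoˡ-< 0<z x<y)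

  *-cancelˡ-≤ : ∀ {z x y} → 0# < z → z * x ≤ z * y → x ≤ y
  *-cancelˡ-≤ 0<z zx≤zy = ≮⇒≥ λ y<x → <⇒≱ (*-monoˡ-< 0<z y<x) zx≤zy

  *-cancelˡ-< : ∀ {z x y} → 0# < z → z * x < z * y → x < y
  *-cancelˡ-< 0<z zx<zy = ≰⇒> λ y≤x → <⇒≱ zx<zy (*-monoˡ-≤ (<⇒≤ 0<z) y≤x)

  ⁻¹-pos : ∀ {x} → 0# < x → 0# < x ⁻¹
  ⁻¹-pos {x} 0<x = *-cancelˡ-< 0<x (subst₂ _<_ (sym (zeroʳ x)) (sym (*-inverseʳ x (>⇒≢0 0<x))) 0<1)

  x*x⁻¹ : ∀ {x} → 0# < x → x * x ⁻¹ ≡ 1#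
  x*x⁻¹ 0<x = *-inverseʳ _ (>⇒≢0 0<x)

  ÷-pos : ∀ {x y} → 0# < x → 0# < y → 0# < x ÷ y
  ÷-pos 0<x 0<y = *-pos 0<x (⁻¹-pos 0<y)

  ÷-nonNeg : ∀ {x y} → 0# ≤ x → 0# < y → 0# ≤ x ÷ y
  ÷-nonNeg 0≤x 0<y = *-nonNeg 0≤x (<⇒≤ (⁻¹-pos 0<y))

  x*[y÷x] : ∀ {x} y → 0# < x → x * (y ÷ x) ≡ y
  x*[y÷x] {x} y 0<x = begin
    x * (y * x ⁻¹) ≡⟨ solve 3 (λ x y i → x :* (y :* i) := y :* (x :* i)) refl _ _ _ ⟩
    y * (x * x ⁻¹) ≡⟨ cong (y *_) (x*x⁻¹ 0<x) ⟩
    y * 1#         ≡⟨ *-identityʳ y ⟩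
    y              ∎
    where open ≡-Reasoning

  [y÷x]*x : ∀ {x} y → 0# < x → y ÷ x * x ≡ y
  [y÷x]*x y 0<x = trans (*-comm _ _) (x*[y÷x] y 0<x)

  x≤y÷z : ∀ {x y z} → 0# < z → z * x ≤ y → x ≤ y ÷ z
  x≤y÷z 0<z zx≤y = *-cancelˡ-≤ 0<z (≤-respʳ (sym (x*[y÷x] _ 0<z)) zx≤y)

  x÷z≤y : ∀ {x y z} → 0# < z → x ≤ z * y → x ÷ z ≤ y
  x÷z≤y 0<z x≤zy = *-cancelˡ-≤ 0<z (≤-respˡ (sym (x*[y÷x] _ 0<z)) x≤zy)

  2# : ℝ
  2# = 1# + 1#

  0<2 : 0# < 2#
  0<2 = +-pos 0<1 0≤1

  half : ℝ → ℝ
  half x = x ÷ 2#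

  half+half : ∀ x → half x + half x ≡ x
  half+half x = begin
    x * 2# ⁻¹ + x * 2# ⁻¹ ≡⟨ solve 2 (λ x i → x :* i :+ x :* i := x :* ((con 1ℤ :+ con 1ℤ) :* i)) refl _ _ ⟩
    x * (2# * 2# ⁻¹)      ≡⟨ cong (x *_) (x*x⁻¹ 0<2) ⟩
    x * 1#                ≡⟨ *-identityʳ x ⟩
    x                     ∎
    where open ≡-Reasoning

  half-pos : ∀ {x} → 0# < x → 0# < half x
  half-pos 0<x = ÷-pos 0<x 0<2

  half<x : ∀ {x} → 0# < x → half x < x
  half<x {x} 0<x = <-respʳ (half+half x) (x<x+y (half x) (half-pos 0<x))

  ≤-if-≤+ε : ∀ {x y} → (∀ ε → 0# < ε → x ≤ y + ε) → x ≤ y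
  ≤-if-≤+ε {x} {y} h = ≮⇒≥ λ y<x → let 0<d = 0<y-x y<x in
    <⇒≱ (half<x 0<d) (≤-shift (h (half (x - y)) (half-pos 0<d))
      (solve 3 (λ x y z → z :- (x :- y) := y :+ z :- x) refl _ _ _))

  -- Absolute value

  abs-cases : ∀ x → (0# ≤ x × abs x ≡ x) ⊎ (x ≤ 0# × abs x ≡ - x)
  abs-cases x with total 0# x
  ... | inj₁ 0≤x = inj₁ (0≤x , refl)
  ... | inj₂ x≤0 = inj₂ (x≤0 , refl)

  abs-nonNeg : ∀ x → 0# ≤ abs x
  abs-nonNeg x with abs-cases x
  ... | inj₁ (0≤x , eq) = ≤-respʳ (sym eq) 0≤x
  ... | inj₂ (x≤0 , eq) = ≤-respʳ (sym eq) (0≤-x x≤0)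

  x≤abs : ∀ x → x ≤ abs x
  x≤abs x with abs-cases x
  ... | inj₁ (0≤x , eq) = ≤-reflexive (sym eq)
  ... | inj₂ (x≤0 , eq) = ≤-trans x≤0 (abs-nonNeg x)

  -x≤abs : ∀ x → - x ≤ abs x
  -x≤abs x with abs-cases x
  ... | inj₁ (0≤x , eq) = ≤-trans (≤-respʳ -0#≈0# (neg-mono-≤ 0≤x)) (abs-nonNeg x)
  ... | inj₂ (x≤0 , eq) = ≤-reflexive (sym eq)

  abs-≤ : ∀ {x b} → x ≤ b → - x ≤ b → abs x ≤ b
  abs-≤ {x} p q with abs-cases x
  ... | inj₁ (_ , eq) = ≤-respˡ (sym eq) p
  ... | inj₂ (_ , eq) = ≤-respˡ (sym eq) q

  abs-< : ∀ {x b} → x < b → - x < b → abs x < b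
  abs-< {x} p q with abs-cases x
  ... | inj₁ (_ , eq) = <-respˡ (sym eq) p
  ... | inj₂ (_ , eq) = <-respˡ (sym eq) q

  abs-nonNeg-≡ : ∀ {x} → 0# ≤ x → abs x ≡ x
  abs-nonNeg-≡ {x} 0≤x = antisym
    (abs-≤ ≤-refl (≤-trans (≤-respʳ -0#≈0# (neg-mono-≤ 0≤x)) 0≤x)) (x≤abs x)

  abs-neg : ∀ x → abs (- x) ≡ abs x
  abs-neg x = antisym (abs-≤ (-x≤abs x) (≤-respˡ (sym (-‿involutive x)) (x≤abs x)))
    (abs-≤ (≤-respˡ (-‿involutive x) (-x≤abs (- x))) (x≤abs (- x)))

  abs-+ : ∀ x y → abs (x + y) ≤ abs x + abs y
  abs-+ x y = abs-≤ (+-mono-≤ (x≤abs x) (x≤abs y))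
    (≤-respˡ (-‿+-comm x y) (+-mono-≤ (-x≤abs x) (-x≤abs y)))

  abs-swap : ∀ x y → abs (x - y) ≡ abs (y - x)
  abs-swap x y = trans (cong abs (solve 2 (λ x y → x :- y := :- (y :- x)) refl x y)) (abs-neg (y - x))

  abs-triangle : ∀ x y z → abs (x - z) ≤ abs (x - y) + abs (y - z)
  abs-triangle x y z = subst (λ w → abs w ≤ abs (x - y) + abs (y - z))
    (solve 3 (λ x y z → (x :- y) :+ (y :- z) := x :- z) refl x y z) (abs-+ (x - y) (y - z))

  abs-* : ∀ x y → abs (x * y) ≡ abs x * abs y
  abs-* x y with abs-cases x | abs-cases y
  ... | inj₁ (0≤x , p) | inj₁ (0≤y , q) = trans (abs-nonNeg-≡ (*-nonNeg 0≤x 0≤y)) (sym (cong₂ _*_ p q))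
  ... | inj₁ (0≤x , p) | inj₂ (y≤0 , q) = begin
    abs (x * y)     ≡⟨ abs-neg _ ⟨
    abs (- (x * y)) ≡⟨ cong abs (-‿distribʳ-* x y) ⟩
    abs (x * - y)   ≡⟨ abs-nonNeg-≡ (*-nonNeg 0≤x (0≤-x y≤0)) ⟩
    x * - y         ≡⟨ cong₂ _*_ p q ⟨
    abs x * abs y   ∎
    where open ≡-Reasoning
  ... | inj₂ (x≤0 , p) | inj₁ (0≤y , q) = begin
    abs (x * y)     ≡⟨ abs-neg _ ⟨
    abs (- (x * y)) ≡⟨ cong abs (-‿distribˡ-* x y) ⟩
    abs ((- x) * y) ≡⟨ abs-nonNeg-≡ (*-nonNeg (0≤-x x≤0) 0≤y) ⟩
    (- x) * y       ≡⟨ cong₂ _*_ p q ⟨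
    abs x * abs y   ∎
    where open ≡-Reasoning
  ... | inj₂ (x≤0 , p) | inj₂ (y≤0 , q) = begin
    abs (x * y)         ≡⟨ cong abs (solve 2 (λ x y → x :* y := (:- x) :* (:- y)) refl x y) ⟩
    abs ((- x) * (- y)) ≡⟨ abs-nonNeg-≡ (*-nonNeg (0≤-x x≤0) (0≤-x y≤0)) ⟩
    (- x) * (- y)       ≡⟨ cong₂ _*_ p q ⟨
    abs x * abs y       ∎
    where open ≡-Reasoning

  -- Natural powers and natural numbers

  ^-nonNeg : ∀ {x} n → 0# ≤ x → 0# ≤ x ^ n
  ^-nonNeg zero    0≤x = 0≤1
  ^-nonNeg (suc n) 0≤x = *-nonNeg 0≤x (^-nonNeg n 0≤x)

  ^-pos : ∀ {x} n → 0# < x → 0# < x ^ n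
  ^-pos zero    0<x = 0<1
  ^-pos (suc n) 0<x = *-pos 0<x (^-pos n 0<x)

  ^-mono-≤ : ∀ n {x y} → 0# ≤ x → x ≤ y → x ^ n ≤ y ^ n
  ^-mono-≤ zero    0≤x x≤y = ≤-refl
  ^-mono-≤ (suc n) 0≤x x≤y = *-mono-≤ 0≤x (^-nonNeg n (≤-trans 0≤x x≤y)) x≤y (^-mono-≤ n 0≤x x≤y)

  1^n : ∀ n → 1# ^ n ≡ 1#
  1^n zero    = refl
  1^n (suc n) = trans (*-identityˡ _) (1^n n)

  ^-≤1 : ∀ {x} n → 0# ≤ x → x ≤ 1# → x ^ n ≤ 1#
  ^-≤1 n 0≤x x≤1 = ≤-respʳ (1^n n) (^-mono-≤ n 0≤x x≤1)

  ^-≤-self : ∀ {x} n .{{_ : NonZero n}} → 0# ≤ x → x ≤ 1# → x ^ n ≤ x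
  ^-≤-self {x} (suc n) 0≤x x≤1 = ≤-respʳ (*-identityʳ x) (*-monoˡ-≤ 0≤x (^-≤1 n 0≤x x≤1))

  sq-cancel-≤ : ∀ {x y} → 0# ≤ y → x * x ≤ y * y → x ≤ y
  sq-cancel-≤ {x} {y} 0≤y xx≤yy = ≮⇒≥ λ y<x →
    <⇒≱ (<-≤-trans (*-monoˡ-< (≤-<-trans 0≤y y<x) y<x) xx≤yy) (*-monoʳ-≤ 0≤y (<⇒≤ y<x))

  fromℕ-+ : ∀ m n → fromℕ (m ℕ.+ n) ≡ fromℕ m + fromℕ n
  fromℕ-+ = ×-homo-+ 1#

  fromℕ-* : ∀ m n → fromℕ (m ℕ.* n) ≡ fromℕ m * fromℕ n
  fromℕ-* = ×1-homo-*

  fromℕ-^ : ∀ m n → fromℕ (m ℕ.^ n) ≡ fromℕ m ^ n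
  fromℕ-^ m zero    = +-identityʳ 1#
  fromℕ-^ m (suc n) = trans (fromℕ-* m (m ℕ.^ n)) (cong (fromℕ m *_) (fromℕ-^ m n))

  fromℕ-nonNeg : ∀ n → 0# ≤ fromℕ n
  fromℕ-nonNeg zero    = ≤-refl
  fromℕ-nonNeg (suc n) = +-nonNeg 0≤1 (fromℕ-nonNeg n)

  fromℕ-pos : ∀ n .{{_ : NonZero n}} → 0# < fromℕ n
  fromℕ-pos (suc n) = +-pos 0<1 (fromℕ-nonNeg n)

  fromℕ-mono-≤ : ∀ {m n} → m ℕ.≤ n → fromℕ m ≤ fromℕ n
  fromℕ-mono-≤ {n = n} z≤n = fromℕ-nonNeg n
  fromℕ-mono-≤ (s≤s m≤n)   = +-monoʳ-≤ 1# (fromℕ-mono-≤ m≤n)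

  -- Suprema

  -- Completeness is available only for predicates in Set; excluded middle resizes the others.
  complete′ : ∀ {ℓ} (P : Pred ℝ ℓ) → ∃[ x ] P x → ∃[ b ] UpperBound P b → ∃[ s ] IsLUB P s
  complete′ P (x , Px) (b , ub) =
    let s , s-ub , s-least = complete P′ (x , shrink Px) (b , λ y → ub y ∘ grow)
    in s , (λ y → s-ub y ∘ shrink) , λ c c-ub → s-least c (λ y → c-ub y ∘ grow)
    where
    resize : ∀ {p} {A : Set p} → Dec A → Set
    resize (yes _) = ⊤
    resize (no _)  = ⊥
    P′ : Pred ℝ 0ℓ
    P′ y = resize (lem {P = P y})
    shrink : ∀ {y} → P y → P′ y
    shrink {y} Py with lem {P = P y}
    ... | yes _  = _
    ... | no ¬Py = ¬Py Py
    grow : ∀ {y} → P′ y → P y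
    grow {y} h with lem {P = P y}
    ... | yes Py = Py

  the-satisfies : ∀ {ℓ} {P : Pred ℝ ℓ} → ∃[ x ] P x → P (the P)
  the-satisfies {P = P} ex with lem {P = ∃[ x ] P x}
  ... | yes (_ , Px) = Px
  ... | no ¬ex       = ⊥-elim (¬ex ex)

  the-unique : ∀ {ℓ} {P : Pred ℝ ℓ} {x} → (∀ {y} → P y → y ≡ x) → P x → the P ≡ x
  the-unique {P = P} uniq Px = uniq (the-satisfies {P = P} (_ , Px))

  sup-isLUB : ∀ {ℓ} {P : Pred ℝ ℓ} → ∃[ x ] P x → ∃[ b ] UpperBound P b → IsLUB P (sup P)
  sup-isLUB {P = P} ne bd = the-satisfies {P = IsLUB P} (complete′ P ne bd)

  sup-unique : ∀ {ℓ} {P : Pred ℝ ℓ} {s} → IsLUB P s → sup P ≡ s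
  sup-unique {s = s} lub = the-unique (λ (y-ub , y-least) → antisym (y-least s (proj₁ lub)) (proj₂ lub _ y-ub)) lub

  -- Otherwise the naturals would have a supremum s, and s - 1 would bound them as well, because n +
  -- 1 ≤ s for every n.
  archimedean : ∀ x → ∃[ n ] x < fromℕ n
  archimedean x with lem {P = ∃[ n ] x < fromℕ n}
  ... | yes found = found
  ... | no  none  = ⊥-elim (<⇒≱ (<-shift 0<1 (solve 1 (λ s → s :- (s :- con 1ℤ) := con 1ℤ :- con 0ℤ) refl s))
                     (s-least (s - 1#) λ { _ (n , refl) →
                       ≤-shift (s-ub (fromℕ (suc n)) (suc n , refl))
                         (solve 2 (λ s y → s :- con 1ℤ :- y := s :- (con 1ℤ :+ y)) refl _ _) }))
    where
    naturals = complete (λ y → ∃[ n ] y ≡ fromℕ n) (0# , 0 , refl)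
      (x , λ { _ (n , refl) → ≮⇒≥ (λ x<n → none (n , x<n)) })
    s = proj₁ naturals
    s-ub = proj₁ (proj₂ naturals)
    s-least = proj₂ (proj₂ naturals)

  archimedean-÷ : ∀ {x ε} → 0# < ε → ∃[ n ] NonZero n × x < fromℕ n * ε
  archimedean-÷ {x} {ε} 0<ε =
    let n , x/ε<n = archimedean (x ÷ ε) in
    suc n , _ , (begin-strict
      x           ≡⟨ [y÷x]*x x 0<ε ⟨
      x ÷ ε * ε   <⟨ *-monoʳ-< 0<ε x/ε<n ⟩
      fromℕ n * ε ≤⟨ *-monoʳ-≤ (<⇒≤ 0<ε) (fromℕ-mono-≤ (ℕₚ.n≤1+n n)) ⟩
      fromℕ (suc n) * ε ∎)
    where open ≤-Reasoning

  -- Finite sums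

  sum-mono : ∀ {n} {f g : Fin n → ℝ} → (∀ i → f i ≤ g i) → sum f ≤ sum g
  sum-mono {zero}  f≤g = ≤-refl
  sum-mono {suc n} f≤g = +-mono-≤ (f≤g zero) (sum-mono (f≤g ∘ suc))

  sum-nonNeg : ∀ {n} {f : Fin n → ℝ} → (∀ i → 0# ≤ f i) → 0# ≤ sum f
  sum-nonNeg {zero}  0≤f = ≤-refl
  sum-nonNeg {suc n} 0≤f = +-nonNeg (0≤f zero) (sum-nonNeg (0≤f ∘ suc))

  term≤sum : ∀ {n} {f : Fin n → ℝ} → (∀ i → 0# ≤ f i) → ∀ i → f i ≤ sum f
  term≤sum 0≤f zero    = x≤x+y _ (sum-nonNeg (0≤f ∘ suc))
  term≤sum 0≤f (suc i) = ≤-trans (term≤sum (0≤f ∘ suc) i) (y≤x+y _ (0≤f zero))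

  sum-const : ∀ n x → sum {n} (λ _ → x) ≡ fromℕ n * x
  sum-const zero    x = sym (zeroˡ x)
  sum-const (suc n) x = trans (cong (x +_) (sum-const n x))
    (solve 2 (λ x n → x :+ n :* x := (con 1ℤ :+ n) :* x) refl _ _)

  sum-zero : ∀ n → sum {n} (λ _ → 0#) ≡ 0#
  sum-zero n = trans (sum-const n 0#) (zeroʳ _)

  sum-all-zero : ∀ {n} {f : Fin n → ℝ} → (∀ i → 0# ≤ f i) → sum f ≡ 0# → ∀ i → f i ≡ 0#
  sum-all-zero 0≤f eq i = antisym (≤-respʳ eq (term≤sum 0≤f i)) (0≤f i)

  -- Limits of sequences

  ⟶-unique : ∀ {a L M} → a ⟶ L → a ⟶ M → L ≡ M
  ⟶-unique {a} {L} {M} a⟶L a⟶M = antisym (≤-if-≤+ε (bound a⟶L a⟶M)) (≤-if-≤+ε (bound a⟶M a⟶L))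
    where
    bound : ∀ {L M} → a ⟶ L → a ⟶ M → ∀ ε → 0# < ε → L ≤ M + ε
    bound {L} {M} p q ε 0<ε =
      let N₁ , h₁ = p (half ε) (half-pos 0<ε)
          N₂ , h₂ = q (half ε) (half-pos 0<ε)
          k = N₁ ℕ.⊔ N₂
          u = <⇒≤ (h₁ k (ℕₚ.m≤m⊔n N₁ N₂))
          v = <⇒≤ (h₂ k (ℕₚ.m≤n⊔m N₁ N₂))
      in ≤-shift (+-mono-≤ (≤-trans (-x≤abs (a k - L)) u) (≤-trans (x≤abs (a k - M)) v))
           (trans (cong (λ e → M + e - L) (sym (half+half ε)))
             (solve 4 (λ a L M h → M :+ (h :+ h) :- L := h :+ h :- (:- (a :- L) :+ (a :- M))) refl _ _ _ _))

  ⟶-ext : ∀ {a b L} → (∀ k → a k ≡ b k) → a ⟶ L → b ⟶ L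
  ⟶-ext a≗b a⟶L ε 0<ε =
    let N , h = a⟶L ε 0<ε in N , λ k N≤k → subst (λ x → abs (x - _) < ε) (a≗b k) (h k N≤k)

  ⟶-cong : ∀ {a L M} → L ≡ M → a ⟶ L → a ⟶ M
  ⟶-cong refl a⟶L = a⟶L

  ⟶-const : ∀ c → (λ _ → c) ⟶ c
  ⟶-const c ε 0<ε = 0 , λ _ _ → <-respˡ (sym (trans (cong abs (-‿inverseʳ c)) (abs-nonNeg-≡ ≤-refl))) 0<ε

  ⟶-+ : ∀ {a b L M} → a ⟶ L → b ⟶ M → (λ k → a k + b k) ⟶ (L + M)
  ⟶-+ {a} {b} {L} {M} a⟶L b⟶M ε 0<ε =
    let N₁ , h₁ = a⟶L (half ε) (half-pos 0<ε)
        N₂ , h₂ = b⟶M (half ε) (half-pos 0<ε)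
    in N₁ ℕ.⊔ N₂ , λ k N≤k → ≤-<-trans
         (≤-respˡ (cong abs (solve 4 (λ a b L M → (a :- L) :+ (b :- M) := a :+ b :- (L :+ M)) refl _ _ _ _))
           (abs-+ (a k - L) (b k - M)))
         (<-respʳ (half+half ε) (+-mono-< (h₁ k (ℕₚ.≤-trans (ℕₚ.m≤m⊔n N₁ N₂) N≤k)) (h₂ k (ℕₚ.≤-trans (ℕₚ.m≤n⊔m N₁ N₂) N≤k))))

  ⟶0-squeeze : ∀ {a b} → (∀ k → abs (a k) ≤ b k) → b ⟶ 0# → a ⟶ 0#
  ⟶0-squeeze {a} {b} a≤b b⟶0 ε 0<ε =
    let N , h = b⟶0 ε 0<ε in N , λ k N≤k → ≤-<-trans
      (≤-trans (≤-respˡ (cong abs (minus0 (a k))) (a≤b k)) (≤-respʳ (cong abs (minus0 (b k))) (x≤abs (b k)))) (h k N≤k)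
    where
    minus0 : ∀ x → x ≡ x - 0#
    minus0 = solve 1 (λ x → x := x :- con 0ℤ) refl

  ⟶-*ˡ : ∀ c {a L} → a ⟶ L → (λ k → c * a k) ⟶ (c * L)
  ⟶-*ˡ c {a} {L} a⟶L ε 0<ε =
    let N , h = a⟶L (ε ÷ (abs c + 1#)) (÷-pos 0<ε 0<c′) in N , λ k N≤k → begin-strict
      abs (c * a k - c * L)             ≡⟨ cong abs (solve 3 (λ c a L → c :* a :- c :* L := c :* (a :- L)) refl c (a k) L) ⟩
      abs (c * (a k - L))               ≡⟨ abs-* c (a k - L) ⟩
      abs c * abs (a k - L)             ≤⟨ *-monoʳ-≤ (abs-nonNeg _) (x≤x+y (abs c) 0≤1) ⟩
      (abs c + 1#) * abs (a k - L)      <⟨ *-monoˡ-< 0<c′ (h k N≤k) ⟩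
      (abs c + 1#) * (ε ÷ (abs c + 1#)) ≡⟨ x*[y÷x] ε 0<c′ ⟩
      ε                                 ∎
    where
    open ≤-Reasoning
    0<c′ : 0# < abs c + 1#
    0<c′ = <-respʳ (+-comm 1# _) (+-pos 0<1 (abs-nonNeg c))

  ⟶-minus : ∀ {a b L M} → a ⟶ L → b ⟶ M → (λ k → a k - b k) ⟶ (L - M)
  ⟶-minus {a} {b} {L} {M} a⟶L b⟶M = ⟶-cong (neg L M)
    (⟶-ext (λ k → neg (a k) (b k)) (⟶-+ a⟶L (⟶-*ˡ (- 1#) b⟶M)))
    where
    neg : ∀ x y → x + - 1# * y ≡ x - y
    neg = solve 2 (λ x y → x :+ (:- con 1ℤ) :* y := x :- y) refl

  ⟶-*0 : ∀ {a b} → a ⟶ 0# → b ⟶ 0# → (λ k → a k * b k) ⟶ 0#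
  ⟶-*0 {a} {b} a⟶0 b⟶0 ε 0<ε =
    let N₁ , h₁ = a⟶0 1# 0<1
        N₂ , h₂ = b⟶0 ε 0<ε
    in N₁ ℕ.⊔ N₂ , λ k N≤k → begin-strict
      abs (a k * b k - 0#)            ≡⟨ cong abs (solve 2 (λ a b → a :* b :- con 0ℤ := (a :- con 0ℤ) :* (b :- con 0ℤ)) refl _ _) ⟩
      abs ((a k - 0#) * (b k - 0#))   ≡⟨ abs-* _ _ ⟩
      abs (a k - 0#) * abs (b k - 0#) ≤⟨ *-monoʳ-≤ (abs-nonNeg _) (<⇒≤ (h₁ k (ℕₚ.≤-trans (ℕₚ.m≤m⊔n N₁ N₂) N≤k))) ⟩
      1# * abs (b k - 0#)             ≡⟨ *-identityˡ _ ⟩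
      abs (b k - 0#)                  <⟨ h₂ k (ℕₚ.≤-trans (ℕₚ.m≤n⊔m N₁ N₂) N≤k) ⟩
      ε                               ∎
    where open ≤-Reasoning

  -- Writing ab = (a - L)(b - M) + Lb + (Ma - ML) leaves a product of two null sequences and linear
  -- terms.
  ⟶-* : ∀ {a b L M} → a ⟶ L → b ⟶ M → (λ k → a k * b k) ⟶ (L * M)
  ⟶-* {a} {b} {L} {M} a⟶L b⟶M = ⟶-cong
    (solve 2 (λ L M → con 0ℤ :+ (L :* M :+ (M :* L :- M :* L)) := L :* M) refl L M)
    (⟶-ext (λ k → solve 4 (λ a b L M → (a :- L) :* (b :- M) :+ (L :* b :+ (M :* a :- M :* L)) := a :* b) refl _ _ _ _)
      (⟶-+ (⟶-*0 (to0 a⟶L) (to0 b⟶M)) (⟶-+ (⟶-*ˡ L b⟶M) (⟶-minus (⟶-*ˡ M a⟶L) (⟶-const (M * L))))))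
    where
    to0 : ∀ {a L} → a ⟶ L → (λ k → a k - L) ⟶ 0#
    to0 {a} {L} a⟶L = ⟶-cong (-‿inverseʳ L) (⟶-minus a⟶L (⟶-const L))

  ⟶-lower : ∀ {a L c} N → (∀ k → N ℕ.≤ k → c ≤ a k) → a ⟶ L → c ≤ L
  ⟶-lower {a} {L} {c} N c≤a a⟶L = ≤-if-≤+ε λ ε 0<ε →
    let N′ , h = a⟶L ε 0<ε
        k = N ℕ.⊔ N′
    in ≤-shift (+-mono-≤ (c≤a k (ℕₚ.m≤m⊔n N N′)) (≤-trans (x≤abs (a k - L)) (<⇒≤ (h k (ℕₚ.m≤n⊔m N N′)))))
         (solve 4 (λ a c L e → L :+ e :- c := a :+ e :- (c :+ (a :- L))) refl (a k) c L ε)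

  ⟶-upper : ∀ {a L c} → (∀ k → a k ≤ c) → a ⟶ L → L ≤ c
  ⟶-upper {a} {L} {c} a≤c a⟶L = ≤-if-≤+ε λ ε 0<ε →
    let N , h = a⟶L ε 0<ε in
    ≤-shift (+-mono-≤ (a≤c N) (≤-trans (-x≤abs (a N - L)) (<⇒≤ (h N ℕₚ.≤-refl))))
      (solve 4 (λ a c L e → c :+ e :- L := c :+ e :- (a :+ :- (a :- L))) refl (a N) c L ε)

  ⟶-subsequence : ∀ {a L} (f : ℕ → ℕ) → (∀ k → k ℕ.≤ f k) → a ⟶ L → (a ∘ f) ⟶ L
  ⟶-subsequence f k≤f a⟶L ε 0<ε =
    let N , h = a⟶L ε 0<ε in N , λ k N≤k → h (f k) (ℕₚ.≤-trans N≤k (k≤f k))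

  Increasing : (ℕ → ℝ) → Set
  Increasing a = ∀ k → a k ≤ a (suc k)

  increasing-mono : ∀ {a} → Increasing a → ∀ {j k} → j ℕ.≤ k → a j ≤ a k
  increasing-mono {a} inc j≤k = go (ℕₚ.≤⇒≤′ j≤k)
    where
    go : ∀ {j k} → j ℕ.≤′ k → a j ≤ a k
    go ℕ.≤′-refl       = ≤-refl
    go (ℕ.≤′-step j≤k) = ≤-trans (go j≤k) (inc _)

  increasing⇒convergent : ∀ {a B} → Increasing a → (∀ k → a k ≤ B) → ∃[ L ] a ⟶ L
  increasing⇒convergent {a} {B} inc a≤B = L , converges
    where
    Term : Pred ℝ 0ℓ
    Term x = ∃[ k ] x ≡ a k
    lub = complete Term (a 0 , 0 , refl) (B , λ { _ (k , refl) → a≤B k })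
    L = proj₁ lub
    converges : a ⟶ L
    converges ε 0<ε with lem {P = ∃[ k ] L - ε < a k}
    ... | yes (k , L-ε<a) = k , λ j k≤j → abs-<
      (≤-<-trans (≤-shift (proj₁ (proj₂ lub) (a j) (j , refl)) (solve 2 (λ a L → con 0ℤ :- (a :- L) := L :- a) refl (a j) L)) 0<ε)
      (<-shift (<-≤-trans L-ε<a (increasing-mono inc k≤j)) (solve 3 (λ a L e → e :- :- (a :- L) := a :- (L :- e)) refl (a j) L ε))
    ... | no none = ⊥-elim (<⇒≱ (<-shift 0<ε (solve 2 (λ L e → L :- (L :- e) := e :- con 0ℤ) refl L ε))
      (proj₂ (proj₂ lub) (L - ε) λ { _ (k , refl) → ≮⇒≥ (λ h → none (k , h)) }))

  -- Partial sums

  -- Adds the last term last, whereas `sum` splits off the first one; passing from k to k + 1 terms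
  -- is then definitional.
  partial : (ℕ → ℝ) → ℕ → ℝ
  partial f zero    = 0#
  partial f (suc k) = partial f k + f k

  partial-tail : ∀ f k → partial f (suc k) ≡ f 0 + partial (f ∘ suc) k
  partial-tail f zero    = +-comm 0# (f 0)
  partial-tail f (suc k) = trans (cong (_+ f (suc k)) (partial-tail f k)) (+-assoc _ _ _)

  sum≡partial : ∀ f k → sum {k} (λ i → f (toℕ i)) ≡ partial f k
  sum≡partial f zero    = refl
  sum≡partial f (suc k) = trans (cong (f 0 +_) (sum≡partial (f ∘ suc) k)) (sym (partial-tail f k))

  partial-cong : ∀ {f g} k → (∀ i → i ℕ.< k → f i ≡ g i) → partial f k ≡ partial g k
  partial-cong zero    f≗g = refl
  partial-cong (suc k) f≗g = cong₂ _+_ (partial-cong k λ i i<k → f≗g i (ℕₚ.m<n⇒m<1+n i<k)) (f≗g k ℕₚ.≤-refl)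

  partial-mono : ∀ {f g} k → (∀ i → i ℕ.< k → f i ≤ g i) → partial f k ≤ partial g k
  partial-mono zero    f≤g = ≤-refl
  partial-mono (suc k) f≤g = +-mono-≤ (partial-mono k λ i i<k → f≤g i (ℕₚ.m<n⇒m<1+n i<k)) (f≤g k ℕₚ.≤-refl)

  partial-+ : ∀ f g k → partial (λ i → f i + g i) k ≡ partial f k + partial g k
  partial-+ f g zero    = sym (+-identityˡ 0#)
  partial-+ f g (suc k) = trans (cong (_+ (f k + g k)) (partial-+ f g k))
    (solve 4 (λ a b x y → a :+ b :+ (x :+ y) := a :+ x :+ (b :+ y)) refl _ _ _ _)

  partial-*ˡ : ∀ c f k → partial (λ i → c * f i) k ≡ c * partial f k
  partial-*ˡ c f zero    = sym (zeroʳ c)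
  partial-*ˡ c f (suc k) = trans (cong (_+ c * f k) (partial-*ˡ c f k)) (sym (distribˡ c (partial f k) (f k)))

  partial-minus : ∀ f g k → partial (λ i → f i - g i) k ≡ partial f k - partial g k
  partial-minus f g zero    = sym (-‿inverseʳ 0#)
  partial-minus f g (suc k) = trans (cong (_+ (f k - g k)) (partial-minus f g k))
    (solve 4 (λ a b x y → a :- b :+ (x :- y) := a :+ x :- (b :+ y)) refl _ _ _ _)

  partial-increasing : ∀ {f} → (∀ i → 0# ≤ f i) → Increasing (partial f)
  partial-increasing 0≤f k = x≤x+y _ (0≤f k)

  abs-partial : ∀ f k → abs (partial f k) ≤ partial (abs ∘ f) k
  abs-partial f zero    = ≤-reflexive (abs-nonNeg-≡ ≤-refl)
  abs-partial f (suc k) = ≤-trans (abs-+ _ _) (+-monoˡ-≤ _ (abs-partial f k))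

  abs-partial-difference : ∀ f {j k} → j ℕ.≤ k →
    abs (partial f k - partial f j) ≤ partial (abs ∘ f) k - partial (abs ∘ f) j
  abs-partial-difference f j≤k = go (ℕₚ.≤⇒≤′ j≤k)
    where
    open ≤-Reasoning
    go : ∀ {j k} → j ℕ.≤′ k → abs (partial f k - partial f j) ≤ partial (abs ∘ f) k - partial (abs ∘ f) j
    go {j} ℕ.≤′-refl = begin
      abs (partial f j - partial f j)           ≡⟨ cong abs (-‿inverseʳ _) ⟩
      abs 0#                                    ≡⟨ abs-nonNeg-≡ ≤-refl ⟩
      0#                                        ≡⟨ -‿inverseʳ _ ⟨
      partial (abs ∘ f) j - partial (abs ∘ f) j ∎
    go {j} {suc k} (ℕ.≤′-step j≤k) = begin
      abs (partial f k + f k - partial f j)       ≡⟨ cong abs (solve 3 (λ a b c → a :+ b :- c := (a :- c) :+ b) refl _ _ _) ⟩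
      abs ((partial f k - partial f j) + f k)     ≤⟨ abs-+ _ _ ⟩
      abs (partial f k - partial f j) + abs (f k) ≤⟨ +-monoˡ-≤ _ (go j≤k) ⟩
      partial (abs ∘ f) k - partial (abs ∘ f) j + abs (f k) ≡⟨ solve 3 (λ a b c → a :- c :+ b := a :+ b :- c) refl _ _ _ ⟩
      partial (abs ∘ f) k + abs (f k) - partial (abs ∘ f) j ∎

  -- Cauchy products

  convolution : (ℕ → ℝ) → (ℕ → ℝ) → ℕ → ℝ
  convolution f g m = partial (λ i → f i * g (m ℕ.∸ i)) (suc m)

  -- The sum of f i * g j over the pairs with i + j < N, arranged by rows.
  triangle : (ℕ → ℝ) → (ℕ → ℝ) → ℕ → ℝ
  triangle f g N = partial (λ i → f i * partial g (N ℕ.∸ i)) N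

  -- From N to N + 1 each row i ≤ N gains the entry f i * g (N - i), and these entries together form
  -- one term of the convolution.
  triangle≡convolutions : ∀ f g N → triangle f g N ≡ partial (convolution f g) N
  triangle≡convolutions f g zero    = refl
  triangle≡convolutions f g (suc N) = begin
    partial (λ i → f i * partial g (suc N ℕ.∸ i)) (suc N) ≡⟨ partial-cong (suc N) split ⟩
    partial (λ i → f i * partial g (N ℕ.∸ i) + f i * g (N ℕ.∸ i)) (suc N) ≡⟨ partial-+ _ _ (suc N) ⟩
    (triangle f g N + f N * partial g (N ℕ.∸ N)) + convolution f g N
      ≡⟨ cong (λ z → triangle f g N + f N * z + convolution f g N) (cong (partial g) (ℕₚ.n∸n≡0 N)) ⟩
    (triangle f g N + f N * 0#) + convolution f g N
      ≡⟨ cong (_+ convolution f g N) (trans (cong (triangle f g N +_) (zeroʳ (f N))) (+-identityʳ _)) ⟩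
    triangle f g N + convolution f g N ≡⟨ cong (_+ convolution f g N) (triangle≡convolutions f g N) ⟩
    partial (convolution f g) N + convolution f g N ∎
    where
    open ≡-Reasoning
    split : ∀ i → i ℕ.< suc N → f i * partial g (suc N ℕ.∸ i) ≡ f i * partial g (N ℕ.∸ i) + f i * g (N ℕ.∸ i)
    split i (s≤s i≤N) rewrite ℕₚ.+-∸-assoc 1 i≤N = distribˡ (f i) _ _

  product-triangle : ∀ f g N → partial f N * partial g N - triangle f g N
    ≡ partial (λ i → f i * (partial g N - partial g (N ℕ.∸ i))) N
  product-triangle f g N = begin
    partial f N * partial g N - triangle f g N ≡⟨ cong (_- triangle f g N) (trans (*-comm _ _) (sym (partial-*ˡ (partial g N) f N))) ⟩
    partial (λ i → partial g N * f i) N - triangle f g N ≡⟨ partial-minus _ _ N ⟨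
    partial (λ i → partial g N * f i - f i * partial g (N ℕ.∸ i)) N
      ≡⟨ partial-cong N (λ i _ → solve 3 (λ a b c → b :* a :- a :* c := a :* (b :- c)) refl _ _ _) ⟩
    partial (λ i → f i * (partial g N - partial g (N ℕ.∸ i))) N ∎
    where open ≡-Reasoning

  -- Square minus triangle is the sum over the pairs with i, j < N ≤ i + j, so the triangle
  -- inequality bounds it by the same difference for the absolute values.
  product-triangle-abs : ∀ f g N → abs (partial f N * partial g N - triangle f g N)
    ≤ partial (abs ∘ f) N * partial (abs ∘ g) N - triangle (abs ∘ f) (abs ∘ g) N
  product-triangle-abs f g N = begin
    abs (partial f N * partial g N - triangle f g N) ≡⟨ cong abs (product-triangle f g N) ⟩
    abs (partial (λ i → f i * (partial g N - partial g (N ℕ.∸ i))) N) ≤⟨ abs-partial _ N ⟩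
    partial (λ i → abs (f i * (partial g N - partial g (N ℕ.∸ i)))) N ≤⟨ partial-mono N step ⟩
    partial (λ i → abs (f i) * (partial (abs ∘ g) N - partial (abs ∘ g) (N ℕ.∸ i))) N ≡⟨ product-triangle (abs ∘ f) (abs ∘ g) N ⟨
    partial (abs ∘ f) N * partial (abs ∘ g) N - triangle (abs ∘ f) (abs ∘ g) N ∎
    where
    open ≤-Reasoning
    step : ∀ i → i ℕ.< N → abs (f i * (partial g N - partial g (N ℕ.∸ i)))
      ≤ abs (f i) * (partial (abs ∘ g) N - partial (abs ∘ g) (N ℕ.∸ i))
    step i _ = ≤-respˡ (sym (abs-* _ _)) (*-monoˡ-≤ (abs-nonNeg (f i)) (abs-partial-difference g (ℕₚ.m∸n≤m N i)))

  -- The square of side N lies in the triangle of side 2N.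
  product≤triangle : ∀ {f g} → (∀ i → 0# ≤ f i) → (∀ i → 0# ≤ g i) → ∀ N →
    partial f N * partial g N ≤ triangle f g (N ℕ.+ N)
  product≤triangle {f} {g} 0≤f 0≤g N = begin
    partial f N * partial g N           ≡⟨ trans (*-comm _ _) (sym (partial-*ˡ (partial g N) f N)) ⟩
    partial (λ i → partial g N * f i) N ≤⟨ partial-mono N step ⟩
    partial (λ i → f i * partial g ((N ℕ.+ N) ℕ.∸ i)) N
      ≤⟨ increasing-mono (partial-increasing λ i → *-nonNeg (0≤f i) (partial-nonNeg (N ℕ.+ N ℕ.∸ i))) (ℕₚ.m≤m+n N N) ⟩
    triangle f g (N ℕ.+ N)              ∎
    where
    open ≤-Reasoning
    partial-nonNeg : ∀ k → 0# ≤ partial g k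
    partial-nonNeg k = increasing-mono (partial-increasing 0≤g) {0} {k} z≤n
    step : ∀ i → i ℕ.< N → partial g N * f i ≤ f i * partial g ((N ℕ.+ N) ℕ.∸ i)
    step i i<N = ≤-respˡ (*-comm _ _) (*-monoˡ-≤ (0≤f i) (increasing-mono (partial-increasing 0≤g)
      (ℕₚ.m+n≤o⇒m≤o∸n N (ℕₚ.+-monoʳ-≤ N (ℕₚ.<⇒≤ i<N)))))

  -- The exponential series

  expTerm : ℝ → ℕ → ℝ
  expTerm x i = x ^ i ÷ fromℕ (i !)

  fromℕ!-pos : ∀ i → 0# < fromℕ (i !)
  fromℕ!-pos i = fromℕ-pos (i !) {{i ℕₚ.!≢0}}

  ⁻¹-* : ∀ {x y} → 0# < x → 0# < y → (x * y) ⁻¹ ≡ x ⁻¹ * y ⁻¹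
  ⁻¹-* {x} {y} 0<x 0<y = *-cancelˡ (x * y) (>⇒≢0 (*-pos 0<x 0<y)) (begin
    x * y * (x * y) ⁻¹    ≡⟨ x*x⁻¹ (*-pos 0<x 0<y) ⟩
    1#                    ≡⟨ *-identityˡ 1# ⟨
    1# * 1#               ≡⟨ cong₂ _*_ (x*x⁻¹ 0<x) (x*x⁻¹ 0<y) ⟨
    x * x ⁻¹ * (y * y ⁻¹) ≡⟨ solve 4 (λ x y i j → x :* i :* (y :* j) := x :* y :* (i :* j)) refl _ _ _ _ ⟩
    x * y * (x ⁻¹ * y ⁻¹)     ∎)
    where open ≡-Reasoning

  -- This recurrence keeps factorials and binomial coefficients out of the product formula and of
  -- the halving estimate.
  expTerm-suc : ∀ x i → fromℕ (suc i) * expTerm x (suc i) ≡ x * expTerm x i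
  expTerm-suc x i = begin
    n * (x * x ^ i * fromℕ (suc i ℕ.* i !) ⁻¹) ≡⟨ cong (λ z → n * (x * x ^ i * z ⁻¹)) (fromℕ-* (suc i) (i !)) ⟩
    n * (x * x ^ i * (n * f) ⁻¹)               ≡⟨ cong (λ z → n * (x * x ^ i * z)) (⁻¹-* (fromℕ-pos (suc i)) (fromℕ!-pos i)) ⟩
    n * (x * x ^ i * (n ⁻¹ * f ⁻¹))            ≡⟨ solve 5 (λ n x p m f → n :* (x :* p :* (m :* f)) := n :* m :* (x :* (p :* f))) refl _ _ _ _ _ ⟩
    n * n ⁻¹ * (x * (x ^ i * f ⁻¹))            ≡⟨ cong (_* (x * (x ^ i * f ⁻¹))) (x*x⁻¹ (fromℕ-pos (suc i))) ⟩
    1# * (x * (x ^ i * f ⁻¹))                  ≡⟨ *-identityˡ _ ⟩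
    x * (x ^ i * f ⁻¹)                         ∎
    where
    open ≡-Reasoning
    n = fromℕ (suc i)
    f = fromℕ (i !)

  expTerm-zero : ∀ x → expTerm x 0 ≡ 1#
  expTerm-zero x = trans (cong (λ z → 1# * z ⁻¹) (+-identityʳ 1#)) (x*x⁻¹ 0<1)

  abs-expTerm : ∀ x i → abs (expTerm x i) ≡ expTerm (abs x) i
  abs-expTerm x i = trans (abs-* _ _) (cong₂ _*_ (abs-^ i) (abs-nonNeg-≡ (<⇒≤ (⁻¹-pos (fromℕ!-pos i)))))
    where
    abs-^ : ∀ i → abs (x ^ i) ≡ abs x ^ i
    abs-^ zero    = abs-nonNeg-≡ 0≤1
    abs-^ (suc i) = trans (abs-* x _) (cong (abs x *_) (abs-^ i))

  expTerm-nonNeg : ∀ {x} i → 0# ≤ x → 0# ≤ expTerm x i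
  expTerm-nonNeg i 0≤x = ÷-nonNeg (^-nonNeg i 0≤x) (fromℕ!-pos i)

  -- Both sides satisfy (m + 1) c (m + 1) = (x + y) c m.
  convolution-expTerm : ∀ x y m → convolution (expTerm x) (expTerm y) m ≡ expTerm (x + y) m
  convolution-expTerm x y zero = begin
    0# + expTerm x 0 * expTerm y 0 ≡⟨ +-identityˡ _ ⟩
    expTerm x 0 * expTerm y 0      ≡⟨ cong₂ _*_ (expTerm-zero x) (expTerm-zero y) ⟩
    1# * 1#                        ≡⟨ *-identityˡ 1# ⟩
    1#                             ≡⟨ expTerm-zero (x + y) ⟨
    expTerm (x + y) 0              ∎
    where open ≡-Reasoning
  convolution-expTerm x y (suc m) = *-cancelˡ (fromℕ (suc m)) (>⇒≢0 (fromℕ-pos (suc m))) (begin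
    fromℕ (suc m) * convolution a b (suc m)
      ≡⟨ sym (partial-*ˡ (fromℕ (suc m)) _ (suc (suc m))) ⟩
    partial (λ i → fromℕ (suc m) * (a i * b (suc m ℕ.∸ i))) (suc (suc m))
      ≡⟨ partial-cong (suc (suc m)) split ⟩
    partial (λ i → fromℕ i * a i * b (suc m ℕ.∸ i) + a i * (fromℕ (suc m ℕ.∸ i) * b (suc m ℕ.∸ i))) (suc (suc m))
      ≡⟨ partial-+ _ _ (suc (suc m)) ⟩
    partial (λ i → fromℕ i * a i * b (suc m ℕ.∸ i)) (suc (suc m)) + partial (λ i → a i * (fromℕ (suc m ℕ.∸ i) * b (suc m ℕ.∸ i))) (suc (suc m))
      ≡⟨ cong₂ _+_ left right ⟩
    x * convolution a b m + y * convolution a b m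
      ≡⟨ sym (distribʳ _ x y) ⟩
    (x + y) * convolution a b m
      ≡⟨ cong ((x + y) *_) (convolution-expTerm x y m) ⟩
    (x + y) * expTerm (x + y) m
      ≡⟨ sym (expTerm-suc (x + y) m) ⟩
    fromℕ (suc m) * expTerm (x + y) (suc m) ∎)
    where
    open ≡-Reasoning
    a = expTerm x
    b = expTerm y
    -- The factor m + 1 is i + (m + 1 - i), and each summand lowers the index of one of the two
    -- factors by `expTerm-suc`.
    split : ∀ i → i ℕ.< suc (suc m) → fromℕ (suc m) * (a i * b (suc m ℕ.∸ i))
      ≡ fromℕ i * a i * b (suc m ℕ.∸ i) + a i * (fromℕ (suc m ℕ.∸ i) * b (suc m ℕ.∸ i))
    split i (s≤s i≤1+m) = trans
      (cong (λ z → z * (a i * b (suc m ℕ.∸ i))) (trans (cong fromℕ (sym (ℕₚ.m+[n∸m]≡n i≤1+m))) (fromℕ-+ i (suc m ℕ.∸ i))))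
      (solve 4 (λ p q a b → (p :+ q) :* (a :* b) := p :* a :* b :+ a :* (q :* b)) refl _ _ _ _)
    left : partial (λ i → fromℕ i * a i * b (suc m ℕ.∸ i)) (suc (suc m)) ≡ x * convolution a b m
    left = begin
      partial (λ i → fromℕ i * a i * b (suc m ℕ.∸ i)) (suc (suc m)) ≡⟨ partial-tail _ (suc m) ⟩
      0# * a 0 * b (suc m) + partial (λ i → fromℕ (suc i) * a (suc i) * b (m ℕ.∸ i)) (suc m)
        ≡⟨ cong₂ _+_ (trans (*-assoc _ _ _) (zeroˡ _)) (partial-cong (suc m) λ i _ → trans (cong (_* b (m ℕ.∸ i)) (expTerm-suc x i)) (*-assoc _ _ _)) ⟩
      0# + partial (λ i → x * (a i * b (m ℕ.∸ i))) (suc m) ≡⟨ +-identityˡ _ ⟩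
      partial (λ i → x * (a i * b (m ℕ.∸ i))) (suc m) ≡⟨ partial-*ˡ x _ (suc m) ⟩
      x * convolution a b m ∎
    right : partial (λ i → a i * (fromℕ (suc m ℕ.∸ i) * b (suc m ℕ.∸ i))) (suc (suc m)) ≡ y * convolution a b m
    right = begin
      partial (λ i → a i * (fromℕ (suc m ℕ.∸ i) * b (suc m ℕ.∸ i))) (suc m) + a (suc m) * (fromℕ (m ℕ.∸ m) * b (m ℕ.∸ m))
        ≡⟨ cong₂ _+_ (partial-cong (suc m) shift) (cong (a (suc m) *_) (trans (cong (λ k → fromℕ k * b (m ℕ.∸ m)) (ℕₚ.n∸n≡0 m)) (zeroˡ _))) ⟩
      partial (λ i → y * (a i * b (m ℕ.∸ i))) (suc m) + a (suc m) * 0#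
        ≡⟨ cong₂ _+_ (partial-*ˡ y _ (suc m)) (zeroʳ _) ⟩
      y * convolution a b m + 0#
        ≡⟨ +-identityʳ _ ⟩
      y * convolution a b m ∎
      where
      shift : ∀ i → i ℕ.< suc m → a i * (fromℕ (suc m ℕ.∸ i) * b (suc m ℕ.∸ i)) ≡ y * (a i * b (m ℕ.∸ i))
      shift i (s≤s i≤m) rewrite ℕₚ.+-∸-assoc 1 i≤m = trans (cong (a i *_) (expTerm-suc y (m ℕ.∸ i)))
        (solve 3 (λ a y b → a :* (y :* b) := y :* (a :* b)) refl _ _ _)

  expSeries : ℝ → ℕ → ℝ
  expSeries x = partial (expTerm x)

  -- Beyond index 2 x each term is at most half of the previous one.
  expSeries-bounded : ∀ {x} → 0# ≤ x → ∃[ B ] (∀ k → expSeries x k ≤ B)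
  expSeries-bounded {x} 0≤x =
    let M , 2x<M = archimedean (2# * x) in
    expSeries x M + 2# * expTerm x M , λ k → begin
      expSeries x k                    ≤⟨ increasing-mono (partial-increasing (λ i → expTerm-nonNeg i 0≤x)) (ℕₚ.m≤m+n k M) ⟩
      expSeries x (k ℕ.+ M)            ≤⟨ x≤x+y _ (*-nonNeg (<⇒≤ 0<2) (expTerm-nonNeg (k ℕ.+ M) 0≤x)) ⟩
      expSeries x (k ℕ.+ M) + 2# * expTerm x (k ℕ.+ M) ≤⟨ tail M (<⇒≤ 2x<M) k ⟩
      expSeries x M + 2# * expTerm x M ∎
    where
    open ≤-Reasoning
    halving : ∀ i → 2# * x ≤ fromℕ i → 2# * expTerm x (suc i) ≤ expTerm x i
    halving i 2x≤i = *-cancelˡ-≤ (fromℕ-pos (suc i)) (begin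
      fromℕ (suc i) * (2# * expTerm x (suc i)) ≡⟨ solve 3 (λ a b c → a :* (b :* c) := b :* (a :* c)) refl _ _ _ ⟩
      2# * (fromℕ (suc i) * expTerm x (suc i)) ≡⟨ cong (2# *_) (expTerm-suc x i) ⟩
      2# * (x * expTerm x i)                   ≡⟨ *-assoc _ _ _ ⟨
      2# * x * expTerm x i                     ≤⟨ *-monoʳ-≤ (expTerm-nonNeg i 0≤x) (≤-trans 2x≤i (fromℕ-mono-≤ (ℕₚ.n≤1+n i))) ⟩
      fromℕ (suc i) * expTerm x i                 ∎)
    -- Partial sum plus twice the next term does not increase beyond M, because twice the following
    -- term is at most that next term.
    tail : ∀ M → 2# * x ≤ fromℕ M → ∀ k → expSeries x (k ℕ.+ M) + 2# * expTerm x (k ℕ.+ M) ≤ expSeries x M + 2# * expTerm x M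
    tail M 2x≤M zero    = ≤-refl
    tail M 2x≤M (suc k) = begin
      s + t + 2# * expTerm x (suc (k ℕ.+ M)) ≤⟨ +-monoʳ-≤ (s + t) (halving (k ℕ.+ M) (≤-trans 2x≤M (fromℕ-mono-≤ (ℕₚ.m≤n+m M k)))) ⟩
      s + t + t                              ≡⟨ solve 2 (λ s t → s :+ t :+ t := s :+ (con 1ℤ :+ con 1ℤ) :* t) refl s t ⟩
      s + 2# * t                             ≤⟨ tail M 2x≤M k ⟩
      expSeries x M + 2# * expTerm x M       ∎
      where
      s = expSeries x (k ℕ.+ M)
      t = expTerm x (k ℕ.+ M)

  -- For negative x the series for x + |x| has nonnegative terms.
  expSeries-convergent : ∀ x → ∃[ L ] expSeries x ⟶ L
  expSeries-convergent x =
    let B , bound = expSeries-bounded (abs-nonNeg x)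
        L , toL = increasing⇒convergent (partial-increasing (λ i → expTerm-nonNeg i (abs-nonNeg x))) bound
        M , toM = increasing⇒convergent {B = B + B} (partial-increasing nonNeg) (λ k →
          ≤-trans (partial-mono k (λ i _ → +-monoˡ-≤ _ (term≤ i)))
            (≤-respˡ (sym (partial-+ _ _ k)) (+-mono-≤ (bound k) (bound k))))
    in M - L , ⟶-ext (λ k → trans (cong (_- expSeries (abs x) k) (partial-+ (expTerm x) (expTerm (abs x)) k))
                          (solve 2 (λ a b → a :+ b :- b := a) refl _ _))
                 (⟶-minus toM toL)
    where
    term≤ : ∀ i → expTerm x i ≤ expTerm (abs x) i
    term≤ i = ≤-respʳ (abs-expTerm x i) (x≤abs _)
    nonNeg : ∀ i → 0# ≤ expTerm x i + expTerm (abs x) i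
    nonNeg i = ≤-shift (≤-respʳ (abs-expTerm x i) (-x≤abs (expTerm x i)))
      (solve 2 (λ a b → a :+ b :- con 0ℤ := b :- :- a) refl _ _)

  exp-limit : ∀ x → expSeries x ⟶ exp x
  exp-limit x = ⟶-ext (sum≡partial (expTerm x))
    (the-satisfies {P = λ L → (λ k → sum {k} (λ i → expTerm x (toℕ i))) ⟶ L}
      (let L , lim = expSeries-convergent x in L , ⟶-ext (sym ∘ sum≡partial (expTerm x)) lim))

  -- The product of the partial sums at x and y differs from the partial sum at x + y by at most
  -- what the series at |x| + |y| gains between N and 2N terms, and this gain tends to 0.
  exp-+ : ∀ x y → exp (x + y) ≡ exp x * exp y
  exp-+ x y = sym (⟶-unique (⟶-* (exp-limit x) (exp-limit y))
    (⟶-cong (+-identityˡ _) (⟶-ext (λ k → solve 2 (λ a b → a :- b :+ b := a) refl _ _)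
      (⟶-+ difference (exp-limit (x + y))))))
    where
    u v : ℝ
    u = abs x
    v = abs y
    triangle-expSeries : ∀ x y N → triangle (expTerm x) (expTerm y) N ≡ expSeries (x + y) N
    triangle-expSeries x y N = trans (triangle≡convolutions (expTerm x) (expTerm y) N) (partial-cong N (λ i _ → convolution-expTerm x y i))
    triangle-abs : ∀ N → triangle (abs ∘ expTerm x) (abs ∘ expTerm y) N ≡ expSeries (u + v) N
    triangle-abs N = trans (partial-cong N (λ i _ → cong₂ _*_ (abs-expTerm x i) (partial-cong (N ℕ.∸ i) (λ j _ → abs-expTerm y j))))
      (triangle-expSeries u v N)
    nonNeg : ∀ {x} i → 0# ≤ abs (expTerm x i)
    nonNeg i = abs-nonNeg _
    bound : ∀ N → abs (expSeries x N * expSeries y N - expSeries (x + y) N) ≤ expSeries (u + v) (N ℕ.+ N) - expSeries (u + v) N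
    bound N = begin
      abs (expSeries x N * expSeries y N - expSeries (x + y) N)
        ≡⟨ cong (λ z → abs (expSeries x N * expSeries y N - z)) (triangle-expSeries x y N) ⟨
      abs (expSeries x N * expSeries y N - triangle (expTerm x) (expTerm y) N) ≤⟨ product-triangle-abs (expTerm x) (expTerm y) N ⟩
      partial (abs ∘ expTerm x) N * partial (abs ∘ expTerm y) N - triangle (abs ∘ expTerm x) (abs ∘ expTerm y) N
        ≤⟨ +-monoˡ-≤ _ (product≤triangle nonNeg nonNeg N) ⟩
      triangle (abs ∘ expTerm x) (abs ∘ expTerm y) (N ℕ.+ N) - triangle (abs ∘ expTerm x) (abs ∘ expTerm y) N
        ≡⟨ cong₂ _-_ (triangle-abs (N ℕ.+ N)) (triangle-abs N) ⟩
      expSeries (u + v) (N ℕ.+ N) - expSeries (u + v) N ∎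
      where open ≤-Reasoning
    difference : (λ N → expSeries x N * expSeries y N - expSeries (x + y) N) ⟶ 0#
    difference = ⟶0-squeeze bound (⟶-cong (-‿inverseʳ _)
      (⟶-minus (⟶-subsequence (λ N → N ℕ.+ N) (λ N → ℕₚ.m≤m+n N N) (exp-limit (u + v))) (exp-limit (u + v))))

  1+x≤exp : ∀ {x} → 0# ≤ x → 1# + x ≤ exp x
  1+x≤exp {x} 0≤x = ⟶-lower 2 (λ k 2≤k → ≤-respˡ two (increasing-mono (partial-increasing (λ i → expTerm-nonNeg i 0≤x)) 2≤k)) (exp-limit x)
    where
    open ≡-Reasoning
    two : expSeries x 2 ≡ 1# + x
    two = begin
      0# + expTerm x 0 + expTerm x 1  ≡⟨ cong₂ (λ a b → 0# + a + b) (expTerm-zero x) (sym (*-identityˡ _)) ⟩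
      0# + 1# + 1# * expTerm x 1      ≡⟨ cong (0# + 1# +_) (cong (_* expTerm x 1) (+-identityʳ 1#)) ⟨
      0# + 1# + fromℕ 1 * expTerm x 1 ≡⟨ cong (0# + 1# +_) (expTerm-suc x 0) ⟩
      0# + 1# + x * expTerm x 0       ≡⟨ cong₂ _+_ (+-identityˡ 1#) (trans (cong (x *_) (expTerm-zero x)) (*-identityʳ x)) ⟩
      1# + x                          ∎

  exp-0 : exp 0# ≡ 1#
  exp-0 = *-cancelˡ (exp 0#) (>⇒≢0 (<-≤-trans 0<1 (≤-respˡ (+-identityʳ 1#) (1+x≤exp ≤-refl))))
    (trans (sym (exp-+ 0# 0#)) (trans (cong exp (+-identityʳ 0#)) (sym (*-identityʳ _))))

  exp-neg : ∀ x → exp x * exp (- x) ≡ 1#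
  exp-neg x = trans (sym (exp-+ x (- x))) (trans (cong exp (-‿inverseʳ x)) exp-0)

  -- It is the square of exp (x / 2), and it has the inverse exp (- x).
  exp-pos : ∀ x → 0# < exp x
  exp-pos x = nonNeg , λ 0≡exp → 0≢1 (trans (sym (zeroˡ _)) (trans (cong (_* exp (- x)) 0≡exp) (exp-neg x)))
    where
    nonNeg : 0# ≤ exp x
    nonNeg = ≤-respʳ (trans (sym (exp-+ _ _)) (cong exp (half+half x))) (square-nonNeg (exp (half x)))

  exp-strictMono : ∀ {x y} → x < y → exp x < exp y
  exp-strictMono {x} {y} x<y = begin-strict
    exp x               ≡⟨ *-identityʳ _ ⟨
    exp x * 1#          <⟨ *-monoˡ-< (exp-pos x) (<-≤-trans (x<x+y 1# (0<y-x x<y)) (1+x≤exp (<⇒≤ (0<y-x x<y)))) ⟩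
    exp x * exp (y - x) ≡⟨ exp-+ x (y - x) ⟨
    exp (x + (y - x))   ≡⟨ cong exp (solve 2 (λ x y → x :+ (y :- x) := y) refl x y) ⟩
    exp y               ∎
    where open ≤-Reasoning

  exp-mono : ∀ {x y} → x ≤ y → exp x ≤ exp y
  exp-mono {x} {y} x≤y with lem {P = x ≡ y}
  ... | yes refl = ≤-refl
  ... | no  x≢y  = <⇒≤ (exp-strictMono (x≤y , x≢y))

  exp-cancel-≤ : ∀ {x y} → exp x ≤ exp y → x ≤ y
  exp-cancel-≤ ex≤ey = ≮⇒≥ λ y<x → <⇒≱ (exp-strictMono y<x) ex≤ey

  -- Comparison of the exponential series with the geometric series.
  exp-upper : ∀ {h} → 0# ≤ h → h ≤ 1# → exp h * (1# - h) ≤ 1#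
  exp-upper {h} 0≤h h≤1 = ⟶-upper (λ k → ≤-trans (bound k) (≤-shift (^-nonNeg k 0≤h) (solve 1 (λ p → con 1ℤ :- (con 1ℤ :- p) := p :- con 0ℤ) refl _)))
    (⟶-* (exp-limit h) (⟶-const (1# - h)))
    where
    open ≤-Reasoning
    term≤ : ∀ i → expTerm h i ≤ h ^ i
    term≤ i = x÷z≤y (fromℕ!-pos i) (≤-respˡ (*-identityˡ _)
      (*-monoʳ-≤ (^-nonNeg i 0≤h) (≤-respˡ (+-identityʳ 1#) (fromℕ-mono-≤ (ℕₚ.1≤n! i)))))
    bound : ∀ k → expSeries h k * (1# - h) ≤ 1# - h ^ k
    bound zero    = ≤-reflexive (solve 1 (λ h → con 0ℤ :* (con 1ℤ :- h) := con 1ℤ :- con 1ℤ) refl h)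
    bound (suc k) = begin
      (expSeries h k + expTerm h k) * (1# - h) ≡⟨ distribʳ (1# - h) (expSeries h k) (expTerm h k) ⟩
      expSeries h k * (1# - h) + expTerm h k * (1# - h) ≤⟨ +-mono-≤ (bound k) (*-monoʳ-≤ (0≤y-x h≤1) (term≤ k)) ⟩
      1# - h ^ k + h ^ k * (1# - h)            ≡⟨ solve 2 (λ h p → con 1ℤ :- p :+ p :* (con 1ℤ :- h) := con 1ℤ :- h :* p) refl _ _ ⟩
      1# - h ^ suc k                           ∎

  1-h≤exp-neg : ∀ {h} → 0# ≤ h → h ≤ 1# → 1# - h ≤ exp (- h)
  1-h≤exp-neg {h} 0≤h h≤1 = *-cancelˡ-≤ (exp-pos h) (≤-respʳ (sym (exp-neg h)) (exp-upper 0≤h h≤1))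

  -- Logarithms and real powers

  -- A solution is the supremum of the y with exp y ≤ x. This set contains - 1 / x, since exp (1 /
  -- x) ≥ 1 / x, and is bounded by x. The estimates 1 - h ≤ exp (- h) and exp h * (1 - h) ≤ 1
  -- replace continuity.
  exp-surjective : ∀ {x} → 0# < x → ∃[ y ] exp y ≡ x
  exp-surjective {x} 0<x = L , antisym (≮⇒≥ not-above) (≮⇒≥ not-below)
    where
    Below : Pred ℝ 0ℓ
    Below y = exp y ≤ x
    below : Below (- (x ⁻¹))
    below = *-cancelˡ-≤ (exp-pos (x ⁻¹)) (≤-respˡ (sym (exp-neg _)) (begin
      1#       ≡⟨ trans (sym (x*x⁻¹ 0<x)) (*-comm _ _) ⟩
      x ⁻¹ * x ≤⟨ *-monoʳ-≤ (<⇒≤ 0<x) (≤-trans (y≤x+y _ 0≤1) (1+x≤exp (<⇒≤ (⁻¹-pos 0<x)))) ⟩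
      exp (x ⁻¹) * x    ∎))
      where open ≤-Reasoning
    bounded : UpperBound Below x
    bounded y ey≤x with total 0# y
    ... | inj₁ 0≤y = ≤-trans (y≤x+y y 0≤1) (≤-trans (1+x≤exp 0≤y) ey≤x)
    ... | inj₂ y≤0 = ≤-trans y≤0 (<⇒≤ 0<x)
    lub = complete Below (_ , below) (x , bounded)
    L = proj₁ lub
    E = exp L
    0<E = exp-pos L

    -- exp (L - h) ≥ x for h = 1 - x / E, and exp (L + h) ≤ x for h = 1 - E / x.
    not-above : ¬ (x < E)
    not-above x<E = <⇒≱ (<-shift 0<h (solve 2 (λ L h → L :- (L :- h) := h :- con 0ℤ) refl L h))
      (proj₂ (proj₂ lub) (L - h) λ y ey≤x → exp-cancel-≤ (≤-trans ey≤x x≤))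
      where
      open ≤-Reasoning
      h = 1# - x ÷ E
      Ex : E * (x ÷ E) ≡ x
      Ex = x*[y÷x] x 0<E
      0<h : 0# < h
      0<h = 0<y-x (*-cancelˡ-< 0<E (<-respˡ (sym Ex) (<-respʳ (sym (*-identityʳ E)) x<E)))
      h≤1 : h ≤ 1#
      h≤1 = ≤-shift (÷-nonNeg (<⇒≤ 0<x) 0<E) (solve 1 (λ q → con 1ℤ :- (con 1ℤ :- q) := q :- con 0ℤ) refl _)
      x≤ : x ≤ exp (L - h)
      x≤ = begin
        x             ≡⟨ Ex ⟨
        E * (x ÷ E)   ≡⟨ cong (E *_) (solve 1 (λ q → q := con 1ℤ :- (con 1ℤ :- q)) refl _) ⟩
        E * (1# - h)  ≤⟨ *-monoˡ-≤ (<⇒≤ 0<E) (1-h≤exp-neg (<⇒≤ 0<h) h≤1) ⟩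
        E * exp (- h) ≡⟨ exp-+ L (- h) ⟨
        exp (L - h)   ∎
    not-below : ¬ (E < x)
    not-below E<x = <⇒≱ (x<x+y L 0<h) (proj₁ (proj₂ lub) (L + h) exp≤)
      where
      open ≤-Reasoning
      h = 1# - E ÷ x
      xE : x * (E ÷ x) ≡ E
      xE = x*[y÷x] E 0<x
      0<h : 0# < h
      0<h = 0<y-x (*-cancelˡ-< 0<x (<-respˡ (sym xE) (<-respʳ (sym (*-identityʳ x)) E<x)))
      h≤1 : h ≤ 1#
      h≤1 = ≤-shift (÷-nonNeg (<⇒≤ 0<E) 0<x) (solve 1 (λ q → con 1ℤ :- (con 1ℤ :- q) := q :- con 0ℤ) refl _)
      exp≤ : exp (L + h) ≤ x
      exp≤ = begin
        exp (L + h)            ≡⟨ exp-+ L h ⟩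
        E * exp h              ≡⟨ cong (_* exp h) xE ⟨
        x * (E ÷ x) * exp h    ≡⟨ solve 3 (λ x q e → x :* q :* e := x :* (e :* (con 1ℤ :- (con 1ℤ :- q)))) refl _ _ _ ⟩
        x * (exp h * (1# - h)) ≤⟨ *-monoˡ-≤ (<⇒≤ 0<x) (exp-upper (<⇒≤ 0<h) h≤1) ⟩
        x * 1#                 ≡⟨ *-identityʳ x ⟩
        x                      ∎

  log-exp : ∀ y → log (exp y) ≡ y
  log-exp y = sup-unique {P = λ z → exp z ≤ exp y} ((λ z → exp-cancel-≤) , λ b ub → ub y ≤-refl)

  exp-log : ∀ {x} → 0# < x → exp (log x) ≡ x
  exp-log 0<x = let y , ey≡x = exp-surjective 0<x in
    trans (cong (λ z → exp (log z)) (sym ey≡x)) (trans (cong exp (log-exp y)) ey≡x)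

  log-mono : ∀ {x y} → 0# < x → x ≤ y → log x ≤ log y
  log-mono 0<x x≤y = exp-cancel-≤ (subst₂ _≤_ (sym (exp-log 0<x)) (sym (exp-log (<-≤-trans 0<x x≤y))) x≤y)

  log-strictMono : ∀ {x y} → 0# < x → x < y → log x < log y
  log-strictMono 0<x x<y = log-mono 0<x (<⇒≤ x<y) , λ eq → proj₂ x<y
    (trans (sym (exp-log 0<x)) (trans (cong exp eq) (exp-log (<-trans 0<x x<y))))

  log-* : ∀ {x y} → 0# < x → 0# < y → log (x * y) ≡ log x + log y
  log-* {x} {y} 0<x 0<y = trans (cong log (trans (sym (cong₂ _*_ (exp-log 0<x) (exp-log 0<y))) (sym (exp-+ (log x) (log y))))) (log-exp _)

  log-1 : log 1# ≡ 0#
  log-1 = trans (cong log (sym exp-0)) (log-exp 0#)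

  log<0 : ∀ {x} → 0# < x → x < 1# → log x < 0#
  log<0 0<x x<1 = <-respʳ log-1 (log-strictMono 0<x x<1)

  ^ʳ-pos : ∀ x a → 0# < x ^ʳ a
  ^ʳ-pos x a = exp-pos _

  ^ʳ-nonNeg : ∀ x a → 0# ≤ x ^ʳ a
  ^ʳ-nonNeg x a = <⇒≤ (^ʳ-pos x a)

  log-^ʳ : ∀ x a → log (x ^ʳ a) ≡ a * log x
  log-^ʳ x a = log-exp _

  ^ʳ-+ : ∀ x a b → x ^ʳ (a + b) ≡ x ^ʳ a * x ^ʳ b
  ^ʳ-+ x a b = trans (cong exp (distribʳ (log x) a b)) (exp-+ _ _)

  ^ʳ-distrib-* : ∀ {x y} a → 0# < x → 0# < y → (x * y) ^ʳ a ≡ x ^ʳ a * y ^ʳ a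
  ^ʳ-distrib-* a 0<x 0<y = trans (cong (λ z → exp (a * z)) (log-* 0<x 0<y)) (trans (cong exp (distribˡ a _ _)) (exp-+ _ _))

  ^ʳ-0 : ∀ x → x ^ʳ 0# ≡ 1#
  ^ʳ-0 x = trans (cong exp (zeroˡ (log x))) exp-0

  1-^ʳ : ∀ a → 1# ^ʳ a ≡ 1#
  1-^ʳ a = trans (cong (λ z → exp (a * z)) log-1) (trans (cong exp (zeroʳ a)) exp-0)

  ^ʳ-fromℕ : ∀ {x} n → 0# < x → x ^ʳ fromℕ n ≡ x ^ n
  ^ʳ-fromℕ {x} zero    0<x = ^ʳ-0 x
  ^ʳ-fromℕ {x} (suc n) 0<x = trans (^ʳ-+ x 1# (fromℕ n))
    (cong₂ _*_ (trans (cong exp (*-identityˡ _)) (exp-log 0<x)) (^ʳ-fromℕ n 0<x))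

  ^ʳ-monoˡ : ∀ {x y a} → 0# ≤ a → 0# < x → x ≤ y → x ^ʳ a ≤ y ^ʳ a
  ^ʳ-monoˡ 0≤a 0<x x≤y = exp-mono (*-monoˡ-≤ 0≤a (log-mono 0<x x≤y))

  -- Square roots and the Euclidean metric

  sqrt-square : ∀ {t} → 0# ≤ t → sqrt (t * t) ≡ t
  sqrt-square {t} 0≤t = sup-unique {P = λ u → u ^ 2 ≤ t * t}
    ( (λ u uu≤tt → sq-cancel-≤ 0≤t (≤-respˡ (square u) uu≤tt))
    , λ b ub → ub t (≤-reflexive (square t)) )
    where
    square : ∀ u → u ^ 2 ≡ u * u
    square = solve 1 (λ u → u :^ 2 := u :* u) refl

  -- Halving the logarithm yields the root without another supremum; 0 is separate because `log` is
  -- meaningful for positive arguments only.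
  root : ∀ {x} → 0# ≤ x → ∃[ t ] 0# ≤ t × t * t ≡ x
  root {x} 0≤x with lem {P = 0# ≡ x}
  ... | yes 0≡x = 0# , ≤-refl , trans (zeroˡ 0#) 0≡x
  ... | no  0≢x = exp (half (log x)) , <⇒≤ (exp-pos _) ,
    trans (sym (exp-+ _ _)) (trans (cong exp (half+half (log x))) (exp-log (0≤x , 0≢x)))

  sqrt-nonNeg : ∀ {x} → 0# ≤ x → 0# ≤ sqrt x
  sqrt-nonNeg 0≤x = let t , 0≤t , tt≡x = root 0≤x in
    ≤-respʳ (trans (sym (sqrt-square 0≤t)) (cong sqrt tt≡x)) 0≤t

  sqrt*sqrt : ∀ {x} → 0# ≤ x → sqrt x * sqrt x ≡ x
  sqrt*sqrt 0≤x = let t , 0≤t , tt≡x = root 0≤x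
                      s≡t = trans (cong sqrt (sym tt≡x)) (sqrt-square 0≤t)
                  in trans (cong₂ _*_ s≡t s≡t) tt≡x

  inner : ∀ {n} → (Fin n → ℝ) → (Fin n → ℝ) → ℝ
  inner a b = sum (λ i → a i * b i)

  inner-self-nonNeg : ∀ {n} (a : Fin n → ℝ) → 0# ≤ inner a a
  inner-self-nonNeg a = sum-nonNeg (λ i → square-nonNeg (a i))

  -- The inequality of arithmetic and geometric means, squared: (p + q)² = 4pq + (p - q)².
  double-product≤ : ∀ {p q c} → 0# ≤ p → 0# ≤ q → c * c ≤ p * q → c + c ≤ p + q
  double-product≤ {p} {q} {c} 0≤p 0≤q cc≤pq = sq-cancel-≤ (+-nonNeg 0≤p 0≤q)
    (≤-shift (+-mono-≤ (+-mono-≤ (+-mono-≤ cc≤pq cc≤pq) (+-mono-≤ cc≤pq cc≤pq)) (square-nonNeg (p - q)))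
      (solve 3 (λ p q c → (p :+ q) :* (p :+ q) :- (c :+ c) :* (c :+ c)
          := p :* q :+ p :* q :+ (p :* q :+ p :* q) :+ (p :- q) :* (p :- q) :- (c :* c :+ c :* c :+ (c :* c :+ c :* c) :+ con 0ℤ))
        refl p q c))

  -- Induction on n: splitting off the first coordinates x and y leaves the inequality for the rest
  -- and the mixed part 2Cxy ≤ Ay² + Bx², an instance of `double-product≤` because C² ≤ AB.
  cauchy-schwarz : ∀ {n} (a b : Fin n → ℝ) → inner a b * inner a b ≤ inner a a * inner b b
  cauchy-schwarz {zero}  a b = ≤-refl
  cauchy-schwarz {suc n} a b = ≤-shift
    (+-mono-≤ (cauchy-schwarz (a ∘ suc) (b ∘ suc))
      (double-product≤ (*-nonNeg A≥0 (square-nonNeg y)) (*-nonNeg B≥0 (square-nonNeg x))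
        (≤-shift (*-monoʳ-≤ (square-nonNeg (x * y)) (cauchy-schwarz (a ∘ suc) (b ∘ suc)))
          (solve 5 (λ A B C x y → A :* (y :* y) :* (B :* (x :* x)) :- C :* (x :* y) :* (C :* (x :* y))
             := A :* B :* (x :* y :* (x :* y)) :- C :* C :* (x :* y :* (x :* y))) refl A B C x y))))
    (solve 5 (λ A B C x y → (x :* x :+ A) :* (y :* y :+ B) :- (x :* y :+ C) :* (x :* y :+ C)
        := A :* B :+ (A :* (y :* y) :+ B :* (x :* x)) :- (C :* C :+ (C :* (x :* y) :+ C :* (x :* y)))) refl A B C x y)
    where
    x = a zero
    y = b zero
    A = inner (a ∘ suc) (a ∘ suc)
    B = inner (b ∘ suc) (b ∘ suc)
    C = inner (a ∘ suc) (b ∘ suc)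
    A≥0 = inner-self-nonNeg (a ∘ suc)
    B≥0 = inner-self-nonNeg (b ∘ suc)

  inner-+-self : ∀ {n} (a b : Fin n → ℝ) →
    inner (λ i → a i + b i) (λ i → a i + b i) ≡ inner a a + inner b b + (inner a b + inner a b)
  inner-+-self a b = begin
    sum (λ i → (a i + b i) * (a i + b i))
      ≡⟨ sum-cong-≗ (λ i → solve 2 (λ a b → (a :+ b) :* (a :+ b) := a :* a :+ b :* b :+ (a :* b :+ a :* b)) refl (a i) (b i)) ⟩
    sum (λ i → a i * a i + b i * b i + (a i * b i + a i * b i)) ≡⟨ ∑-distrib-+ (λ i → a i * a i + b i * b i) (λ i → a i * b i + a i * b i) ⟩
    sum (λ i → a i * a i + b i * b i) + sum (λ i → a i * b i + a i * b i)
      ≡⟨ cong₂ _+_ (∑-distrib-+ (λ i → a i * a i) (λ i → b i * b i)) (∑-distrib-+ (λ i → a i * b i) (λ i → a i * b i)) ⟩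
    inner a a + inner b b + (inner a b + inner a b) ∎
    where open ≡-Reasoning

  difference : ∀ {n} → Point n → Point n → Fin n → ℝ
  difference x y i = lookup x i - lookup y i

  sum-squares-nonNeg : ∀ {n} (x y : Point n) → 0# ≤ sum (λ i → (lookup x i - lookup y i) ^ 2)
  sum-squares-nonNeg x y = sum-nonNeg λ i → ≤-respʳ (solve 1 (λ u → u :* u := u :^ 2) refl _) (square-nonNeg (difference x y i))

  dist-nonNeg : ∀ {n} (x y : Point n) → 0# ≤ dist x y
  dist-nonNeg x y = sqrt-nonNeg (sum-squares-nonNeg x y)

  dist*dist : ∀ {n} (x y : Point n) → dist x y * dist x y ≡ inner (difference x y) (difference x y)
  dist*dist x y = trans (sqrt*sqrt (sum-squares-nonNeg x y))
    (sum-cong-≗ λ i → solve 1 (λ u → u :^ 2 := u :* u) refl (difference x y i))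

  dist-sym : ∀ {n} (x y : Point n) → dist x y ≡ dist y x
  dist-sym x y = cong sqrt (sum-cong-≗ λ i → solve 2 (λ a b → (a :- b) :^ 2 := (b :- a) :^ 2) refl (lookup x i) (lookup y i))

  dist-triangle : ∀ {n} (x y z : Point n) → dist x z ≤ dist x y + dist y z
  dist-triangle x y z = sq-cancel-≤ (+-nonNeg 0≤α 0≤β) (begin
    dist x z * dist x z                     ≡⟨ dist*dist x z ⟩
    inner (difference x z) (difference x z) ≡⟨ split ⟩
    sum (λ i → (u i + v i) * (u i + v i))   ≡⟨ inner-+-self u v ⟩
    inner u u + inner v v + (inner u v + inner u v) ≤⟨ +-monoʳ-≤ _ (+-mono-≤ uv≤ uv≤) ⟩
    inner u u + inner v v + (α * β + α * β) ≡⟨ cong (_+ (α * β + α * β)) (cong₂ _+_ (sym (dist*dist x y)) (sym (dist*dist y z))) ⟩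
    α * α + β * β + (α * β + α * β)         ≡⟨ solve 2 (λ a b → a :* a :+ b :* b :+ (a :* b :+ a :* b) := (a :+ b) :* (a :+ b)) refl α β ⟩
    (α + β) * (α + β)                                         ∎)
    where
    open ≤-Reasoning
    u = difference x y
    v = difference y z
    α = dist x y
    β = dist y z
    0≤α = dist-nonNeg x y
    0≤β = dist-nonNeg y z
    split : inner (difference x z) (difference x z) ≡ sum (λ i → (u i + v i) * (u i + v i))
    split = sum-cong-≗ λ i → solve 3 (λ x y z → (x :- z) :* (x :- z) := (x :- y :+ (y :- z)) :* (x :- y :+ (y :- z))) refl (lookup x i) (lookup y i) (lookup z i)
    uv≤ : inner u v ≤ α * β
    uv≤ = sq-cancel-≤ (*-nonNeg 0≤α 0≤β) (≤-respʳ
      (trans (cong₂ _*_ (sym (dist*dist x y)) (sym (dist*dist y z))) (solve 2 (λ a b → a :* a :* (b :* b) := a :* b :* (a :* b)) refl α β))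
      (cauchy-schwarz u v))

  dist-self : ∀ {n} (x : Point n) → dist x x ≡ 0#
  dist-self {n} x = trans (cong sqrt (trans (sum-cong-≗ λ i → trans (cong (_^ 2) (-‿inverseʳ (lookup x i))) (zeroˡ _))
    (trans (sum-zero n) (sym (zeroˡ 0#))))) (sqrt-square ≤-refl)

  coordinate≤dist : ∀ {n} (x y : Point n) i → abs (lookup x i - lookup y i) ≤ dist x y
  coordinate≤dist x y i = sq-cancel-≤ (dist-nonNeg x y) (begin
    abs d * abs d                           ≡⟨ abs-* d d ⟨
    abs (d * d)                             ≡⟨ abs-nonNeg-≡ (square-nonNeg d) ⟩
    d * d                                   ≤⟨ term≤sum (λ i → square-nonNeg (difference x y i)) i ⟩
    inner (difference x y) (difference x y) ≡⟨ dist*dist x y ⟨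
    dist x y * dist x y                        ∎)
    where
    open ≤-Reasoning
    d = difference x y i

  -- The crude factor n in place of its square root keeps roots out of all later constants.
  dist≤coordinates : ∀ {n b} (x y : Point n) → 0# ≤ b →
    (∀ i → abs (lookup x i - lookup y i) ≤ b) → dist x y ≤ fromℕ n * b
  dist≤coordinates {n} {b} x y 0≤b close = sq-cancel-≤ (*-nonNeg (fromℕ-nonNeg n) 0≤b) (begin
    dist x y * dist x y         ≡⟨ dist*dist x y ⟩
    sum (λ i → d i * d i)       ≤⟨ sum-mono (λ i → ≤-trans (≤-respˡ (sq i) ≤-refl) (*-mono-≤ (abs-nonNeg _) 0≤b (close i) (close i))) ⟩
    sum {n} (λ _ → b * b)       ≡⟨ sum-const n (b * b) ⟩
    fromℕ n * (b * b)           ≤⟨ *-monoʳ-≤ (square-nonNeg b) (n≤n² n) ⟩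
    fromℕ n * fromℕ n * (b * b) ≡⟨ solve 2 (λ m b → m :* m :* (b :* b) := m :* b :* (m :* b)) refl _ _ ⟩
    fromℕ n * b * (fromℕ n * b)               ∎)
    where
    open ≤-Reasoning
    d = difference x y
    sq : ∀ i → abs (d i) * abs (d i) ≡ d i * d i
    sq i = trans (sym (abs-* (d i) (d i))) (abs-nonNeg-≡ (square-nonNeg (d i)))
    n≤n² : ∀ n → fromℕ n ≤ fromℕ n * fromℕ n
    n≤n² zero    = ≤-reflexive (sym (zeroˡ _))
    n≤n² (suc n) = ≤-respˡ (*-identityʳ _) (*-monoˡ-≤ (fromℕ-nonNeg (suc n)) (≤-respˡ (+-identityʳ 1#) (fromℕ-mono-≤ {1} {suc n} (s≤s z≤n))))

  lookup-injective : ∀ {n} {x y : Point n} → (∀ i → lookup x i ≡ lookup y i) → x ≡ y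
  lookup-injective {x = x} {y} eq = trans (sym (Vecₚ.tabulate∘lookup x)) (trans (Vecₚ.tabulate-cong eq) (Vecₚ.tabulate∘lookup y))

  dist≡0⇒≡ : ∀ {n} {x y : Point n} → dist x y ≡ 0# → x ≡ y
  dist≡0⇒≡ {x = x} {y} d≡0 = lookup-injective λ i →
    let abs≤0 = ≤-respʳ d≡0 (coordinate≤dist x y i) in
    antisym (≤-shift (≤-trans (x≤abs _) abs≤0) (solve 2 (λ a b → b :- a := con 0ℤ :- (a :- b)) refl _ _))
            (≤-shift (≤-trans (-x≤abs _) abs≤0) (solve 2 (λ a b → a :- b := con 0ℤ :- :- (a :- b)) refl _ _))

  -- Similarities are surjective

  -- Kronecker's delta, by recursion on both indices so that sums against it compute without
  -- deciding equality.
  δ : ∀ {n} → Fin n → Fin n → ℝ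
  δ zero    zero    = 1#
  δ zero    (suc j) = 0#
  δ (suc i) zero    = 0#
  δ (suc i) (suc j) = δ i j

  inner-δ : ∀ {n} (f : Fin n → ℝ) i → inner f (δ i) ≡ f i
  inner-δ {suc n} f zero = begin
    f zero * 1# + sum (λ j → f (suc j) * 0#) ≡⟨ cong₂ _+_ (*-identityʳ _) (trans (sum-cong-≗ λ j → zeroʳ (f (suc j))) (sum-zero n)) ⟩
    f zero + 0#                              ≡⟨ +-identityʳ _ ⟩
    f zero                                   ∎
    where open ≡-Reasoning
  inner-δ f (suc i) = trans (cong₂ _+_ (zeroʳ (f zero)) (inner-δ (f ∘ suc) i)) (+-identityˡ _)

  sum-*-sum : ∀ {m n} (f : Fin m → ℝ) (g : Fin n → ℝ) → sum f * sum g ≡ sum (λ i → sum (λ j → f i * g j))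
  sum-*-sum f g = trans (*-distribʳ-sum (sum g) f) (sum-cong-≗ λ i → *-distribˡ-sum (f i) g)

  sum-rotate : ∀ {l m n} (G : Fin l → Fin m → Fin n → ℝ) →
    sum (λ i → sum (λ k → sum (λ j → G i k j))) ≡ sum (λ j → sum (λ i → sum (λ k → G i k j)))
  sum-rotate G = trans (sum-cong-≗ λ i → ∑-comm (G i)) (∑-comm (λ i j → sum (λ k → G i k j)))

  module Matrices {n} (A : Fin n → Fin n → ℝ) (s : ℝ) where
    -- The entries of AᵀA and of AAᵀ.
    columns rows : Fin n → Fin n → ℝ
    columns j m = inner (λ i → A i j) (λ i → A i m)
    rows i k = inner (A i) (A k)

    -- Both sides are the sum of A i j * A k j * A i m * A k m over all four indices.
    rows-columns : sum (λ i → sum (λ k → rows i k * rows i k)) ≡ sum (λ j → sum (λ m → columns j m * columns j m))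
    rows-columns = begin
      sum (λ i → sum (λ k → rows i k * rows i k))
        ≡⟨ sum-cong-≗ (λ i → sum-cong-≗ λ k → sum-*-sum (λ j → A i j * A k j) (λ m → A i m * A k m)) ⟩
      sum (λ i → sum (λ k → sum (λ j → sum (λ m → F i k j m))))
        ≡⟨ sum-rotate (λ i k j → sum (F i k j)) ⟩
      sum (λ j → sum (λ i → sum (λ k → sum (λ m → F i k j m))))
        ≡⟨ sum-cong-≗ (λ j → sum-rotate (λ i k → F i k j)) ⟩
      sum (λ j → sum (λ m → sum (λ i → sum (λ k → F i k j m))))
        ≡⟨ sum-cong-≗ (λ j → sum-cong-≗ λ m → trans (sum-cong-≗ λ i → sum-cong-≗ λ k →
             solve 4 (λ a b c d → a :* b :* (c :* d) := a :* c :* (b :* d)) refl (A i j) (A k j) (A i m) (A k m))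
             (sym (sum-*-sum (λ i → A i j * A i m) (λ k → A k j * A k m)))) ⟩
      sum (λ j → sum (λ m → columns j m * columns j m)) ∎
      where
      open ≡-Reasoning
      F : Fin n → Fin n → Fin n → Fin n → ℝ
      F i k j m = A i j * A k j * (A i m * A k m)

    -- The Frobenius norm of AAᵀ - s I vanishes, since AAᵀ and AᵀA have the same Frobenius norm and the same trace.
    orthogonal-transpose : (∀ j m → columns j m ≡ s * δ j m) → ∀ i k → rows i k ≡ s * δ i k
    orthogonal-transpose orth i k =
      trans (solve 2 (λ a b → a := a :- b :+ b) refl _ _)
        (trans (cong (_+ s * δ i k) (Q≡0 i k)) (+-identityˡ _))
      where
      open ≡-Reasoning
      Q : Fin n → Fin n → ℝ
      Q i k = rows i k - s * δ i k
      D = sum (λ j → δ {n} j j)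
      trace : sum (λ i → rows i i) ≡ s * D
      trace = begin
        sum (λ i → sum (λ j → A i j * A i j)) ≡⟨ ∑-comm (λ i j → A i j * A i j) ⟩
        sum (λ j → columns j j)               ≡⟨ sum-cong-≗ (λ j → orth j j) ⟩
        sum (λ j → s * δ {n} j j)             ≡⟨ *-distribˡ-sum s (λ j → δ {n} j j) ⟨
        s * D                                 ∎
      s²δ : ∀ j → sum (λ m → s * δ j m * (s * δ j m)) ≡ s * s * δ {n} j j
      s²δ j = begin
        sum (λ m → s * δ j m * (s * δ j m)) ≡⟨ sum-cong-≗ (λ m → solve 2 (λ s d → s :* d :* (s :* d) := s :* s :* d :* d) refl s (δ j m)) ⟩
        inner (λ m → s * s * δ j m) (δ j)   ≡⟨ inner-δ (λ m → s * s * δ j m) j ⟩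
        s * s * δ {n} j j                   ∎
      squares : sum (λ i → sum (λ k → rows i k * rows i k)) ≡ s * s * D
      squares = begin
        sum (λ i → sum (λ k → rows i k * rows i k)) ≡⟨ rows-columns ⟩
        sum (λ j → sum (λ m → columns j m * columns j m)) ≡⟨ sum-cong-≗ (λ j → sum-cong-≗ λ m → cong₂ _*_ (orth j m) (orth j m)) ⟩
        sum {n} (λ j → sum {n} (λ m → s * δ j m * (s * δ j m))) ≡⟨ sum-cong-≗ s²δ ⟩
        sum (λ j → s * s * δ {n} j j)               ≡⟨ *-distribˡ-sum (s * s) (λ j → δ {n} j j) ⟨
        s * s * D                                   ∎
      cross : ∀ i → sum (λ k → (- (s + s)) * rows i k * δ i k) ≡ (- (s + s)) * rows i i
      cross i = inner-δ (λ k → (- (s + s)) * rows i k) i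
      row : ∀ i → sum (λ k → Q i k * Q i k) ≡ sum (λ k → rows i k * rows i k) + ((- (s + s)) * rows i i + s * s * δ {n} i i)
      row i = begin
        sum (λ k → Q i k * Q i k)
          ≡⟨ sum-cong-≗ (λ k → solve 3 (λ r s d → (r :- s :* d) :* (r :- s :* d) := r :* r :+ ((:- (s :+ s)) :* r :* d :+ s :* d :* (s :* d))) refl (rows i k) s (δ i k)) ⟩
        sum (λ k → rows i k * rows i k + ((- (s + s)) * rows i k * δ i k + s * δ i k * (s * δ i k)))
          ≡⟨ ∑-distrib-+ (λ k → rows i k * rows i k) (λ k → (- (s + s)) * rows i k * δ i k + s * δ i k * (s * δ i k)) ⟩
        sum (λ k → rows i k * rows i k) + sum (λ k → (- (s + s)) * rows i k * δ i k + s * δ i k * (s * δ i k))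
          ≡⟨ cong (sum (λ k → rows i k * rows i k) +_) (∑-distrib-+ (λ k → (- (s + s)) * rows i k * δ i k) (λ k → s * δ i k * (s * δ i k))) ⟩
        sum (λ k → rows i k * rows i k) + (sum (λ k → (- (s + s)) * rows i k * δ i k) + sum (λ k → s * δ i k * (s * δ i k)))
          ≡⟨ cong (sum (λ k → rows i k * rows i k) +_) (cong₂ _+_ (cross i) (s²δ i)) ⟩
        sum (λ k → rows i k * rows i k) + ((- (s + s)) * rows i i + s * s * δ {n} i i) ∎
      frobenius : sum (λ i → sum (λ k → Q i k * Q i k)) ≡ 0#
      frobenius = begin
        sum (λ i → sum (λ k → Q i k * Q i k))
          ≡⟨ sum-cong-≗ row ⟩
        sum (λ i → sum (λ k → rows i k * rows i k) + ((- (s + s)) * rows i i + s * s * δ {n} i i))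
          ≡⟨ ∑-distrib-+ (λ i → sum (λ k → rows i k * rows i k)) (λ i → (- (s + s)) * rows i i + s * s * δ {n} i i) ⟩
        sum (λ i → sum (λ k → rows i k * rows i k)) + sum (λ i → (- (s + s)) * rows i i + s * s * δ {n} i i)
          ≡⟨ cong₂ _+_ squares (∑-distrib-+ (λ i → (- (s + s)) * rows i i) (λ i → s * s * δ {n} i i)) ⟩
        s * s * D + (sum (λ i → (- (s + s)) * rows i i) + sum (λ i → s * s * δ {n} i i))
          ≡⟨ cong (s * s * D +_) (cong₂ _+_ (trans (sym (*-distribˡ-sum (- (s + s)) (λ i → rows i i))) (cong ((- (s + s)) *_) trace)) (sym (*-distribˡ-sum (s * s) (λ i → δ {n} i i)))) ⟩
        s * s * D + ((- (s + s)) * (s * D) + s * s * D)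
          ≡⟨ solve 2 (λ s d → s :* s :* d :+ ((:- (s :+ s)) :* (s :* d) :+ s :* s :* d) := con 0ℤ) refl s D ⟩
        0# ∎
      Q≡0 : ∀ i k → Q i k ≡ 0#
      Q≡0 i k with lem {P = Q i k ≡ 0#}
      ... | yes eq = eq
      ... | no neq = *-cancelˡ (Q i k) neq (trans
        (sum-all-zero (λ k → square-nonNeg (Q i k)) (sum-all-zero (λ i → sum-nonNeg λ k → square-nonNeg (Q i k)) frobenius i) k)
        (sym (zeroʳ _)))

  Similarity : ∀ {n} → ℝ → (Point n → Point n) → Set
  Similarity r φ = ∀ x y → dist (φ x) (φ y) ≡ r * dist x y

  module _ {n r} {φ : Point n → Point n} (0<r : 0# < r) (similar : Similarity r φ) where
    private
      origin : Point n
      origin = tabulate (λ _ → 0#)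

      g : Point n → Fin n → ℝ
      g x = difference (φ x) (φ origin)

      s = r * r

      dist²-scales : ∀ x y → dist (φ x) (φ y) * dist (φ x) (φ y) ≡ s * (dist x y * dist x y)
      dist²-scales x y = trans (cong₂ _*_ (similar x y) (similar x y))
        (solve 2 (λ r d → r :* d :* (r :* d) := r :* r :* (d :* d)) refl _ _)

      norm-scales : ∀ x → inner (g x) (g x) ≡ s * inner (lookup x) (lookup x)
      norm-scales x = begin
        inner (g x) (g x)                   ≡⟨ dist*dist (φ x) (φ origin) ⟨
        dist (φ x) (φ origin) * dist (φ x) (φ origin) ≡⟨ dist²-scales x origin ⟩
        s * (dist x origin * dist x origin) ≡⟨ cong (s *_) (dist*dist x origin) ⟩
        s * inner (difference x origin) (difference x origin)
          ≡⟨ cong (s *_) (sum-cong-≗ λ i → cong (λ z → (lookup x i - z) * (lookup x i - z)) (Vecₚ.lookup∘tabulate _ i)) ⟩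
        s * sum (λ i → (lookup x i - 0#) * (lookup x i - 0#))
          ≡⟨ cong (s *_) (sum-cong-≗ λ i → solve 1 (λ a → (a :- con 0ℤ) :* (a :- con 0ℤ) := a :* a) refl (lookup x i)) ⟩
        s * inner (lookup x) (lookup x)     ∎
        where open ≡-Reasoning

      polarize : ∀ {m} (u v : Fin m → ℝ) → 2# * inner u v ≡ inner u u + inner v v - inner (λ i → u i - v i) (λ i → u i - v i)
      polarize u v = begin
        2# * inner u v
          ≡⟨ solve 3 (λ a b c → (con 1ℤ :+ con 1ℤ) :* c := a :+ b :- (a :+ b :+ (:- c :+ :- c))) refl _ _ _ ⟩
        inner u u + inner v v - (inner u u + inner v v + (- inner u v + - inner u v))
          ≡⟨ cong (λ z → inner u u + inner v v - z) (sym expand) ⟩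
        inner u u + inner v v - inner (λ i → u i - v i) (λ i → u i - v i) ∎
        where
        open ≡-Reasoning
        negate : inner u (λ i → - v i) ≡ - inner u v
        negate = begin
          sum (λ i → u i * - v i)        ≡⟨ sum-cong-≗ (λ i → solve 2 (λ a b → a :* :- b := (:- con 1ℤ) :* (a :* b)) refl (u i) (v i)) ⟩
          sum (λ i → - 1# * (u i * v i)) ≡⟨ *-distribˡ-sum (- 1#) (λ i → u i * v i) ⟨
          - 1# * inner u v               ≡⟨ solve 1 (λ c → (:- con 1ℤ) :* c := :- c) refl _ ⟩
          - inner u v                    ∎
        expand : inner (λ i → u i - v i) (λ i → u i - v i) ≡ inner u u + inner v v + (- inner u v + - inner u v)
        expand = trans (inner-+-self u (λ i → - v i)) (cong₂ _+_
          (cong (inner u u +_) (sum-cong-≗ λ i → solve 1 (λ b → :- b :* :- b := b :* b) refl (v i)))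
          (cong₂ _+_ negate negate))

      -- Polarization: `g` is φ translated so as to fix the origin, and it scales distances to the
      -- origin and mutual distances alike, hence also inner products.
      inner-scales : ∀ x y → inner (g x) (g y) ≡ s * inner (lookup x) (lookup y)
      inner-scales x y = *-cancelˡ 2# (>⇒≢0 0<2) (begin
        2# * inner (g x) (g y)
          ≡⟨ polarize (g x) (g y) ⟩
        inner (g x) (g x) + inner (g y) (g y) - inner (λ i → g x i - g y i) (λ i → g x i - g y i)
          ≡⟨ cong₂ _-_ (cong₂ _+_ (norm-scales x) (norm-scales y)) cross ⟩
        s * inner (lookup x) (lookup x) + s * inner (lookup y) (lookup y) - s * inner (difference x y) (difference x y)
          ≡⟨ solve 4 (λ s a b c → s :* a :+ s :* b :- s :* c := s :* (a :+ b :- c)) refl s _ _ _ ⟩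
        s * (inner (lookup x) (lookup x) + inner (lookup y) (lookup y) - inner (difference x y) (difference x y))
          ≡⟨ cong (s *_) (sym (polarize (lookup x) (lookup y))) ⟩
        s * (2# * inner (lookup x) (lookup y))
          ≡⟨ solve 3 (λ s t c → s :* (t :* c) := t :* (s :* c)) refl s 2# _ ⟩
        2# * (s * inner (lookup x) (lookup y)) ∎)
        where
        open ≡-Reasoning
        cross : inner (λ i → g x i - g y i) (λ i → g x i - g y i) ≡ s * inner (difference x y) (difference x y)
        cross = begin
          inner (λ i → g x i - g y i) (λ i → g x i - g y i)
            ≡⟨ sum-cong-≗ (λ i → solve 3 (λ a b c → (a :- c :- (b :- c)) :* (a :- c :- (b :- c)) := (a :- b) :* (a :- b)) refl (lookup (φ x) i) (lookup (φ y) i) (lookup (φ origin) i)) ⟩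
          inner (difference (φ x) (φ y)) (difference (φ x) (φ y)) ≡⟨ dist*dist (φ x) (φ y) ⟨
          dist (φ x) (φ y) * dist (φ x) (φ y)         ≡⟨ dist²-scales x y ⟩
          s * (dist x y * dist x y)                   ≡⟨ cong (s *_) (dist*dist x y) ⟩
          s * inner (difference x y) (difference x y) ∎

      basis : Fin n → Point n
      basis j = tabulate (δ j)

      inner-basis : ∀ (f : Fin n → ℝ) j → inner f (lookup (basis j)) ≡ f j
      inner-basis f j = trans (sum-cong-≗ λ i → cong (f i *_) (Vecₚ.lookup∘tabulate (δ j) i)) (inner-δ f j)

      A : Fin n → Fin n → ℝ
      A i j = g (basis j) i

      open Matrices A s

      columns-orthogonal : ∀ j m → columns j m ≡ s * δ j m
      columns-orthogonal j m = trans (inner-scales (basis j) (basis m))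
        (cong (s *_) (trans (inner-basis (lookup (basis j)) m) (Vecₚ.lookup∘tabulate (δ j) m)))

      rows-inner : ∀ (w : Fin n → ℝ) i → sum (λ j → A i j * inner w (λ k → A k j)) ≡ s * w i
      rows-inner w i = begin
        sum (λ j → A i j * sum (λ k → w k * A k j)) ≡⟨ sum-cong-≗ (λ j → *-distribˡ-sum (A i j) (λ k → w k * A k j)) ⟩
        sum (λ j → sum (λ k → A i j * (w k * A k j))) ≡⟨ ∑-comm (λ j k → A i j * (w k * A k j)) ⟩
        sum (λ k → sum (λ j → A i j * (w k * A k j)))
          ≡⟨ sum-cong-≗ (λ k → trans (sum-cong-≗ λ j → solve 3 (λ a w b → a :* (w :* b) := w :* (a :* b)) refl (A i j) (w k) (A k j)) (sym (*-distribˡ-sum (w k) (λ j → A i j * A k j)))) ⟩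
        sum (λ k → w k * rows i k)
          ≡⟨ sum-cong-≗ (λ k → trans (cong (w k *_) (orthogonal-transpose columns-orthogonal i k)) (solve 3 (λ w s d → w :* (s :* d) := s :* w :* d) refl _ _ _)) ⟩
        inner (λ k → s * w k) (δ i)                 ≡⟨ inner-δ (λ k → s * w k) i ⟩
        s * w i                                     ∎
        where open ≡-Reasoning

    -- The preimage is Aᵀw / s with w = y - φ(0), where the columns of A are the vectors g(eⱼ).
    -- Instead of proving φ affine, the proof recovers g x from its inner products with the g(eⱼ),
    -- by means of AAᵀ = s I.
    similarity-surjective : ∀ y → ∃[ x ] φ x ≡ y
    similarity-surjective y = x , lookup-injective λ i →
      trans (solve 2 (λ a b → a := a :- b :+ b) refl _ _)
        (trans (cong (_+ lookup (φ origin) i) (g≡w i))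
          (solve 2 (λ a b → a :- b :+ b := a) refl _ _))
      where
      open ≡-Reasoning
      w : Fin n → ℝ
      w = difference y (φ origin)
      0<s : 0# < s
      0<s = *-pos 0<r 0<r
      x : Point n
      x = tabulate (λ j → inner w (λ k → A k j) ÷ s)
      g≡w : ∀ i → g x i ≡ w i
      g≡w i = *-cancelˡ s (>⇒≢0 0<s) (begin
        s * g x i                                 ≡⟨ rows-inner (g x) i ⟨
        sum (λ j → A i j * inner (g x) (g (basis j)))
          ≡⟨ sum-cong-≗ (λ j → cong (A i j *_) (trans (inner-scales x (basis j)) (cong (s *_) (trans (inner-basis (lookup x) j) (Vecₚ.lookup∘tabulate _ j))))) ⟩
        sum (λ j → A i j * (s * (inner w (λ k → A k j) ÷ s))) ≡⟨ sum-cong-≗ (λ j → cong (A i j *_) (x*[y÷x] (inner w (λ k → A k j)) 0<s)) ⟩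
        sum (λ j → A i j * inner w (λ k → A k j)) ≡⟨ rows-inner w i ⟩
        s * w i                                               ∎)

  -- The extended half-line [0,∞]

  open import Relation.Binary.Construct.Add.Supremum.NonStrict _≤_ using (_≤⁺_; [_]; _≤⊤⁺; [≤]-injective)
  import Relation.Binary.Construct.Add.Supremum.NonStrict _≤_ as NonStrict
  open import Relation.Binary.Construct.Add.Supremum.Strict _<_ using (_<⁺_; [_])

  ≤⁺-trans : ∀ {x y z} → x ≤⁺ y → y ≤⁺ z → x ≤⁺ z
  ≤⁺-trans = NonStrict.≤⁺-trans ≤-trans

  ≤⁺-respʳ : ∀ {x a b} → a ≡ b → x ≤⁺ ⟨ a ⟩ → x ≤⁺ ⟨ b ⟩
  ≤⁺-respʳ refl x≤a = x≤a

  -- Every real bounds the empty set, so no least bound exists and `sup` takes its default value,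
  -- which is the supremum of the empty set in [0,∞].
  sup-empty : ∀ {ℓ} {P : Pred ℝ ℓ} → ¬ (∃[ x ] P x) → sup P ≡ 0#
  sup-empty {P = P} empty with lem {P = ∃[ s ] IsLUB P s}
  ... | yes (s , _ , least) = ⊥-elim (<⇒≱
          (<-shift 0<1 (solve 1 (λ s → s :- (s :- con 1ℤ) := con 1ℤ :- con 0ℤ) refl s))
          (least (s - 1#) λ x Px → ⊥-elim (empty (x , Px))))
  ... | no _ = refl

  sup⁺-upper : ∀ {ℓ} {P : Pred (ℝ ⁺) ℓ} {x} → P x → x ≤⁺ sup⁺ P
  sup⁺-upper {P = P} {x} Px with lem {P = ∃[ b ] (∀ x → P x → x ≤⁺ ⟨ b ⟩)}
  ... | no _ = x ≤⊤⁺
  ... | yes (b , bound) = go (bound x Px) Px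
    where
    go : ∀ {x} → x ≤⁺ ⟨ b ⟩ → P x → x ≤⁺ ⟨ sup (λ r → P ⟨ r ⟩) ⟩
    go {⟨ r ⟩} [ _ ] Pr = [ proj₁ (sup-isLUB {P = λ r → P ⟨ r ⟩} (r , Pr) (b , λ y Py → [≤]-injective (bound ⟨ y ⟩ Py))) r Pr ]

  -- The bound has to be nonnegative because the empty predicate has supremum 0.
  sup⁺-least : ∀ {ℓ} {P : Pred (ℝ ⁺) ℓ} {b} → ⟨ 0# ⟩ ≤⁺ b → (∀ x → P x → x ≤⁺ b) → sup⁺ P ≤⁺ b
  sup⁺-least {P = P} {⊤⁺}    _      bound = sup⁺ P ≤⊤⁺
  sup⁺-least {P = P} {⟨ b ⟩} [ 0≤b ] bound with lem {P = ∃[ b ] (∀ x → P x → x ≤⁺ ⟨ b ⟩)}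
  ... | no unbounded = ⊥-elim (unbounded (b , bound))
  ... | yes _ with lem {P = ∃[ r ] P ⟨ r ⟩}
  ...   | yes nonempty = [ proj₂ (sup-isLUB {P = λ r → P ⟨ r ⟩} nonempty (b , ub)) b ub ]
    where
    ub : UpperBound (λ r → P ⟨ r ⟩) b
    ub y Py = [≤]-injective (bound ⟨ y ⟩ Py)
  ...   | no empty     = [ ≤-respˡ (sym (sup-empty empty)) 0≤b ]

  sup⁺-nonNeg : ∀ {ℓ} {P : Pred (ℝ ⁺) ℓ} → (∀ x → P x → ⟨ 0# ⟩ ≤⁺ x) → ⟨ 0# ⟩ ≤⁺ sup⁺ P
  sup⁺-nonNeg {P = P} nonNeg with lem {P = ∃[ x ] P x}
  ... | yes (x , Px) = ≤⁺-trans (nonNeg x Px) (sup⁺-upper Px)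
  ... | no empty with lem {P = ∃[ b ] (∀ x → P x → x ≤⁺ ⟨ b ⟩)}
  ...   | yes _ = [ ≤-reflexive (sym (sup-empty λ (r , Pr) → empty (⟨ r ⟩ , Pr))) ]
  ...   | no _  = ⟨ 0# ⟩ ≤⊤⁺

  inf⁺-lower : ∀ {ℓ} {P : Pred (ℝ ⁺) ℓ} {y} → ⟨ 0# ⟩ ≤⁺ y → P y → inf⁺ P ≤⁺ y
  inf⁺-lower 0≤y Py = sup⁺-least 0≤y λ x (_ , x≤) → x≤ _ Py

  inf⁺-greatest : ∀ {ℓ} {P : Pred (ℝ ⁺) ℓ} {x} → ⟨ 0# ⟩ ≤⁺ x → (∀ y → P y → x ≤⁺ y) → x ≤⁺ inf⁺ P
  inf⁺-greatest 0≤x x≤ = sup⁺-upper (0≤x , x≤)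

  ^⁺-mono : ∀ {x b} n → ⟨ 0# ⟩ ≤⁺ x → x ≤⁺ ⟨ b ⟩ → x ^⁺ n ≤⁺ ⟨ b ^ n ⟩
  ^⁺-mono n [ 0≤x ] [ x≤b ] = [ ^-mono-≤ n 0≤x x≤b ]

  +⁺-mono : ∀ {x y a b} → x ≤⁺ ⟨ a ⟩ → y ≤⁺ ⟨ b ⟩ → x +⁺ y ≤⁺ ⟨ a + b ⟩
  +⁺-mono [ x≤a ] [ y≤b ] = [ +-mono-≤ x≤a y≤b ]

  partial⁺ : (ℕ → ℝ ⁺) → ℕ → ℝ ⁺
  partial⁺ a k = Vector.foldr _+⁺_ ⟨ 0# ⟩ {k} (λ i → a (toℕ i))

  partial⁺≤series⁺ : ∀ a k → partial⁺ a k ≤⁺ series⁺ a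
  partial⁺≤series⁺ a k = sup⁺-upper (k , refl)

  series⁺-least : ∀ {a b} → ⟨ 0# ⟩ ≤⁺ b → (∀ k → partial⁺ a k ≤⁺ b) → series⁺ a ≤⁺ b
  series⁺-least 0≤b bound = sup⁺-least 0≤b λ { _ (k , refl) → bound k }

  partial⁺-finite : ∀ {a} v → (∀ i → a i ≡ ⟨ v i ⟩) → ∀ k → partial⁺ a k ≡ ⟨ sum {k} (λ i → v (toℕ i)) ⟩
  partial⁺-finite v eq zero    = refl
  partial⁺-finite v eq (suc k) = cong₂ _+⁺_ (eq 0) (partial⁺-finite (v ∘ suc) (eq ∘ suc) k)

  -- Distances to sets and diameters

  distTo≤ : ∀ {n} {F : Subset n} {x y} → y ∈ F → distTo x F ≤⁺ ⟨ dist x y ⟩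
  distTo≤ {x = x} {y} y∈F = inf⁺-lower [ dist-nonNeg x y ] (y , y∈F , refl)

  Δ-intro : ∀ {n} {F : Subset n} {ε x y} → y ∈ F → dist x y < ε → x ∈ Δ F ε
  Δ-intro {F = F} {ε} {x} {y} y∈F d<ε = go (distTo≤ {F = F} {x} y∈F)
    where
    go : ∀ {s} → s ≤⁺ ⟨ dist x y ⟩ → s <⁺ ⟨ ε ⟩
    go [ s≤d ] = [ ≤-<-trans s≤d d<ε ]

  -- Without a witness ε would be a lower bound of all distances from x to F, hence at most their
  -- infimum.
  Δ-elim : ∀ {n} {F : Subset n} {ε x} → 0# < ε → x ∈ Δ F ε → ∃[ y ] y ∈ F × dist x y < ε
  Δ-elim {F = F} {ε} {x} 0<ε near with lem {P = ∃[ y ] y ∈ F × dist x y < ε}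
  ... | yes found = found
  ... | no none   = ⊥-elim (go near (inf⁺-greatest [ <⇒≤ 0<ε ]
                      λ { _ (y , y∈F , refl) → [ ≮⇒≥ (λ d<ε → none (y , y∈F , d<ε)) ] }))
    where
    go : ∀ {s} → s <⁺ ⟨ ε ⟩ → ⟨ ε ⟩ ≤⁺ s → ⊥
    go [ s<ε ] [ ε≤s ] = <⇒≱ s<ε ε≤s

  dist≤diam : ∀ {n} {U : Subset n} {x y} → x ∈ U → y ∈ U → ⟨ dist x y ⟩ ≤⁺ diam U
  dist≤diam {x = x} {y} x∈U y∈U = sup⁺-upper (x , y , x∈U , y∈U , refl)

  diam≤ : ∀ {n b} {U : Subset n} → 0# ≤ b → (∀ x y → x ∈ U → y ∈ U → dist x y ≤ b) → diam U ≤⁺ ⟨ b ⟩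
  diam≤ 0≤b bound = sup⁺-least [ 0≤b ] λ { _ (x , y , x∈U , y∈U , refl) → [ bound x y x∈U y∈U ] }

  diam-nonNeg : ∀ {n} (U : Subset n) → ⟨ 0# ⟩ ≤⁺ diam U
  diam-nonNeg U = sup⁺-nonNeg λ { _ (x , y , _ , _ , refl) → [ dist-nonNeg x y ] }

  -- Grids

  Cube : ∀ {n} → Point n → ℝ → Subset n
  Cube q h y = ∀ i → lookup q i ≤ lookup y i × lookup y i ≤ lookup q i + h

  -- Separation in the maximum norm, for which boxes can be treated one coordinate at a time.
  Separated : ∀ {n} → ℝ → Point n → Point n → Set
  Separated h x y = ∃[ i ] h ≤ abs (lookup x i - lookup y i)

  -- The lower corners of the m ^ n subcubes of a cube of side m * h. They serve twice: the subcubes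
  -- are fine covers for upper bounds, and the corners are separated points for lower bounds.
  grid : ∀ {n} → ℕ → ℝ → Point n → List (Point n)
  grid m h []       = [] ∷ []
  grid m h (b ∷ bs) = concatMap (λ k → List.map ((b + fromℕ k * h) ∷_) (grid m h bs)) (upTo m)

  length-concatMap : ∀ {A B : Set} (f : A → List B) {c} → (∀ x → length (f x) ≡ c) →
    ∀ xs → length (concatMap f xs) ≡ length xs ℕ.* c
  length-concatMap f eq []       = refl
  length-concatMap f eq (x ∷ xs) = trans (Listₚ.length-++ (f x)) (cong₂ ℕ._+_ (eq x) (length-concatMap f eq xs))

  length-grid : ∀ {n} m h (b : Point n) → length (grid m h b) ≡ m ℕ.^ n
  length-grid m h []       = refl
  length-grid {suc n} m h (b ∷ bs) = trans
    (length-concatMap _ (λ k → trans (Listₚ.length-map _ (grid m h bs)) (length-grid m h bs)) (upTo m))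
    (cong (λ k → k ℕ.* m ℕ.^ n) (Listₚ.length-upTo m))

  grid-step : ∀ m {b y h} → b ≤ y → y ≤ b + fromℕ m * h → .{{NonZero m}} →
    Any (λ k → b + fromℕ k * h ≤ y × y ≤ b + fromℕ k * h + h) (upTo m)
  grid-step (suc m) {b} {y} {h} b≤y y≤ = let k , k<1+m , fits = find m y≤ in Anyₚ.applyUpTo⁺ {P = λ k → b + fromℕ k * h ≤ y × y ≤ b + fromℕ k * h + h} id fits k<1+m
    where
    find : ∀ m → y ≤ b + fromℕ (suc m) * h → ∃[ k ] k ℕ.< suc m × b + fromℕ k * h ≤ y × y ≤ b + fromℕ k * h + h
    find zero y≤ = 0 , s≤s z≤n , ≤-respˡ (solve 2 (λ b h → b := b :+ con 0ℤ :* h) refl b h) b≤y ,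
      ≤-respʳ (solve 2 (λ b h → b :+ (con 1ℤ :+ con 0ℤ) :* h := b :+ con 0ℤ :* h :+ h) refl b h) y≤
    find (suc m) y≤ with ≤-or-> y (b + fromℕ (suc m) * h)
    ... | inj₁ y≤′ = let k , k<m , fits = find m y≤′ in k , ℕₚ.m<n⇒m<1+n k<m , fits
    ... | inj₂ y>  = suc m , ℕₚ.≤-refl , <⇒≤ y> ,
      ≤-respʳ (solve 3 (λ b m h → b :+ (con 1ℤ :+ m) :* h := b :+ m :* h :+ h) refl _ _ _) y≤

  grid-cover : ∀ {n} m {h} (b : Point n) {y} → .{{NonZero m}} → y ∈ Cube b (fromℕ m * h) → Any (λ q → y ∈ Cube q h) (grid m h b)
  grid-cover m []       {[]}     y∈ = here λ ()
  grid-cover m {h} (b ∷ bs) {y ∷ ys} y∈ = Anyₚ.concatMap⁺ _ (Any.map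
    (λ {k} fits → Anyₚ.map⁺ (Any.map (λ {q} → extend k q fits) (grid-cover m bs {ys} (y∈ ∘ suc))))
    (grid-step m (proj₁ (y∈ zero)) (proj₂ (y∈ zero))))
    where
    extend : ∀ k q → b + fromℕ k * h ≤ y × y ≤ b + fromℕ k * h + h → ys ∈ Cube q h →
      (y ∷ ys) ∈ Cube ((b + fromℕ k * h) ∷ q) h
    extend k q fits ys∈ zero    = fits
    extend k q fits ys∈ (suc i) = ys∈ i

  cube-diam : ∀ {n h} (q : Point n) → 0# ≤ h → diam (Cube q h) ≤⁺ ⟨ fromℕ n * h ⟩
  cube-diam {n} {h} q 0≤h = diam≤ (*-nonNeg (fromℕ-nonNeg n) 0≤h) λ x y x∈ y∈ →
    dist≤coordinates x y 0≤h λ i → abs-≤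
      (≤-shift (+-mono-≤ (proj₂ (x∈ i)) (proj₁ (y∈ i)))
        (solve 4 (λ x y q h → h :- (x :- y) := q :+ h :+ y :- (x :+ q)) refl _ _ _ _))
      (≤-shift (+-mono-≤ (proj₂ (y∈ i)) (proj₁ (x∈ i)))
        (solve 4 (λ x y q h → h :- :- (x :- y) := q :+ h :+ x :- (y :+ q)) refl _ _ _ _))

  -- The covers in `ℋ-pre` are indexed by ℕ, so a finite list of cubes is continued by empty sets,
  -- whose diameter is 0.
  cell : ∀ {n} → ℝ → List (Point n) → ℕ → Subset n
  cell h []       _       _ = ⊥
  cell h (q ∷ qs) zero      = Cube q h
  cell h (q ∷ qs) (suc i)   = cell h qs i

  cell-cover : ∀ {n h y} {qs : List (Point n)} → Any (λ q → y ∈ Cube q h) qs → ∃[ i ] y ∈ cell h qs i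
  cell-cover (here y∈)  = 0 , y∈
  cell-cover (there y∈) = let i , y∈′ = cell-cover y∈ in suc i , y∈′

  cell-diam : ∀ {n h} → 0# ≤ h → ∀ (qs : List (Point n)) i → diam (cell h qs i) ≤⁺ ⟨ fromℕ n * h ⟩
  cell-diam {n} 0≤h []       i       = diam≤ (*-nonNeg (fromℕ-nonNeg n) 0≤h) λ _ _ ()
  cell-diam     0≤h (q ∷ qs) zero    = cube-diam q 0≤h
  cell-diam     0≤h (q ∷ qs) (suc i) = cell-diam 0≤h qs i

  -- Here n ≥ 1 matters: an empty cell contributes 0 ^ n, which is 0 only for positive n.
  cell-partial : ∀ {n} .{{_ : NonZero n}} {h} → 0# ≤ h → ∀ (qs : List (Point n)) k →
    partial⁺ (λ i → diam (cell h qs i) ^⁺ n) k ≤⁺ ⟨ fromℕ (length qs) * (fromℕ n * h) ^ n ⟩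
  cell-partial {n} {h} 0≤h qs       zero    = [ *-nonNeg (fromℕ-nonNeg (length qs)) (^-nonNeg n (*-nonNeg (fromℕ-nonNeg n) 0≤h)) ]
  cell-partial {n} {h} 0≤h []       (suc k) = ≤⁺-respʳ (+-identityˡ _)
    (+⁺-mono {a = 0#} (≤⁺-trans (^⁺-mono n (diam-nonNeg (cell {n} h [] 0)) (diam≤ {U = cell {n} h [] 0} ≤-refl λ _ _ ())) [ ^-≤-self n ≤-refl 0≤1 ])
      (cell-partial 0≤h [] k))
  cell-partial {n} {h} 0≤h (q ∷ qs) (suc k) = ≤⁺-respʳ
    (solve 2 (λ m c → c :+ m :* c := (con 1ℤ :+ m) :* c) refl _ _)
    (+⁺-mono (^⁺-mono n (diam-nonNeg (Cube q h)) (cube-diam q 0≤h)) (cell-partial 0≤h qs k))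

  -- Upper bounds for the measure

  ball⊆cube : ∀ {n ρ} (p : Point n) → Ball p ρ ⊆ Cube (Vec.map (_- ρ) p) (ρ + ρ)
  ball⊆cube {ρ = ρ} p {y} d<ρ i rewrite Vecₚ.lookup-map i (_- ρ) p =
    ≤-shift (≤-trans (x≤abs _) close) (solve 3 (λ p y r → y :- (p :- r) := r :- (p :- y)) refl _ _ _) ,
    ≤-shift (≤-trans (-x≤abs _) close) (solve 3 (λ p y r → p :- r :+ (r :+ r) :- y := r :- :- (p :- y)) refl _ _ _)
    where
    close = ≤-trans (coordinate≤dist p y i) (<⇒≤ d<ρ)

  -- Each ball lies in a cube of side 2ρ, which is cut into m ^ n equal cubes. The number of cubes
  -- grows by m ^ n while diam ^ n shrinks by the same factor, so the bound is the same at every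
  -- scale ε.
  ℋ-upper : ∀ {n} .{{_ : NonZero n}} (ps : List (Point n)) {ρ} {A : Subset n} → 0# < ρ →
    A ⊆ (λ y → Any (λ p → y ∈ Ball p ρ) ps) → ℋ A ≤⁺ ⟨ fromℕ (length ps) * (fromℕ n * (ρ + ρ)) ^ n ⟩
  ℋ-upper {n} ps {ρ} {A} 0<ρ A⊆ = sup⁺-least [ 0≤bound ] λ { _ (ε , 0<ε , refl) → at-scale ε 0<ε }
    where
    bound = fromℕ (length ps) * (fromℕ n * (ρ + ρ)) ^ n
    0≤ρ+ρ : 0# ≤ ρ + ρ
    0≤ρ+ρ = +-nonNeg (<⇒≤ 0<ρ) (<⇒≤ 0<ρ)
    0≤bound : 0# ≤ bound
    0≤bound = *-nonNeg (fromℕ-nonNeg (length ps)) (^-nonNeg n (*-nonNeg (fromℕ-nonNeg n) 0≤ρ+ρ))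
    at-scale : ∀ ε → 0# < ε → ℋ-pre ε A ≤⁺ ⟨ bound ⟩
    -- The empty partial sum shows that the series is at least 0, which `inf⁺-lower` demands.
    at-scale ε 0<ε = ≤⁺-trans (inf⁺-lower (≤⁺-trans [ ≤-refl ] (partial⁺≤series⁺ (λ i → diam (cell h corners i) ^⁺ n) 0))
        (cell h corners , cover , fine , refl))
      (series⁺-least {a = λ i → diam (cell h corners i) ^⁺ n} [ 0≤bound ] λ k → ≤⁺-respʳ total-bound (cell-partial 0≤h corners k))
      where
      open ≡-Reasoning
      arch = archimedean-÷ {fromℕ n * (ρ + ρ)} {ε} 0<ε
      m = proj₁ arch
      instance
        m≢0 : NonZero m
        m≢0 = proj₁ (proj₂ arch)
      0<m = fromℕ-pos m
      h = (ρ + ρ) ÷ fromℕ m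
      0≤h : 0# ≤ h
      0≤h = ÷-nonNeg 0≤ρ+ρ 0<m
      mh : fromℕ m * h ≡ ρ + ρ
      mh = x*[y÷x] (ρ + ρ) 0<m
      mnh : fromℕ m * (fromℕ n * h) ≡ fromℕ n * (ρ + ρ)
      mnh = trans (solve 3 (λ m n h → m :* (n :* h) := n :* (m :* h)) refl _ _ _) (cong (fromℕ n *_) mh)
      cubes : Point n → List (Point n)
      cubes p = grid m h (Vec.map (_- ρ) p)
      corners = concatMap cubes ps
      fine : ∀ i → diam (cell h corners i) ≤⁺ ⟨ ε ⟩
      fine i = ≤⁺-trans (cell-diam 0≤h corners i) [ *-cancelˡ-≤ 0<m (≤-respˡ (sym mnh) (<⇒≤ (proj₂ (proj₂ arch)))) ]
      cover : A ⊆ ⋃ ℕ (cell h corners)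
      cover {y} y∈A = cell-cover (Anyₚ.concatMap⁺ cubes (Any.map
        (λ {p} y∈ → grid-cover m (Vec.map (_- ρ) p) {y} (subst (λ s → y ∈ Cube (Vec.map (_- ρ) p) s) (sym mh) (ball⊆cube p {y} y∈))) (A⊆ {y} y∈A)))
      total-bound : fromℕ (length corners) * (fromℕ n * h) ^ n ≡ bound
      total-bound = begin
        fromℕ (length corners) * (fromℕ n * h) ^ n
          ≡⟨ cong (λ k → fromℕ k * (fromℕ n * h) ^ n) (length-concatMap cubes (λ p → length-grid m h (Vec.map (_- ρ) p)) ps) ⟩
        fromℕ (length ps ℕ.* m ℕ.^ n) * (fromℕ n * h) ^ n
          ≡⟨ cong (_* (fromℕ n * h) ^ n) (trans (fromℕ-* (length ps) (m ℕ.^ n)) (cong (fromℕ (length ps) *_) (fromℕ-^ m n))) ⟩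
        fromℕ (length ps) * fromℕ m ^ n * (fromℕ n * h) ^ n
          ≡⟨ trans (*-assoc _ _ _) (cong (fromℕ (length ps) *_) (sym (^-distrib-* (fromℕ m) (fromℕ n * h) n))) ⟩
        fromℕ (length ps) * (fromℕ m * (fromℕ n * h)) ^ n
          ≡⟨ cong (λ z → fromℕ (length ps) * z ^ n) mnh ⟩
        bound ∎

  -- Compactness of cubes

  reciprocal : ℕ → ℝ
  reciprocal k = (fromℕ (suc k)) ⁻¹

  reciprocal-pos : ∀ k → 0# < reciprocal k
  reciprocal-pos k = ⁻¹-pos (fromℕ-pos (suc k))

  reciprocal-small : ∀ {ε} → 0# < ε → ∃[ N ] (∀ k → N ℕ.≤ k → reciprocal k < ε)
  reciprocal-small {ε} 0<ε =
    let N , _ , 1<Nε = archimedean-÷ {1#} 0<ε in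
    N , λ k N≤k → *-cancelˡ-< (fromℕ-pos (suc k)) (<-respˡ (sym (x*x⁻¹ (fromℕ-pos (suc k))))
      (<-≤-trans 1<Nε (*-monoʳ-≤ (<⇒≤ 0<ε) (fromℕ-mono-≤ (ℕₚ.m≤n⇒m≤1+n N≤k)))))

  reciprocal-antitone : ∀ {j k} → j ℕ.≤ k → reciprocal k ≤ reciprocal j
  reciprocal-antitone {j} {k} j≤k = *-cancelˡ-≤ (fromℕ-pos (suc k)) (begin
    fromℕ (suc k) * reciprocal k ≡⟨ x*x⁻¹ (fromℕ-pos (suc k)) ⟩
    1#                           ≡⟨ x*x⁻¹ (fromℕ-pos (suc j)) ⟨
    fromℕ (suc j) * reciprocal j ≤⟨ *-monoʳ-≤ (<⇒≤ (reciprocal-pos j)) (fromℕ-mono-≤ (s≤s j≤k)) ⟩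
    fromℕ (suc k) * reciprocal j    ∎)
    where open ≤-Reasoning

  -- The cluster point is the limit superior.
  cluster-point : ∀ {a b} (x : ℕ → ℝ) → (∀ k → a ≤ x k) → (∀ k → x k ≤ b) →
    ∃[ p ] (∀ ε → 0# < ε → ∀ N → ∃[ m ] N ℕ.≤ m × abs (x m - p) < ε)
  cluster-point {a} {b} x a≤x x≤b = p , near
    where
    Frequent : Pred ℝ 0ℓ
    Frequent t = ∀ N → ∃[ m ] N ℕ.≤ m × t ≤ x m
    lub : ∃[ t ] IsLUB Frequent t
    lub = complete Frequent (a , λ N → N , ℕₚ.≤-refl , a≤x N)
      (b , λ t freq → let m , _ , t≤x = freq 0 in ≤-trans t≤x (x≤b m))
    p : ℝ
    p = proj₁ lub
    eventually-below : ∀ ε → 0# < ε → ∃[ N ] (∀ m → N ℕ.≤ m → x m < p + ε)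
    eventually-below ε 0<ε with lem {P = ∃[ N ] (∀ m → N ℕ.≤ m → x m < p + ε)}
    ... | yes found = found
    ... | no none   = ⊥-elim (<⇒≱ (x<x+y p 0<ε) (proj₁ (proj₂ lub) (p + ε) frequent))
      where
      frequent : Frequent (p + ε)
      frequent N with lem {P = ∃[ m ] N ℕ.≤ m × p + ε ≤ x m}
      ... | yes found = found
      ... | no never  = ⊥-elim (none (N , λ m N≤m → ≰⇒> λ h → never (m , N≤m , h)))
    frequently-above : ∀ ε → 0# < ε → Frequent (p - ε)
    frequently-above ε 0<ε N with lem {P = ∃[ m ] N ℕ.≤ m × p - ε ≤ x m}
    ... | yes found = found
    ... | no never  = ⊥-elim (<⇒≱ (<-shift 0<ε (solve 2 (λ p e → p :- (p :- e) := e :- con 0ℤ) refl p ε))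
      (proj₂ (proj₂ lub) (p - ε) λ t freq → let m , N≤m , t≤x = freq N in
        ≤-trans t≤x (<⇒≤ (≰⇒> λ h → never (m , N≤m , h)))))
    near : ∀ ε → 0# < ε → ∀ N → ∃[ m ] N ℕ.≤ m × abs (x m - p) < ε
    near ε 0<ε N =
      let N′ , below = eventually-below ε 0<ε
          m , N≤m , above = frequently-above (half ε) (half-pos 0<ε) (N ℕ.⊔ N′)
      in m , ℕₚ.≤-trans (ℕₚ.m≤m⊔n N N′) N≤m , abs-<
        (<-shift (below m (ℕₚ.≤-trans (ℕₚ.m≤n⊔m N N′) N≤m)) (solve 3 (λ x p e → e :- (x :- p) := p :+ e :- x) refl (x m) p ε))
        (≤-<-trans (≤-shift above (solve 3 (λ x p e → e :- :- (x :- p) := x :- (p :- e)) refl _ _ _)) (half<x 0<ε))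

  -- The index map f satisfies k ≤ f k but need not increase. This suffices to compose f with the
  -- map g for the remaining coordinates: the rate for the first coordinate at g k is at least as
  -- good as the rate at k.
  bolzano-weierstrass : ∀ {n} {a b : Fin n → ℝ} (x : ℕ → Fin n → ℝ) → (∀ k i → a i ≤ x k i) → (∀ k i → x k i ≤ b i) →
    ∃ λ (f : ℕ → ℕ) → (∀ k → k ℕ.≤ f k) × ∃ λ (p : Fin n → ℝ) → (∀ k i → abs (x (f k) i - p i) < reciprocal k)
  bolzano-weierstrass {zero}  x a≤x x≤b = id , (λ _ → ℕₚ.≤-refl) , (λ ()) , λ _ ()
  bolzano-weierstrass {suc n} {a} {b} x a≤x x≤b = f ∘ g , (λ k → ℕₚ.≤-trans (k≤g k) (k≤f (g k))) , (p₀ Vector.∷ p) , close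
    where
    first : ∃[ p ] (∀ ε → 0# < ε → ∀ N → ∃[ m ] N ℕ.≤ m × abs (x m zero - p) < ε)
    first = cluster-point (λ k → x k zero) (λ k → a≤x k zero) (λ k → x≤b k zero)
    p₀ : ℝ
    p₀ = proj₁ first
    near : ∀ k → ∃[ m ] k ℕ.≤ m × abs (x m zero - p₀) < reciprocal k
    near k = proj₂ first (reciprocal k) (reciprocal-pos k) k
    f : ℕ → ℕ
    f k = proj₁ (near k)
    k≤f : ∀ k → k ℕ.≤ f k
    k≤f k = proj₁ (proj₂ (near k))
    others : ∃ λ (g : ℕ → ℕ) → (∀ k → k ℕ.≤ g k) × ∃ λ (p : Fin n → ℝ) → (∀ k i → abs (x (f (g k)) (suc i) - p i) < reciprocal k)
    others = bolzano-weierstrass {n} {a ∘ suc} {b ∘ suc} (λ k i → x (f k) (suc i)) (λ k i → a≤x (f k) (suc i)) (λ k i → x≤b (f k) (suc i))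
    g : ℕ → ℕ
    g = proj₁ others
    k≤g : ∀ k → k ℕ.≤ g k
    k≤g = proj₁ (proj₂ others)
    p : Fin n → ℝ
    p = proj₁ (proj₂ (proj₂ others))
    close : ∀ k i → abs (x (f (g k)) i - (p₀ Vector.∷ p) i) < reciprocal k
    close k zero    = <-≤-trans (proj₂ (proj₂ (near (g k)))) (reciprocal-antitone (k≤g k))
    close k (suc i) = proj₂ (proj₂ (proj₂ others)) k i

  Near : ∀ {n} → Subset n → ℝ → Subset n
  Near U θ y = ∃[ u ] u ∈ U × (∀ i → abs (lookup y i - lookup u i) < θ)

  -- The members of the cover are arbitrary sets, so thickening takes the place of openness. If
  -- every finite part failed, points escaping the first N thickened sets would accumulate at a
  -- point of the cube; it lies in some U i, and points near it lie in the thickened U i.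
  cube-subcover : ∀ {n} (q : Point n) {s} (U : ℕ → Subset n) (θ : ℕ → ℝ) → (∀ i → 0# < θ i) →
    Cube q s ⊆ ⋃ ℕ U → ∃[ N ] (∀ y → y ∈ Cube q s → ∃[ i ] i ℕ.< N × y ∈ Near (U i) (θ i))
  cube-subcover {n} q {s} U θ 0<θ cover with lem {P = ∃[ N ] (∀ y → y ∈ Cube q s → ∃[ i ] i ℕ.< N × y ∈ Near (U i) (θ i))}
  ... | yes found = found
  ... | no none   = ⊥-elim (proj₂ (proj₂ (escape (f k))) (i , ℕₚ.≤-trans (ℕₚ.m≤m⊔n (suc i) K) (k≤f k) , limit , limit∈U ,
        λ j → <-trans (subst (λ z → abs (lookup (x (f k)) j - z) < reciprocal k) (sym (Vecₚ.lookup∘tabulate p j)) (close k j))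
                      (small k (ℕₚ.m≤n⊔m (suc i) K))))
    where
    escape : ∀ N → ∃[ y ] y ∈ Cube q s × ¬ (∃[ i ] i ℕ.< N × y ∈ Near (U i) (θ i))
    escape N with lem {P = ∃[ y ] y ∈ Cube q s × ¬ (∃[ i ] i ℕ.< N × y ∈ Near (U i) (θ i))}
    ... | yes found = found
    ... | no covered = ⊥-elim (none (N , λ y y∈ → decidable-stable lem λ uncovered → covered (y , y∈ , uncovered)))
    x : ℕ → Point n
    x k = proj₁ (escape k)
    x∈ : ∀ k → x k ∈ Cube q s
    x∈ k = proj₁ (proj₂ (escape k))
    bw = bolzano-weierstrass (λ k → lookup (x k)) (λ k i → proj₁ (x∈ k i)) (λ k i → proj₂ (x∈ k i))
    f = proj₁ bw
    k≤f = proj₁ (proj₂ bw)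
    p = proj₁ (proj₂ (proj₂ bw))
    close = proj₂ (proj₂ (proj₂ bw))
    limit : Point n
    limit = tabulate p
    limit∈ : limit ∈ Cube q s
    limit∈ j rewrite Vecₚ.lookup∘tabulate p j =
      (≤-if-≤+ε λ ε 0<ε → let N , below = reciprocal-small 0<ε in
        ≤-shift (+-mono-≤ (proj₁ (x∈ (f N) j)) (≤-trans (x≤abs _) (<⇒≤ (<-trans (close N j) (below N ℕₚ.≤-refl)))))
          (solve 4 (λ q x p e → p :+ e :- q := x :+ e :- (q :+ (x :- p))) refl _ _ _ _)) ,
      (≤-if-≤+ε λ ε 0<ε → let N , below = reciprocal-small 0<ε in
        ≤-shift (+-mono-≤ (proj₂ (x∈ (f N) j)) (≤-trans (-x≤abs _) (<⇒≤ (<-trans (close N j) (below N ℕₚ.≤-refl)))))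
          (solve 5 (λ q x p e s → q :+ s :+ e :- p := q :+ s :+ e :- (x :+ :- (x :- p))) refl _ _ _ _ _))
    i = proj₁ (cover limit∈)
    limit∈U = proj₂ (cover limit∈)
    K = proj₁ (reciprocal-small (0<θ i))
    small = proj₂ (reciprocal-small (0<θ i))
    -- From k ≥ i + 1 and k ≤ f k, the set U i is among those that the chosen point escapes; k ≥ K
    -- puts that point within θ i of the limit.
    k = suc i ℕ.⊔ K

  -- Counting separated points

  length-filter-split : ∀ {A : Set} {P : Pred A 0ℓ} (P? : ∀ x → Dec (P x)) xs →
    length xs ≡ length (List.filter P? xs) ℕ.+ length (List.filter (¬? ∘ P?) xs)
  length-filter-split P? []       = refl
  length-filter-split P? (x ∷ xs) with P? x
  ... | yes _ = cong suc (length-filter-split P? xs)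
  ... | no  _ = trans (cong suc (length-filter-split P? xs)) (sym (ℕₚ.+-suc _ _))

  allPairs-with-all : ∀ {A : Set} {P : A → Set} {R : A → A → Set} {xs} →
    All P xs → AllPairs R xs → AllPairs (λ x y → P x × P y × R x y) xs
  allPairs-with-all []         []           = []
  allPairs-with-all (px ∷ pxs) (rxs ∷ rest) = All.zipWith (λ (py , r) → px , py , r) (pxs , rxs) ∷ allPairs-with-all pxs rest

  InBox : ∀ {n} → Point n → ℕ → ℝ → Subset n
  InBox b m h y = ∀ i → lookup b i ≤ lookup y i × lookup y i < lookup b i + fromℕ m * h

  count-in-box : ∀ {n} m h (b : Point n) ys → All (InBox b m h) ys → AllPairs (Separated h) ys → length ys ℕ.≤ m ℕ.^ n
  count-in-box m h []       []           _  _                       = z≤n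
  count-in-box m h []       (_ ∷ [])     _  _                       = s≤s z≤n
  count-in-box m h []       (_ ∷ _ ∷ _)  _  (((() , _) ∷ _) ∷ _)
  count-in-box {suc n} m h (b ∷ bs) ys in-box sep = slabs m ys (All.map (λ {y} y∈ → y∈ zero , tail-in-box y y∈) in-box) sep
    where
    InSlabs : ℝ → ℝ → Subset (suc n)
    InSlabs lo hi y = (lo ≤ lookup y zero × lookup y zero < hi) × InBox bs m h (Vec.tail y)
    tail-in-box : ∀ y → InBox (b ∷ bs) m h y → InBox bs m h (Vec.tail y)
    tail-in-box (_ ∷ _) y∈ = y∈ ∘ suc
    separated-tail : ∀ {c} y z → InSlabs c (c + h) y × InSlabs c (c + h) z × Separated h y z → Separated h (Vec.tail y) (Vec.tail z)
    separated-tail {c} (y ∷ _) (z ∷ _) (((c≤y , y<c+h) , _) , ((c≤z , z<c+h) , _) , zero , h≤) = ⊥-elim (<⇒≱ (abs-<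
      (<-shift (+-mono-<-≤ y<c+h c≤z) (solve 4 (λ y z c h → h :- (y :- z) := c :+ h :+ z :- (y :+ c)) refl y z c h))
      (<-shift (+-mono-<-≤ z<c+h c≤y) (solve 4 (λ y z c h → h :- :- (y :- z) := c :+ h :+ y :- (z :+ c)) refl y z c h))) h≤)
    separated-tail (_ ∷ _) (_ ∷ _) (_ , _ , suc i , h≤) = i , h≤
    slabs : ∀ k ys → All (InSlabs b (b + fromℕ k * h)) ys → AllPairs (Separated h) ys → length ys ℕ.≤ k ℕ.* m ℕ.^ n
    slabs zero    []       _                      _   = z≤n
    slabs zero    (y ∷ ys) (((b≤y , y<b) , _) ∷ _) _   = ⊥-elim (<⇒≱ (<-respʳ (trans (cong (b +_) (zeroˡ h)) (+-identityʳ b)) y<b) b≤y)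
    slabs (suc k) ys       in-slabs               sep = ℕₚ.≤-trans (ℕₚ.≤-reflexive (length-filter-split below? ys))
      (ℕₚ.≤-trans (ℕₚ.+-mono-≤ lower upper) (ℕₚ.≤-reflexive (ℕₚ.+-comm (k ℕ.* m ℕ.^ n) _)))
      where
      c = b + fromℕ k * h
      below? : ∀ y → Dec (lookup y zero < c)
      below? y = lem
      top = List.filter (¬? ∘ below?) ys
      lower : length (List.filter below? ys) ℕ.≤ k ℕ.* m ℕ.^ n
      lower = slabs k _ (All.zipWith (λ (y<c , ((b≤y , _) , rest)) → (b≤y , y<c) , rest)
        (Allₚ.all-filter below? ys , Allₚ.filter⁺ below? in-slabs)) (AllPairsₚ.filter⁺ below? sep)
      in-top : All (InSlabs c (c + h)) top
      in-top = All.zipWith (λ (y≮c , ((_ , y<) , rest)) → (≮⇒≥ y≮c ,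
          <-respʳ (solve 3 (λ b k h → b :+ (con 1ℤ :+ k) :* h := b :+ k :* h :+ h) refl _ _ _) y<) , rest)
        (Allₚ.all-filter (¬? ∘ below?) ys , Allₚ.filter⁺ (¬? ∘ below?) in-slabs)
      upper : length top ℕ.≤ m ℕ.^ n
      upper = ℕₚ.≤-trans (ℕₚ.≤-reflexive (sym (Listₚ.length-map Vec.tail top)))
        (count-in-box m h bs (List.map Vec.tail top) (Allₚ.map⁺ (All.map proj₂ in-top))
          (AllPairsₚ.map⁺ (AllPairs.map (λ {y} {z} → separated-tail y z) (allPairs-with-all in-top (AllPairsₚ.filter⁺ (¬? ∘ below?) sep)))))

  least-multiple : ∀ {x h} → 0# ≤ x → 0# < h → ∃[ m ] x < fromℕ m * h × fromℕ m * h ≤ x + h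
  least-multiple {x} {h} 0≤x 0<h = let m , _ , x<mh = archimedean-÷ 0<h in go m x<mh
    where
    go : ∀ m → x < fromℕ m * h → ∃[ m ] x < fromℕ m * h × fromℕ m * h ≤ x + h
    go zero    x<0 = ⊥-elim (<⇒≱ (<-respʳ (zeroˡ h) x<0) 0≤x)
    go (suc m) x<  with ≤-or-> (fromℕ m * h) x
    ... | inj₁ mh≤x = suc m , x< , ≤-shift mh≤x (solve 3 (λ m h x → x :+ h :- (con 1ℤ :+ m) :* h := x :- m :* h) refl _ _ _)
    ... | inj₂ x<mh = go m x<mh

  3# : ℝ
  3# = 2# + 1#

  HasSpread : ∀ {n} → ℝ → Subset n → Set
  HasSpread E V = ∀ y z → y ∈ V → z ∈ V → ∀ i → abs (lookup y i - lookup z i) ≤ E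

  -- All points lie in a box of side m * h around one of them, where 2E < m * h ≤ 2E + h. The
  -- assumption h ≤ E bounds this side by 3E, the origin of `3#`.
  count-spread : ∀ {n h E} {V : Subset n} ys → 0# < h → h ≤ E → HasSpread E V → All (_∈ V) ys → AllPairs (Separated h) ys →
    fromℕ (length ys) * h ^ n ≤ (3# * E) ^ n
  count-spread {n} {h} {E} []       0<h h≤E spread ys∈ sep = ≤-respˡ (sym (zeroˡ _))
    (^-nonNeg n (*-nonNeg (+-nonNeg (<⇒≤ 0<2) 0≤1) (≤-trans (<⇒≤ 0<h) h≤E)))
  count-spread {n} {h} {E} {V} (y ∷ ys) 0<h h≤E spread ys∈@(y∈ ∷ _) sep =
    let m , 2E<mh , mh≤ = least-multiple (+-nonNeg 0≤E 0≤E) 0<h in begin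
    fromℕ (length (y ∷ ys)) * h ^ n
      ≤⟨ *-monoʳ-≤ (^-nonNeg n (<⇒≤ 0<h)) (fromℕ-mono-≤ (count-in-box m h (Vec.map (_- E) y) (y ∷ ys) (All.map (λ {z} → in-box m 2E<mh z) ys∈) sep)) ⟩
    fromℕ (m ℕ.^ n) * h ^ n         ≡⟨ trans (cong (_* h ^ n) (fromℕ-^ m n)) (sym (^-distrib-* (fromℕ m) h n)) ⟩
    (fromℕ m * h) ^ n
      ≤⟨ ^-mono-≤ n (*-nonNeg (fromℕ-nonNeg m) (<⇒≤ 0<h)) (≤-trans mh≤ (≤-shift h≤E (solve 2 (λ E h → (con 1ℤ :+ con 1ℤ :+ con 1ℤ) :* E :- (E :+ E :+ h) := E :- h) refl E h))) ⟩
    (3# * E) ^ n                    ∎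
    where
    open ≤-Reasoning
    0≤E : 0# ≤ E
    0≤E = ≤-trans (<⇒≤ 0<h) h≤E
    in-box : ∀ m → E + E < fromℕ m * h → ∀ z → z ∈ V → InBox (Vec.map (_- E) y) m h z
    in-box m 2E<mh z z∈ i rewrite Vecₚ.lookup-map i (_- E) y =
      ≤-shift (≤-trans (x≤abs _) (spread y z y∈ z∈ i)) (solve 3 (λ y z E → z :- (y :- E) := E :- (y :- z)) refl _ _ _) ,
      <-shift (+-mono-<-≤ 2E<mh (≤-trans (-x≤abs _) (spread y z y∈ z∈ i)))
        (solve 4 (λ y z E t → y :- E :+ t :- z := t :+ E :- (E :+ E :+ :- (y :- z))) refl _ _ _ _)

  -- Each point is charged to the first set that contains it.
  count-cover : ∀ {n h} N (V : ℕ → Subset n) (E : ℕ → ℝ) ys → 0# < h → (∀ i → i ℕ.< N → h ≤ E i) → (∀ i → HasSpread (E i) (V i)) →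
    All (λ y → ∃[ i ] i ℕ.< N × y ∈ V i) ys → AllPairs (Separated h) ys →
    fromℕ (length ys) * h ^ n ≤ sum {N} (λ i → (3# * E (toℕ i)) ^ n)
  count-cover zero    V E []      0<h h≤E spread covered sep = ≤-reflexive (zeroˡ _)
  count-cover zero    V E (_ ∷ _) 0<h h≤E spread ((_ , () , _) ∷ _) sep
  count-cover {n} {h} (suc N) V E ys 0<h h≤E spread covered sep = begin
    fromℕ (length ys) * h ^ n
      ≡⟨ cong (λ k → fromℕ k * h ^ n) (length-filter-split in₀? ys) ⟩
    fromℕ (length (List.filter in₀? ys) ℕ.+ length rest) * h ^ n
      ≡⟨ trans (cong (_* h ^ n) (fromℕ-+ (length (List.filter in₀? ys)) (length rest))) (distribʳ _ _ _) ⟩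
    fromℕ (length (List.filter in₀? ys)) * h ^ n + fromℕ (length rest) * h ^ n
      ≤⟨ +-mono-≤ (count-spread _ 0<h (h≤E 0 (s≤s z≤n)) (spread 0) (Allₚ.all-filter in₀? ys) (AllPairsₚ.filter⁺ in₀? sep))
           (count-cover N (V ∘ suc) (E ∘ suc) rest 0<h (λ i i<N → h≤E (suc i) (s≤s i<N)) (spread ∘ suc) rest-covered (AllPairsₚ.filter⁺ (¬? ∘ in₀?) sep)) ⟩
    sum {suc N} (λ i → (3# * E (toℕ i)) ^ n) ∎
    where
    open ≤-Reasoning
    in₀? : ∀ y → Dec (y ∈ V 0)
    in₀? y = lem
    rest = List.filter (¬? ∘ in₀?) ys
    shift : ∀ {y} → ¬ (y ∈ V 0) → ∃[ i ] i ℕ.< suc N × y ∈ V i → ∃[ i ] i ℕ.< N × y ∈ V (suc i)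
    shift y∉ (zero  , _       , y∈) = ⊥-elim (y∉ y∈)
    shift y∉ (suc i , s≤s i<N , y∈) = i , i<N , y∈
    rest-covered : All (λ y → ∃[ i ] i ℕ.< N × y ∈ V (suc i)) rest
    rest-covered = All.zipWith (λ (y∉ , c) → shift y∉ c) (Allₚ.all-filter (¬? ∘ in₀?) ys , Allₚ.filter⁺ (¬? ∘ in₀?) covered)

  grid-inside : ∀ {n} m {h} (b : Point n) → 0# ≤ h → All (Cube b (fromℕ m * h)) (grid m h b)
  grid-inside m     []       0≤h = (λ ()) ∷ []
  grid-inside m {h} (b ∷ bs) 0≤h = Allₚ.concat⁺ (Allₚ.map⁺ (Allₚ.applyUpTo⁺₁ id m λ {k} k<m →
    Allₚ.map⁺ (All.map (λ {q} q∈ → λ { zero → x≤x+y b (*-nonNeg (fromℕ-nonNeg k) 0≤h) ,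
                                              +-monoʳ-≤ b (*-monoʳ-≤ 0≤h (fromℕ-mono-≤ (ℕₚ.<⇒≤ k<m)))
                                     ; (suc i) → q∈ i }) (grid-inside m bs 0≤h))))

  grid-separated : ∀ {n} m {h} (b : Point n) → 0# < h → AllPairs (Separated h) (grid m h b)
  grid-separated m     []       0<h = [] ∷ []
  grid-separated m {h} (b ∷ bs) 0<h = AllPairsₚ.concat⁺
    (Allₚ.map⁺ (Allₚ.applyUpTo⁺₂ id m λ k → AllPairsₚ.map⁺ (AllPairs.map (λ (i , h≤) → suc i , h≤) (grid-separated m bs 0<h))))
    (AllPairsₚ.map⁺ (AllPairsₚ.applyUpTo⁺₁ id m λ {j} {k} j<k _ →
      Allₚ.map⁺ (All.universal (λ _ → Allₚ.map⁺ (All.universal (λ _ → zero , apart j<k) _)) _)))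
    where
    apart : ∀ {j k} → j ℕ.< k → h ≤ abs (b + fromℕ j * h - (b + fromℕ k * h))
    apart {j} {k} j<k = ≤-trans (≤-shift (*-monoʳ-≤ (<⇒≤ 0<h) (fromℕ-mono-≤ j<k))
      (solve 4 (λ b j k h → :- (b :+ j :* h :- (b :+ k :* h)) :- h := k :* h :- (con 1ℤ :+ j) :* h) refl _ _ _ _)) (-x≤abs _)

  -- Lower bounds for the measure

  -- If x and y were closer than h ≤ a in every coordinate, then p and q would be within 2a in every
  -- coordinate, hence at distance at most 2na < ρ.
  cubes-separated : ∀ {n a h ρ} {p q : Point n} → fromℕ n * (a + a) < ρ → 0# ≤ a → h ≤ a → ρ ≤ dist p q →
    ∀ {x y} → x ∈ Cube p a → y ∈ Cube q a → Separated h x y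
  cubes-separated {n} {a} {h} {ρ} {p} {q} na<ρ 0≤a h≤a ρ≤d {x} {y} x∈ y∈ with lem {P = Separated h x y}
  ... | yes sep = sep
  ... | no close = ⊥-elim (<⇒≱ na<ρ (≤-trans ρ≤d (dist≤coordinates p q (+-nonNeg 0≤a 0≤a) λ i →
    let |x-y|≤a = ≤-trans (<⇒≤ (≰⇒> λ h≤ → close (i , h≤))) h≤a
        px , xp = x∈ i
        qy , yq = y∈ i
    in abs-≤
      (≤-shift (+-mono-≤ (+-mono-≤ px yq) (≤-trans (x≤abs _) |x-y|≤a))
        (solve 5 (λ p q x y a → a :+ a :- (p :- q) := x :+ (q :+ a) :+ a :- (p :+ y :+ (x :- y))) refl _ _ _ _ _))
      (≤-shift (+-mono-≤ (+-mono-≤ xp qy) (≤-trans (-x≤abs _) |x-y|≤a))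
        (solve 5 (λ p q x y a → a :+ a :- :- (p :- q) := p :+ a :+ y :+ a :- (x :+ q :+ :- (x :- y))) refl _ _ _ _ _)))))

  near-spread : ∀ {n D θ} {U : Subset n} → diam U ≡ ⟨ D ⟩ → HasSpread (D + (θ + θ)) (Near U θ)
  near-spread {n} {D} {θ} {U} diam≡D y z (u , u∈ , y~u) (v , v∈ , z~v) i = begin
    abs (y′ - z′)                 ≤⟨ abs-triangle y′ u′ z′ ⟩
    abs (y′ - u′) + abs (u′ - z′) ≤⟨ +-monoʳ-≤ _ (abs-triangle u′ v′ z′) ⟩
    abs (y′ - u′) + (abs (u′ - v′) + abs (v′ - z′))
      ≤⟨ +-mono-≤ (<⇒≤ (y~u i)) (+-mono-≤ (≤-trans (coordinate≤dist u v i) u-v≤D) (≤-respˡ (abs-swap z′ v′) (<⇒≤ (z~v i)))) ⟩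
    θ + (D + θ)                   ≡⟨ solve 2 (λ D θ → θ :+ (D :+ θ) := D :+ (θ :+ θ)) refl D θ ⟩
    D + (θ + θ)                   ∎
    where
    open ≤-Reasoning
    y′ = lookup y i
    z′ = lookup z i
    u′ = lookup u i
    v′ = lookup v i
    u-v≤D : dist u v ≤ D
    u-v≤D = [≤]-injective (subst (⟨ dist u v ⟩ ≤⁺_) diam≡D (dist≤diam {U = U} u∈ v∈))

  positive-lower-bound : ∀ N {E : ℕ → ℝ} → (∀ i → 0# < E i) → ∃[ e ] 0# < e × (∀ i → i ℕ.< N → e ≤ E i)
  positive-lower-bound zero    0<E = 1# , 0<1 , λ _ ()
  positive-lower-bound (suc N) {E} 0<E with positive-lower-bound N 0<E
  ... | e , 0<e , e≤ with ≤-or-> e (E N)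
  ...   | inj₁ e≤E = e , 0<e , λ i i<1+N → [ (λ i<N → e≤ i i<N) , (λ { refl → e≤E }) ]′ (ℕₚ.m≤n⇒m<n∨m≡n (ℕₚ.≤-pred i<1+N))
  ...   | inj₂ E<e = E N , 0<E N , λ i i<1+N → [ (λ i<N → ≤-trans (<⇒≤ E<e) (e≤ i i<N)) , (λ { refl → ≤-refl }) ]′ (ℕₚ.m≤n⇒m<n∨m≡n (ℕₚ.≤-pred i<1+N))

  common-bound : ∀ {A : Set} {P : A → ℕ → Set} → (∀ {x M N} → M ℕ.≤ N → P x M → P x N) →
    ∀ {xs} → All (λ x → ∃[ N ] P x N) xs → ∃[ N ] All (λ x → P x N) xs
  common-bound weaken []             = 0 , []
  common-bound weaken ((M , p) ∷ ps) =
    let N , rest = common-bound weaken ps in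
    M ℕ.⊔ N , weaken (ℕₚ.m≤m⊔n M N) p ∷ All.map (weaken (ℕₚ.m≤n⊔m M N)) rest

  -- Weights of total at most 1, so that the cost of thickening does not depend on how many members
  -- of a cover are used.
  halves : ℕ → ℝ
  halves i = (half 1#) ^ suc i

  halves-pos : ∀ i → 0# < halves i
  halves-pos i = ^-pos (suc i) (half-pos 0<1)

  halves≤1 : ∀ i → halves i ≤ 1#
  halves≤1 i = ^-≤1 (suc i) (<⇒≤ (half-pos 0<1)) (<⇒≤ (half<x 0<1))

  sum-halves : ∀ N → sum {N} (λ i → halves (toℕ i)) ≤ 1#
  sum-halves N = ≤-respˡ (sym (trans (sum≡partial halves N) (closed N)))
    (≤-shift (^-nonNeg N (<⇒≤ (half-pos 0<1))) (solve 1 (λ p → con 1ℤ :- (con 1ℤ :- p) := p :- con 0ℤ) refl _))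
    where
    open ≡-Reasoning
    g = half 1#
    closed : ∀ N → partial halves N ≡ 1# - g ^ N
    closed zero    = sym (-‿inverseʳ 1#)
    closed (suc N) = begin
      partial halves N + g * g ^ N     ≡⟨ cong (_+ g * g ^ N) (closed N) ⟩
      1# - g ^ N + g * g ^ N           ≡⟨ cong (λ z → 1# - z + g * g ^ N) (trans (sym (*-identityˡ (g ^ N))) (cong (_* g ^ N) (sym (half+half 1#)))) ⟩
      1# - (g + g) * g ^ N + g * g ^ N ≡⟨ solve 2 (λ g p → con 1ℤ :- (g :+ g) :* p :+ g :* p := con 1ℤ :- g :* p) refl _ _ ⟩
      1# - g ^ suc N                   ∎

  4# 6# 12# : ℝ
  4#  = 2# + 2#
  6#  = 3# + 3#
  12# = 6# + 6#

  0<3 : 0# < 3#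
  0<3 = +-pos 0<2 0≤1
  0<4 : 0# < 4#
  0<4 = +-pos 0<2 (<⇒≤ 0<2)
  0<6 : 0# < 6#
  0<6 = +-pos 0<3 (<⇒≤ 0<3)
  0<12 : 0# < 12#
  0<12 = +-pos 0<6 (<⇒≤ 0<6)

  -- Since x + y is at most twice the larger summand, the factor 3 of `count-spread` becomes 6.
  power-of-sum : ∀ {x y} n → 0# ≤ x → 0# ≤ y → (3# * (x + y)) ^ n ≤ 6# ^ n * (x ^ n + y ^ n)
  power-of-sum {x} {y} n 0≤x 0≤y with total x y
  ... | inj₁ x≤y = begin
    (3# * (x + y)) ^ n
      ≤⟨ ^-mono-≤ n (*-nonNeg (<⇒≤ 0<3) (+-nonNeg 0≤x 0≤y)) (≤-trans (*-monoˡ-≤ (<⇒≤ 0<3) (+-monoˡ-≤ y x≤y)) (≤-reflexive (solve 2 (λ t y → t :* (y :+ y) := (t :+ t) :* y) refl 3# y))) ⟩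
    (6# * y) ^ n             ≡⟨ ^-distrib-* 6# y n ⟩
    6# ^ n * y ^ n           ≤⟨ *-monoˡ-≤ (^-nonNeg n (<⇒≤ 0<6)) (y≤x+y _ (^-nonNeg n 0≤x)) ⟩
    6# ^ n * (x ^ n + y ^ n) ∎
    where open ≤-Reasoning
  ... | inj₂ y≤x = begin
    (3# * (x + y)) ^ n
      ≤⟨ ^-mono-≤ n (*-nonNeg (<⇒≤ 0<3) (+-nonNeg 0≤x 0≤y)) (≤-trans (*-monoˡ-≤ (<⇒≤ 0<3) (+-monoʳ-≤ x y≤x)) (≤-reflexive (solve 2 (λ t y → t :* (y :+ y) := (t :+ t) :* y) refl 3# x))) ⟩
    (6# * x) ^ n             ≡⟨ ^-distrib-* 6# x n ⟩
    6# ^ n * x ^ n           ≤⟨ *-monoˡ-≤ (^-nonNeg n (<⇒≤ 0<6)) (x≤x+y _ (^-nonNeg n 0≤y)) ⟩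
    6# ^ n * (x ^ n + y ^ n) ∎
    where open ≤-Reasoning

  -- After a slight thickening finitely many members of the cover suffice. They contain all points of a fine grid,
  -- and a set of spread E contains at most (3 E / h) ^ n points of a grid of mesh h ≤ E.
  module CoverOfCubes {n} .{{_ : NonZero n}} {a ρ : ℝ} (0<a : 0# < a) (2na<ρ : fromℕ n * (a + a) < ρ)
    (ps : List (Point n)) (separated : AllPairs (λ p q → ρ ≤ dist p q) ps)
    (U : ℕ → Subset n) (D : ℕ → ℝ) (diam≡D : ∀ i → diam (U i) ≡ ⟨ D i ⟩)
    (cover : All (λ p → Cube p a ⊆ ⋃ ℕ U) ps) {t : ℝ} (sum≤t : ∀ k → sum {k} (λ i → D (toℕ i) ^ n) ≤ t) where

    0≤D : ∀ i → 0# ≤ D i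
    0≤D i = [≤]-injective (subst (⟨ 0# ⟩ ≤⁺_) (diam≡D i) (diam-nonNeg (U i)))

    γ : ℝ
    γ = a ÷ 12#

    0<γ : 0# < γ
    0<γ = ÷-pos 0<a 0<12

    θ : ℕ → ℝ
    θ i = half (γ * halves i)

    0<γh : ∀ i → 0# < γ * halves i
    0<γh i = *-pos 0<γ (halves-pos i)

    -- The diameter plus twice the thickening θ. The added term is positive even where D i = 0, so
    -- finitely many E i have a positive lower bound, below which the mesh h can be chosen.
    E : ℕ → ℝ
    E i = D i + γ * halves i

    CoveredBy : Point n → ℕ → Set
    CoveredBy p N = ∀ y → y ∈ Cube p a → ∃[ i ] i ℕ.< N × y ∈ Near (U i) (θ i)

    abstract
      subcover : ∃[ N ] All (λ p → CoveredBy p N) ps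
      subcover = common-bound {P = CoveredBy}
        (λ M≤N within y y∈ → let i , i<M , near = within y y∈ in i , ℕₚ.≤-trans i<M M≤N , near)
        (All.map (λ {p} → cube-subcover p U θ (λ i → half-pos (0<γh i))) cover)

    N = proj₁ subcover

    abstract
      minimum : ∃[ e ] 0# < e × (∀ i → i ℕ.< N → e ≤ E i)
      minimum = positive-lower-bound N λ i → <-≤-trans (0<γh i) (y≤x+y _ (0≤D i))

    abstract
      fine : ∃[ m ] NonZero m × a < fromℕ m * proj₁ minimum
      fine = archimedean-÷ (proj₁ (proj₂ minimum))

    m = proj₁ fine

    instance
      m≢0 : NonZero m
      m≢0 = proj₁ (proj₂ fine)

    0<m : 0# < fromℕ m
    0<m = fromℕ-pos m

    h : ℝ
    h = a ÷ fromℕ m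

    0<h : 0# < h
    0<h = ÷-pos 0<a 0<m

    mh≡a : fromℕ m * h ≡ a
    mh≡a = x*[y÷x] a 0<m

    h≤a : h ≤ a
    h≤a = x÷z≤y 0<m (≤-respˡ (*-identityˡ a) (*-monoʳ-≤ (<⇒≤ 0<a) (≤-respˡ (+-identityʳ 1#) (fromℕ-mono-≤ (ℕ.>-nonZero⁻¹ m)))))

    h≤E : ∀ i → i ℕ.< N → h ≤ E i
    h≤E i i<N = ≤-trans (x÷z≤y 0<m (<⇒≤ (proj₂ (proj₂ fine)))) (proj₂ (proj₂ minimum) i i<N)

    points : List (Point n)
    points = concatMap (grid m h) ps

    inside : ∀ (p : Point n) → All (Cube p a) (grid m h p)
    inside p = subst (λ s → All (Cube p s) (grid m h p)) mh≡a (grid-inside m p (<⇒≤ 0<h))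

    points-covered : All (λ y → ∃[ i ] i ℕ.< N × y ∈ Near (U i) (θ i)) points
    points-covered = Allₚ.concat⁺ (Allₚ.map⁺ (All.map (λ {p} (within : CoveredBy p N) → All.map (λ {y} y∈ → within y y∈) (inside p)) (proj₂ subcover)))

    points-separated : AllPairs (Separated h) points
    points-separated = AllPairsₚ.concat⁺ (Allₚ.map⁺ (All.universal (λ p → grid-separated m p 0<h) ps))
      (AllPairsₚ.map⁺ (AllPairs.map (λ {p} {q} ρ≤d → All.map (λ {x} x∈ → All.map (λ {y} y∈ → cubes-separated {p = p} {q} 2na<ρ (<⇒≤ 0<a) h≤a ρ≤d {x} {y} x∈ y∈) (inside q)) (inside p)) separated))

    spread : ∀ i → HasSpread (E i) (Near (U i) (θ i))
    spread i = subst (λ e → HasSpread (D i + e) (Near (U i) (θ i))) (half+half (γ * halves i)) (near-spread (diam≡D i))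

    total-points : fromℕ (length ps) * a ^ n ≡ fromℕ (length points) * h ^ n
    total-points = begin
      fromℕ (length ps) * a ^ n                 ≡⟨ cong (λ z → fromℕ (length ps) * z ^ n) mh≡a ⟨
      fromℕ (length ps) * (fromℕ m * h) ^ n     ≡⟨ cong (fromℕ (length ps) *_) (^-distrib-* (fromℕ m) h n) ⟩
      fromℕ (length ps) * (fromℕ m ^ n * h ^ n) ≡⟨ *-assoc _ _ _ ⟨
      fromℕ (length ps) * fromℕ m ^ n * h ^ n
        ≡⟨ cong (_* h ^ n) (trans (cong (fromℕ (length ps) *_) (sym (fromℕ-^ m n))) (sym (fromℕ-* (length ps) (m ℕ.^ n)))) ⟩
      fromℕ (length ps ℕ.* m ℕ.^ n) * h ^ n     ≡⟨ cong (λ k → fromℕ k * h ^ n) (length-concatMap (grid m h) (length-grid m h) ps) ⟨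
      fromℕ (length points) * h ^ n             ∎
      where open ≡-Reasoning

    thickening : sum {N} (λ i → (γ * halves (toℕ i)) ^ n) ≤ γ ^ n
    thickening = begin
      sum {N} (λ i → (γ * halves (toℕ i)) ^ n)
        ≤⟨ sum-mono (λ (i : Fin N) → ≤-respˡ (sym (^-distrib-* γ (halves (toℕ i)) n)) (*-monoˡ-≤ (^-nonNeg n (<⇒≤ 0<γ)) (^-≤-self n (<⇒≤ (halves-pos (toℕ i))) (halves≤1 (toℕ i))))) ⟩
      sum {N} (λ i → γ ^ n * halves (toℕ i))   ≡⟨ *-distribˡ-sum (γ ^ n) (λ (i : Fin N) → halves (toℕ i)) ⟨
      γ ^ n * sum {N} (λ i → halves (toℕ i))   ≤⟨ *-monoˡ-≤ (^-nonNeg n (<⇒≤ 0<γ)) (sum-halves N) ⟩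
      γ ^ n * 1#                               ≡⟨ *-identityʳ _ ⟩
      γ ^ n                                    ∎
      where open ≤-Reasoning

    -- Since 6 γ = a / 2, the thickening accounts for at most half of the measure of one cube.
    6γ : 6# ^ n * γ ^ n ≤ half (a ^ n)
    6γ = begin
      6# ^ n * γ ^ n      ≡⟨ ^-distrib-* 6# γ n ⟨
      (6# * γ) ^ n        ≡⟨ cong (_^ n) 6γ≡ ⟩
      (half 1# * a) ^ n   ≡⟨ ^-distrib-* (half 1#) a n ⟩
      half 1# ^ n * a ^ n ≤⟨ *-monoʳ-≤ (^-nonNeg n (<⇒≤ 0<a)) (^-≤-self n (<⇒≤ (half-pos 0<1)) (<⇒≤ (half<x 0<1))) ⟩
      half 1# * a ^ n     ≡⟨ solve 2 (λ g x → con 1ℤ :* g :* x := x :* g) refl _ _ ⟩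
      half (a ^ n)        ∎
      where
      open ≤-Reasoning
      6γ≡ : 6# * γ ≡ half 1# * a
      6γ≡ = *-cancelˡ 2# (>⇒≢0 0<2) (trans (solve 2 (λ s γ → (con 1ℤ :+ con 1ℤ) :* (s :* γ) := (s :+ s) :* γ) refl 6# γ)
        (trans (x*[y÷x] a 0<12) (sym (trans (solve 2 (λ g a → (con 1ℤ :+ con 1ℤ) :* (g :* a) := (g :+ g) :* a) refl _ _)
          (trans (cong (_* a) (half+half 1#)) (*-identityˡ a))))))

    weak-bound : fromℕ (length ps) * a ^ n ≤ 6# ^ n * t + half (a ^ n)
    weak-bound = begin
      fromℕ (length ps) * a ^ n            ≡⟨ total-points ⟩
      fromℕ (length points) * h ^ n        ≤⟨ count-cover N (λ i → Near (U i) (θ i)) E points 0<h h≤E spread points-covered points-separated ⟩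
      sum {N} (λ i → (3# * E (toℕ i)) ^ n) ≤⟨ sum-mono (λ (i : Fin N) → power-of-sum n (0≤D (toℕ i)) (<⇒≤ (0<γh (toℕ i)))) ⟩
      sum {N} (λ i → 6# ^ n * (D (toℕ i) ^ n + (γ * halves (toℕ i)) ^ n))
        ≡⟨ *-distribˡ-sum (6# ^ n) (λ (i : Fin N) → D (toℕ i) ^ n + (γ * halves (toℕ i)) ^ n) ⟨
      6# ^ n * sum {N} (λ i → D (toℕ i) ^ n + (γ * halves (toℕ i)) ^ n)
        ≡⟨ cong (6# ^ n *_) (∑-distrib-+ (λ (i : Fin N) → D (toℕ i) ^ n) (λ i → (γ * halves (toℕ i)) ^ n)) ⟩
      6# ^ n * (sum {N} (λ i → D (toℕ i) ^ n) + sum {N} (λ i → (γ * halves (toℕ i)) ^ n))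
        ≤⟨ *-monoˡ-≤ (^-nonNeg n (<⇒≤ 0<6)) (+-mono-≤ (sum≤t N) thickening) ⟩
      6# ^ n * (t + γ ^ n)                 ≡⟨ distribˡ (6# ^ n) t (γ ^ n) ⟩
      6# ^ n * t + 6# ^ n * γ ^ n          ≤⟨ +-monoʳ-≤ (6# ^ n * t) 6γ ⟩
      6# ^ n * t + half (a ^ n)            ∎
      where open ≤-Reasoning

    -- For a nonempty list the left side is at least a ^ n, so it absorbs the error a ^ n / 2 at the
    -- cost of a factor 2.
    bound : fromℕ (length ps) * a ^ n ≤ 2# * 6# ^ n * t
    bound = absorb ps weak-bound
      where
      open ≤-Reasoning
      absorb : ∀ ps → fromℕ (length ps) * a ^ n ≤ 6# ^ n * t + half (a ^ n) → fromℕ (length ps) * a ^ n ≤ 2# * 6# ^ n * t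
      absorb []       _ = ≤-respˡ (sym (zeroˡ _)) (*-nonNeg (*-nonNeg (<⇒≤ 0<2) (^-nonNeg n (<⇒≤ 0<6))) (sum≤t 0))
      absorb (p ∷ ps) weak = begin
        x                     ≡⟨ solve 1 (λ x → x := x :+ x :- x) refl x ⟩
        x + x - x             ≤⟨ +-mono-≤ (+-mono-≤ weak weak) (neg-mono-≤ a≤x) ⟩
        y + half (a ^ n) + (y + half (a ^ n)) - a ^ n ≡⟨ solve 3 (λ y z a → y :+ z :+ (y :+ z) :- a := y :+ y :+ (z :+ z) :- a) refl _ _ _ ⟩
        y + y + (half (a ^ n) + half (a ^ n)) - a ^ n ≡⟨ cong (λ z → y + y + z - a ^ n) (half+half (a ^ n)) ⟩
        y + y + a ^ n - a ^ n ≡⟨ solve 3 (λ s t a → s :* t :+ s :* t :+ a :- a := (con 1ℤ :+ con 1ℤ) :* s :* t) refl _ _ _ ⟩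
        2# * 6# ^ n * t       ∎
        where
        x = fromℕ (length (p ∷ ps)) * a ^ n
        y = 6# ^ n * t
        a≤x : a ^ n ≤ x
        a≤x = ≤-respˡ (*-identityˡ _) (*-monoʳ-≤ (^-nonNeg n (<⇒≤ 0<a)) (x≤x+y 1# (fromℕ-nonNeg (length ps))))

  -- The cubes inside balls of radius ρ have side ρ / (4n), and the counting bound loses the factor
  -- 2 * 6 ^ n.
  lowerConstant : ℕ → ℝ
  lowerConstant n = ((fromℕ n * 4#) ⁻¹) ^ n ÷ (2# * 6# ^ n)

  lowerConstant-pos : ∀ n .{{_ : NonZero n}} → 0# < lowerConstant n
  lowerConstant-pos n = ÷-pos (^-pos n (⁻¹-pos (*-pos (fromℕ-pos n) 0<4))) (*-pos 0<2 (^-pos n 0<6))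

  -- Cubes of side a = ρ / (4n) with lower corners at the centres lie in the balls, and 2na = ρ / 2
  -- keeps them apart. As ℋ is a supremum over scales, the single scale 1 suffices; it also makes
  -- all diameters finite.
  ℋ-lower : ∀ {n} .{{_ : NonZero n}} (ps : List (Point n)) {ρ} {A : Subset n} → 0# < ρ →
    AllPairs (λ p q → ρ ≤ dist p q) ps → All (λ p → Ball p ρ ⊆ A) ps →
    ⟨ lowerConstant n * (fromℕ (length ps) * ρ ^ n) ⟩ ≤⁺ ℋ A
  ℋ-lower {n} ps {ρ} {A} 0<ρ separated balls = ≤⁺-trans
    (inf⁺-greatest [ 0≤c ] λ { s (U , A⊆U , small , refl) → cover-bound U A⊆U small })
    (sup⁺-upper (1# , 0<1 , refl))
    where
    k = fromℕ n * 4#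
    0<k : 0# < k
    0<k = *-pos (fromℕ-pos n) 0<4
    a = ρ ÷ k
    0<a : 0# < a
    0<a = ÷-pos 0<ρ 0<k
    c = lowerConstant n * (fromℕ (length ps) * ρ ^ n)
    0≤c : 0# ≤ c
    0≤c = *-nonNeg (<⇒≤ (lowerConstant-pos n)) (*-nonNeg (fromℕ-nonNeg (length ps)) (^-nonNeg n (<⇒≤ 0<ρ)))
    na+na≡ρ : fromℕ n * (a + a) + fromℕ n * (a + a) ≡ ρ
    na+na≡ρ = trans (solve 2 (λ n a → n :* (a :+ a) :+ n :* (a :+ a) := n :* (con 1ℤ :+ con 1ℤ :+ (con 1ℤ :+ con 1ℤ)) :* a) refl _ _) (x*[y÷x] ρ 0<k)
    2na<ρ : fromℕ n * (a + a) < ρ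
    2na<ρ = <-respʳ na+na≡ρ (x<x+y _ (*-pos (fromℕ-pos n) (+-pos 0<a (<⇒≤ 0<a))))
    cube⊆ball : ∀ p → Cube p a ⊆ Ball p ρ
    cube⊆ball p {y} y∈ = ≤-<-trans (dist≤coordinates p y (<⇒≤ 0<a) λ i → abs-≤
        (≤-trans (≤-shift (proj₁ (y∈ i)) (solve 2 (λ p y → con 0ℤ :- (p :- y) := y :- p) refl _ _)) (<⇒≤ 0<a))
        (≤-shift (proj₂ (y∈ i)) (solve 3 (λ p y a → a :- :- (p :- y) := p :+ a :- y) refl _ _ _)))
      (≤-<-trans (*-monoˡ-≤ (fromℕ-nonNeg n) (x≤x+y a (<⇒≤ 0<a))) 2na<ρ)
    finite : ∀ {x b} → x ≤⁺ ⟨ b ⟩ → x ≡ ⟨ toReal x ⟩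
    finite [ _ ] = refl
    from-bound : ∀ {t} → fromℕ (length ps) * a ^ n ≤ 2# * 6# ^ n * t → c ≤ t
    from-bound {t} h = ≤-respˡ (sym eq) (x÷z≤y (*-pos 0<2 (^-pos n 0<6)) h)
      where
      eq : c ≡ fromℕ (length ps) * a ^ n ÷ (2# * 6# ^ n)
      eq = trans (solve 4 (λ x y l r → x :* y :* (l :* r) := l :* (r :* x) :* y) refl _ _ _ _)
        (cong (λ z → fromℕ (length ps) * z * (2# * 6# ^ n) ⁻¹) (sym (^-distrib-* ρ (k ⁻¹) n)))
    cover-bound : ∀ U → A ⊆ ⋃ ℕ U → (∀ i → diam (U i) ≤⁺ ⟨ 1# ⟩) → ⟨ c ⟩ ≤⁺ series⁺ (λ i → diam {n} (U i) ^⁺ n)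
    cover-bound U A⊆U small = go (series⁺ (λ i → diam (U i) ^⁺ n)) (partial⁺≤series⁺ (λ i → diam (U i) ^⁺ n))
      where
      D : ℕ → ℝ
      D i = toReal (diam (U i))
      diam≡D : ∀ i → diam (U i) ≡ ⟨ D i ⟩
      diam≡D i = finite (small i)
      go : ∀ s → (∀ k → partial⁺ (λ i → diam (U i) ^⁺ n) k ≤⁺ s) → ⟨ c ⟩ ≤⁺ s
      go ⊤⁺    _      = _ ≤⊤⁺
      go ⟨ t ⟩ partial≤ = [ from-bound (CoverOfCubes.bound 0<a 2na<ρ ps separated U D diam≡D
        (All.map (λ {p} ball⊆ {y} y∈ → A⊆U {y} (ball⊆ {y} (cube⊆ball p {y} y∈))) balls)
        λ k → [≤]-injective (subst (_≤⁺ ⟨ t ⟩) (partial⁺-finite (λ i → D i ^ n) (λ i → cong (_^⁺ n) (diam≡D i)) k) (partial≤ k))) ]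

  -- Cut sets of a self-similar system

  module SelfSimilar {n l} (φ : Fin l → Point n → Point n) (r : Fin l → ℝ) (0<r : ∀ i → 0# < r i)
    (φ-similar : ∀ i → Similarity (r i) (φ i)) where

    -- Stands for a word in the maps φ i. The word itself is forgotten, since later arguments use
    -- only its map and its ratio.
    record Node : Set where
      field
        map       : Point n → Point n
        ratio     : ℝ
        0<ratio   : 0# < ratio
        similar   : Similarity ratio map
    open Node public

    rootNode : Node
    rootNode = record { map = id ; ratio = 1# ; 0<ratio = 0<1 ; similar = λ x y → sym (*-identityˡ _) }

    -- The new map is applied first, so a child's image of an invariant set lies inside the parent's
    -- image.
    child : Node → Fin l → Node
    child u i = record
      { map     = map u ∘ φ i
      ; ratio   = ratio u * r i
      ; 0<ratio = *-pos (0<ratio u) (0<r i)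
      ; similar = λ x y → trans (similar u (φ i x) (φ i y)) (trans (cong (ratio u *_) (φ-similar i x y)) (sym (*-assoc _ _ _)))
      }

    map-injective : ∀ u {x y} → map u x ≡ map u y → x ≡ y
    map-injective u {x} {y} eq = dist≡0⇒≡ (*-cancelˡ (ratio u) (>⇒≢0 (0<ratio u)) (begin
      ratio u * dist x y       ≡⟨ similar u x y ⟨
      dist (map u x) (map u y) ≡⟨ cong (dist (map u x)) (sym eq) ⟩
      dist (map u x) (map u x) ≡⟨ dist-self (map u x) ⟩
      0#                       ≡⟨ zeroʳ (ratio u) ⟨
      ratio u * 0#              ∎))
      where open ≡-Reasoning

    -- vs consists of the nodes below u at which the ratio first drops to ρ or less.
    data Cut (ρ : ℝ) (u : Node) : List Node → Set where
      stop  : ratio u ≤ ρ → Cut ρ u (u ∷ [])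
      split : ∀ {vss : Fin l → List Node} → ρ < ratio u → (∀ i → Cut ρ (child u i) (vss i)) → Cut ρ u (List.concat (List.tabulate vss))

    -- k bounds the remaining depth, because each step multiplies the ratio by at most r⁺.
    cut-exists : ∀ {ρ r⁺} → 0# ≤ r⁺ → (∀ i → r i ≤ r⁺) → ∀ k u → ratio u * r⁺ ^ k ≤ ρ → ∃[ vs ] Cut ρ u vs
    cut-exists 0≤r⁺ r≤r⁺ zero    u small = _ , stop (≤-respˡ (*-identityʳ _) small)
    cut-exists {ρ} {r⁺} 0≤r⁺ r≤r⁺ (suc k) u small with ≤-or-> (ratio u) ρ
    ... | inj₁ u≤ρ = _ , stop u≤ρ
    ... | inj₂ ρ<u = _ , split ρ<u (proj₂ ∘ below)
      where
      below : ∀ i → ∃[ vs ] Cut ρ (child u i) vs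
      below i = cut-exists 0≤r⁺ r≤r⁺ k (child u i) (≤-trans
        (*-monoʳ-≤ (^-nonNeg k 0≤r⁺) (*-monoˡ-≤ (<⇒≤ (0<ratio u)) (r≤r⁺ i)))
        (≤-respˡ (sym (*-assoc _ _ _)) small))

    cut-small : ∀ {ρ u vs} → Cut ρ u vs → All (λ v → ratio v ≤ ρ) vs
    cut-small (stop u≤ρ)       = u≤ρ ∷ []
    cut-small (split _ below)  = Allₚ.concat⁺ (Allₚ.tabulate⁺ λ i → cut-small (below i))

    -- The parent of a stopped node has ratio above ρ, and the last step costs at most the factor
    -- r⁻. Only u itself may be stopped without a parent, whence the hypothesis on `ratio u`.
    cut-large : ∀ {ρ r⁻ u vs} → 0# ≤ ρ → 0# ≤ r⁻ → (∀ i → r⁻ ≤ r i) → r⁻ * ρ ≤ ratio u → Cut ρ u vs → All (λ v → r⁻ * ρ ≤ ratio v) vs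
    cut-large 0≤ρ 0≤r⁻ r⁻≤r large (stop _)          = large ∷ []
    cut-large 0≤ρ 0≤r⁻ r⁻≤r large (split ρ<u below) = Allₚ.concat⁺ (Allₚ.tabulate⁺ λ i →
      cut-large 0≤ρ 0≤r⁻ r⁻≤r (≤-respˡ (*-comm _ _) (*-mono-≤ 0≤ρ (<⇒≤ (0<r i)) (<⇒≤ ρ<u) (r⁻≤r i))) (below i))

    weight : ℝ → List Node → ℝ
    weight s []       = 0#
    weight s (v ∷ vs) = ratio v ^ʳ s + weight s vs

    weight-++ : ∀ s vs ws → weight s (vs List.++ ws) ≡ weight s vs + weight s ws
    weight-++ s []       ws = sym (+-identityˡ _)
    weight-++ s (v ∷ vs) ws = trans (cong (ratio v ^ʳ s +_) (weight-++ s vs ws)) (sym (+-assoc _ _ _))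

    weight-tabulate : ∀ s {m} (vss : Fin m → List Node) → weight s (List.concat (List.tabulate vss)) ≡ sum (λ i → weight s (vss i))
    weight-tabulate s {zero}  vss = refl
    weight-tabulate s {suc m} vss = trans (weight-++ s (vss zero) _) (cong (weight s (vss zero) +_) (weight-tabulate s (vss ∘ suc)))

    weight-lower : ∀ s {c} vs → All (λ v → c ≤ ratio v ^ʳ s) vs → fromℕ (length vs) * c ≤ weight s vs
    weight-lower s {c} []       []       = ≤-reflexive (zeroˡ c)
    weight-lower s {c} (v ∷ vs) (p ∷ ps) = ≤-respˡ (solve 2 (λ m c → c :+ m :* c := (con 1ℤ :+ m) :* c) refl _ _)
      (+-mono-≤ p (weight-lower s vs ps))

    weight-upper : ∀ s {c} vs → All (λ v → ratio v ^ʳ s ≤ c) vs → weight s vs ≤ fromℕ (length vs) * c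
    weight-upper s {c} []       []       = ≤-reflexive (sym (zeroˡ c))
    weight-upper s {c} (v ∷ vs) (p ∷ ps) = ≤-respʳ (solve 2 (λ m c → c :+ m :* c := (con 1ℤ :+ m) :* c) refl _ _)
      (+-mono-≤ p (weight-upper s vs ps))

    -- Moran's equation says that replacing a node by its children preserves the total weight.
    cut-weight : ∀ {s ρ u vs} → sum (λ i → r i ^ʳ s) ≡ 1# → Cut ρ u vs → weight s vs ≡ ratio u ^ʳ s
    cut-weight     moran (stop _)                    = +-identityʳ _
    cut-weight {s} {u = u} moran (split {vss} _ below) = begin
      weight s (List.concat (List.tabulate vss)) ≡⟨ weight-tabulate s vss ⟩
      sum (λ i → weight s (vss i))               ≡⟨ sum-cong-≗ (λ i → trans (cut-weight moran (below i)) (^ʳ-distrib-* s (0<ratio u) (0<r i))) ⟩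
      sum (λ i → ratio u ^ʳ s * r i ^ʳ s)        ≡⟨ *-distribˡ-sum (ratio u ^ʳ s) (λ i → r i ^ʳ s) ⟨
      ratio u ^ʳ s * sum (λ i → r i ^ʳ s)        ≡⟨ trans (cong (ratio u ^ʳ s *_) moran) (*-identityʳ _) ⟩
      ratio u ^ʳ s                               ∎
      where open ≡-Reasoning

    cut-cover : ∀ {K : Subset n} → K ⊆ ⋃ (Fin l) (λ i → image (φ i) K) → ∀ {ρ u vs} → Cut ρ u vs →
      ∀ {x} → x ∈ K → Any (λ v → map u x ∈ image (map v) K) vs
    cut-cover K⊆ (stop _) {x} x∈K = here (x , x∈K , refl)
    cut-cover {K} K⊆ {u = u} (split {vss} _ below) {x} x∈K =
      let i , y , y∈K , φy≡x = K⊆ x∈K in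
      Anyₚ.concat⁺ (Anyₚ.tabulate⁺ i (subst (λ z → Any (λ v → map u z ∈ image (map v) K) (vss i)) φy≡x (cut-cover K⊆ (below i) y∈K)))

    child-inside : ∀ {A : Subset n} → (∀ i → image (φ i) A ⊆ A) → ∀ u i → image (map (child u i)) A ⊆ image (map u) A
    child-inside φA⊆A u i (x , x∈A , eq) = φ i x , φA⊆A i (x , x∈A , refl) , eq

    cut-inside : ∀ {A : Subset n} → (∀ i → image (φ i) A ⊆ A) → ∀ {ρ u vs} → Cut ρ u vs → All (λ v → image (map v) A ⊆ image (map u) A) vs
    cut-inside     φA⊆A (stop _) = id ∷ []
    cut-inside {A} φA⊆A {u = u} (split _ below) = Allₚ.concat⁺ (Allₚ.tabulate⁺ λ i →
      All.map (λ (inside : _ ⊆ _) {y} y∈ → child-inside {A} φA⊆A u i {y} (inside {y} y∈)) (cut-inside {A} φA⊆A (below i)))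

    ImagesDisjoint : Subset n → Node → Node → Set
    ImagesDisjoint O v w = ∀ y → y ∈ image (map v) O → y ∈ image (map w) O → ⊥

    children-disjoint : ∀ {O : Subset n} → (∀ i j → i ≢ j → image (φ i) O ⟂ image (φ j) O) →
      ∀ u {i j} → i ≢ j → ImagesDisjoint O (child u i) (child u j)
    children-disjoint disjoint u {i} {j} i≢j y (p , p∈O , p↦y) (q , q∈O , q↦y) =
      disjoint i j i≢j {φ i p} ((p , p∈O , refl) , (q , q∈O , map-injective u (trans q↦y (sym p↦y))))

    -- Two nodes of a cut part ways at some split. Their images of O lie inside the images for two
    -- different children, and these are disjoint because the parent's map is injective.
    cut-disjoint : ∀ {O : Subset n} → (∀ i → image (φ i) O ⊆ O) → (∀ i j → i ≢ j → image (φ i) O ⟂ image (φ j) O) →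
      ∀ {ρ u vs} → Cut ρ u vs → AllPairs (ImagesDisjoint O) vs
    cut-disjoint     φO⊆O disjoint (stop _) = [] ∷ []
    cut-disjoint {O} φO⊆O disjoint {u = u} (split _ below) = AllPairsₚ.concat⁺
      (Allₚ.tabulate⁺ λ i → cut-disjoint φO⊆O disjoint (below i))
      (AllPairsₚ.tabulate⁺ λ {i} {j} i≢j → All.map (λ (v⊆ : _ ⊆ _) → All.map (λ (w⊆ : _ ⊆ _) y y∈v y∈w →
        children-disjoint {O} disjoint u i≢j y (v⊆ {y} y∈v) (w⊆ {y} y∈w))
        (cut-inside {O} φO⊆O (below j))) (cut-inside {O} φO⊆O (below i)))

    -- Surjectivity of the similarity supplies the preimage of a point of the ball, and scaling puts
    -- this preimage within a of z.
    ball⊆image : ∀ {O : Subset n} {z a} → Ball z a ⊆ O → ∀ u → Ball (map u z) (ratio u * a) ⊆ image (map u) O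
    ball⊆image {O} {z} {a} ball⊆O u {y} y∈ =
      let x , eq = similarity-surjective {φ = map u} (0<ratio u) (similar u) y in
      x , ball⊆O {x} (*-cancelˡ-< (0<ratio u) (<-respˡ (trans (cong (dist (map u z)) (sym eq)) (similar u z x)) y∈)) , eq

    -- If the centres were closer than ρ, the centre of w would lie in the images of O under both
    -- maps.
    centres-separated : ∀ {O : Subset n} {z a ρ} → 0# < a → Ball z a ⊆ O → ∀ {v w} →
      ρ ≤ ratio v * a → ImagesDisjoint O v w → ρ ≤ dist (map v z) (map w z)
    centres-separated {O} {z} {a} 0<a ball⊆O {v} {w} ρ≤ disjoint = ≮⇒≥ λ d<ρ → disjoint (map w z)
      (ball⊆image {O} {z} {a} ball⊆O v {map w z} (<-≤-trans d<ρ ρ≤)) (z , ball⊆O {z} (<-respˡ (sym (dist-self z)) 0<a) , refl)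

  -- The similarity dimension

  least-ratio : ∀ {l} (r : Fin l → ℝ) → (∀ i → 0# < r i) → ∃[ r⁻ ] 0# < r⁻ × r⁻ < 1# × (∀ i → r⁻ ≤ r i)
  least-ratio {zero}  r 0<r = half 1# , half-pos 0<1 , half<x 0<1 , λ ()
  least-ratio {suc l} r 0<r with least-ratio (r ∘ suc) (0<r ∘ suc)
  ... | c , 0<c , c<1 , c≤ with ≤-or-> c (r zero)
  ...   | inj₁ c≤r = c , 0<c , c<1 , λ { zero → c≤r ; (suc i) → c≤ i }
  ...   | inj₂ r<c = r zero , 0<r zero , <-trans r<c c<1 , λ { zero → ≤-refl ; (suc i) → ≤-trans (<⇒≤ r<c) (c≤ i) }

  greatest-ratio : ∀ {l} (r : Fin l → ℝ) → (∀ i → r i < 1#) → ∃[ r⁺ ] 0# < r⁺ × r⁺ < 1# × (∀ i → r i ≤ r⁺)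
  greatest-ratio {zero}  r r<1 = half 1# , half-pos 0<1 , half<x 0<1 , λ ()
  greatest-ratio {suc l} r r<1 with greatest-ratio (r ∘ suc) (r<1 ∘ suc)
  ... | c , 0<c , c<1 , ≤c with ≤-or-> (r zero) c
  ...   | inj₁ r≤c = c , 0<c , c<1 , λ { zero → r≤c ; (suc i) → ≤c i }
  ...   | inj₂ c<r = r zero , <-trans 0<c c<r , r<1 zero , λ { zero → ≤-refl ; (suc i) → ≤-trans (≤c i) (<⇒≤ c<r) }

  powers-vanish : ∀ {x ε} → 0# < x → x < 1# → 0# < ε → ∃[ k ] x ^ k ≤ ε
  powers-vanish {x} {ε} 0<x x<1 0<ε =
    let k , _ , small = archimedean-÷ {x = - log ε} {ε = - log x} (<-respˡ -0#≈0# (neg-mono-< (log<0 0<x x<1))) in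
    k , subst₂ _≤_ (^ʳ-fromℕ k 0<x) (exp-log 0<ε) (exp-mono (≤-shift (<⇒≤ small)
          (solve 3 (λ a b k → a :- k :* b := k :* (:- b) :- :- a) refl _ _ _)))

  module Moran {l} (r : Fin l → ℝ) (0<r : ∀ i → 0# < r i) (r<1 : ∀ i → r i < 1#) (i₀ : Fin l) where
    F : ℝ → ℝ
    F t = sum (λ i → r i ^ʳ t)

    private
      r⁻ = proj₁ (least-ratio r 0<r)
      0<r⁻ = proj₁ (proj₂ (least-ratio r 0<r))
      r⁻<1 = proj₁ (proj₂ (proj₂ (least-ratio r 0<r)))
      r⁻≤r = proj₂ (proj₂ (proj₂ (least-ratio r 0<r)))
      r⁺ = proj₁ (greatest-ratio r r<1)
      0<r⁺ = proj₁ (proj₂ (greatest-ratio r r<1))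
      r⁺<1 = proj₁ (proj₂ (proj₂ (greatest-ratio r r<1)))
      r≤r⁺ = proj₂ (proj₂ (proj₂ (greatest-ratio r r<1)))

    -- This and the next estimate stand in for continuity and strict monotonicity of F.
    F-shift-lower : ∀ t {h} → 0# ≤ h → r⁻ ^ʳ h * F t ≤ F (t + h)
    F-shift-lower t {h} 0≤h = ≤-respˡ (sym (*-distribˡ-sum (r⁻ ^ʳ h) (λ i → r i ^ʳ t)))
      (sum-mono λ i → ≤-respʳ (trans (*-comm _ _) (sym (^ʳ-+ (r i) t h))) (*-monoʳ-≤ (^ʳ-nonNeg (r i) t) (^ʳ-monoˡ 0≤h 0<r⁻ (r⁻≤r i))))

    F-shift-upper : ∀ t {h} → 0# ≤ h → F (t + h) ≤ r⁺ ^ʳ h * F t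
    F-shift-upper t {h} 0≤h = ≤-respʳ (sym (*-distribˡ-sum (r⁺ ^ʳ h) (λ i → r i ^ʳ t)))
      (sum-mono λ i → ≤-respˡ (trans (*-comm _ _) (sym (^ʳ-+ (r i) t h))) (*-monoʳ-≤ (^ʳ-nonNeg (r i) t) (^ʳ-monoˡ 0≤h (0<r i) (r≤r⁺ i))))

    F-0 : F 0# ≡ fromℕ l
    F-0 = trans (sum-cong-≗ λ i → ^ʳ-0 (r i)) (trans (sum-const l 1#) (*-identityʳ _))

    1≤l : 1# ≤ fromℕ l
    1≤l = go i₀
      where
      go : ∀ {l} → Fin l → 1# ≤ fromℕ l
      go {suc l} _ = x≤x+y 1# (fromℕ-nonNeg l)

    -- The h with x ^ʳ h = 1 / Q.
    exponent : ℝ → ℝ → ℝ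
    exponent x Q = log Q ÷ (- log x)

    0<-log : ∀ {x} → 0# < x → x < 1# → 0# < - log x
    0<-log 0<x x<1 = <-respˡ -0#≈0# (neg-mono-< (log<0 0<x x<1))

    exponent-pos : ∀ {x Q} → 0# < x → x < 1# → 1# < Q → 0# < exponent x Q
    exponent-pos 0<x x<1 1<Q = ÷-pos (<-respˡ log-1 (log-strictMono 0<1 1<Q)) (0<-log 0<x x<1)

    exponent-power : ∀ {x Q} → 0# < x → x < 1# → 0# < Q → x ^ʳ exponent x Q * Q ≡ 1#
    exponent-power {x} {Q} 0<x x<1 0<Q = begin
      exp (log Q ÷ (- log x) * log x) * Q ≡⟨ cong₂ (λ a b → exp a * b) eq (sym (exp-log 0<Q)) ⟩
      exp (- log Q) * exp (log Q)         ≡⟨ *-comm _ _ ⟩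
      exp (log Q) * exp (- log Q)         ≡⟨ exp-neg (log Q) ⟩
      1#                                  ∎
      where
      open ≡-Reasoning
      eq : log Q ÷ (- log x) * log x ≡ - log Q
      eq = trans (solve 2 (λ q x → q :* x := :- (q :* (:- x))) refl _ _) (cong -_ ([y÷x]*x (log Q) (0<-log 0<x x<1)))

    power<1 : ∀ {x h} → 0# < x → x < 1# → 0# < h → x ^ʳ h < 1#
    power<1 {x} {h} 0<x x<1 0<h = <-respʳ exp-0 (exp-strictMono (<-respʳ (zeroʳ h) (*-monoˡ-< 0<h (log<0 0<x x<1))))

    Large : Pred ℝ 0ℓ
    Large t = 1# ≤ F t

    0-large : Large 0#
    0-large = ≤-respʳ (sym F-0) 1≤l

    F-below-1 : ∀ {t t′} → F t ≤ 1# → t < t′ → F t′ < 1#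
    F-below-1 {t} {t′} Ft≤1 t<t′ = begin-strict
      F t′                 ≡⟨ cong F (solve 2 (λ t u → u := t :+ (u :- t)) refl t t′) ⟩
      F (t + (t′ - t))     ≤⟨ F-shift-upper t (0≤y-x (<⇒≤ t<t′)) ⟩
      r⁺ ^ʳ (t′ - t) * F t ≤⟨ *-monoˡ-≤ (^ʳ-nonNeg r⁺ (t′ - t)) Ft≤1 ⟩
      r⁺ ^ʳ (t′ - t) * 1#  ≡⟨ *-identityʳ _ ⟩
      r⁺ ^ʳ (t′ - t)       <⟨ power<1 0<r⁺ r⁺<1 (0<y-x t<t′) ⟩
      1#                   ∎
      where open ≤-Reasoning

    B : ℝ
    B = exponent r⁺ (fromℕ l)

    -- B is chosen such that r⁺ ^ʳ B * l = 1, whence F B ≤ r⁺ ^ʳ B * F 0 = 1.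
    large-bounded : UpperBound Large B
    large-bounded t 1≤Ft = ≮⇒≥ λ B<t → <⇒≱ (F-below-1 FB≤1 B<t) 1≤Ft
      where
      open ≤-Reasoning
      0≤B : 0# ≤ B
      0≤B = ÷-nonNeg (≤-respˡ log-1 (log-mono 0<1 1≤l)) (0<-log 0<r⁺ r⁺<1)
      FB≤1 : F B ≤ 1#
      FB≤1 = begin
        F B               ≡⟨ cong F (sym (+-identityˡ B)) ⟩
        F (0# + B)        ≤⟨ F-shift-upper 0# 0≤B ⟩
        r⁺ ^ʳ B * F 0#    ≡⟨ cong (r⁺ ^ʳ B *_) F-0 ⟩
        r⁺ ^ʳ B * fromℕ l ≡⟨ exponent-power 0<r⁺ r⁺<1 (<-≤-trans 0<1 1≤l) ⟩
        1#                ∎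

    -- s is the supremum of the t with F t ≥ 1. The index `i₀` gives F 0 = l ≥ 1, so 0 belongs to
    -- this set and s ≥ 0.
    solution : ∃[ s ] 0# ≤ s × F s ≡ 1#
    solution = s , 0≤s , antisym (≮⇒≥ not-above) (≮⇒≥ not-below)
      where
      lub : ∃[ s ] IsLUB Large s
      lub = complete Large (0# , 0-large) (B , large-bounded)
      s = proj₁ lub
      0≤s : 0# ≤ s
      0≤s = proj₁ (proj₂ lub) 0# 0-large
      0<F : 0# < F s
      0<F = <-≤-trans (^ʳ-pos (r i₀) s) (term≤sum (λ i → ^ʳ-nonNeg (r i) s) i₀)

      -- Both times the shift h is chosen such that r⁻ ^ʳ h compensates the deviation of F s from 1 exactly.
      not-above : ¬ (1# < F s)
      not-above 1<F = <⇒≱ (x<x+y s 0<h) (proj₁ (proj₂ lub) (s + h)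
        (≤-respˡ (exponent-power 0<r⁻ r⁻<1 0<F) (F-shift-lower s (<⇒≤ 0<h))))
        where
        h = exponent r⁻ (F s)
        0<h = exponent-pos 0<r⁻ r⁻<1 1<F
      not-below : ¬ (F s < 1#)
      not-below F<1 = <⇒≱ (<-shift 0<h (solve 2 (λ s h → s :- (s :- h) := h :- con 0ℤ) refl s h))
        (proj₂ (proj₂ lub) (s - h) λ t 1≤Ft → ≮⇒≥ λ s-h<t → <⇒≱ (F-below-1 Fs-h≤1 s-h<t) 1≤Ft)
        where
        open ≤-Reasoning
        Q = F s ⁻¹
        0<Q = ⁻¹-pos 0<F
        1<Q : 1# < Q
        1<Q = *-cancelˡ-< 0<F (subst₂ _<_ (sym (*-identityʳ _)) (sym (x*x⁻¹ 0<F)) F<1)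
        h = exponent r⁻ Q
        0<h = exponent-pos 0<r⁻ r⁻<1 1<Q
        power≡F : r⁻ ^ʳ h ≡ F s
        power≡F = *-cancelˡ Q (>⇒≢0 0<Q) (trans (*-comm _ _) (trans (exponent-power 0<r⁻ r⁻<1 0<Q) (sym (trans (*-comm _ _) (x*x⁻¹ 0<F)))))
        Fs-h≤1 : F (s - h) ≤ 1#
        Fs-h≤1 = *-cancelˡ-≤ 0<F (begin
          F s * F (s - h)     ≡⟨ cong (_* F (s - h)) (sym power≡F) ⟩
          r⁻ ^ʳ h * F (s - h) ≤⟨ F-shift-lower (s - h) (<⇒≤ 0<h) ⟩
          F (s - h + h)       ≡⟨ cong F (solve 2 (λ s h → s :- h :+ h := s) refl s h) ⟩
          F s                 ≡⟨ *-identityʳ _ ⟨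
          F s * 1#                   ∎)

  -- Measures of neighbourhoods of the attractor

  any-with-all : ∀ {A : Set} {P Q : A → Set} {xs} → All P xs → Any Q xs → Any (λ x → P x × Q x) xs
  any-with-all (p ∷ _)  (here q)  = here (p , q)
  any-with-all (_ ∷ ps) (there q) = there (any-with-all ps q)

  any-filter : ∀ {A : Set} {P Q : A → Set} (Q? : ∀ x → Dec (Q x)) → (∀ {x} → P x → Q x) → ∀ {xs} → Any P xs → Any P (List.filter Q? xs)
  any-filter Q? P⇒Q p with Anyₚ.filter⁺ Q? p
  ... | inj₁ q  = q
  ... | inj₂ ¬q = ⊥-elim (¬q (P⇒Q (Anyₚ.lookup-result p)))

  module Attractor {n l} .{{n≢0 : NonZero n}} (φ : Fin l → Point n → Point n) (r : Fin l → ℝ) (0<r : ∀ i → 0# < r i)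
    (φ-similar : ∀ i → Similarity (r i) (φ i))
    (r⁻ r⁺ : ℝ) (0<r⁻ : 0# < r⁻) (r⁻<1 : r⁻ < 1#) (r⁻≤r : ∀ i → r⁻ ≤ r i) (0<r⁺ : 0# < r⁺) (r⁺<1 : r⁺ < 1#) (r≤r⁺ : ∀ i → r i ≤ r⁺)
    (O : Subset n) (z : Point n) (a : ℝ) (0<a : 0# < a) (ball⊆O : Ball z a ⊆ O) (φO⊆O : ∀ i → image (φ i) O ⊆ O)
    (disjoint : ∀ i j → i ≢ j → image (φ i) O ⟂ image (φ j) O)
    (K : Subset n) (K⊆ : K ⊆ ⋃ (Fin l) (λ i → image (φ i) K)) (φK⊆K : ∀ i → image (φ i) K ⊆ K)
    (k₀ : Point n) (k₀∈K : k₀ ∈ K) (D : ℝ) (0≤D : 0# ≤ D) (bounded : ∀ x y → x ∈ K → y ∈ K → dist x y ≤ D)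
    (s : ℝ) (0≤s : 0# ≤ s) (moran : sum (λ i → r i ^ʳ s) ≡ 1#) where

    open SelfSimilar φ r 0<r φ-similar

    0≤r⁻ : 0# ≤ r⁻
    0≤r⁻ = <⇒≤ 0<r⁻

    abstract
      cuts : ∀ {ρ} → 0# < ρ → ∀ u → ∃[ vs ] Cut ρ u vs
      cuts {ρ} 0<ρ u =
        let k , small = powers-vanish 0<r⁺ r⁺<1 (÷-pos 0<ρ (0<ratio u)) in
        cut-exists (<⇒≤ 0<r⁺) r≤r⁺ k u (≤-respʳ (x*[y÷x] ρ (0<ratio u)) (*-monoˡ-≤ (<⇒≤ (0<ratio u)) small))

    codim : ℝ
    codim = fromℕ n - s

    split-power : ∀ {x} → 0# < x → x ^ n ≡ x ^ʳ codim * x ^ʳ s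
    split-power {x} 0<x = trans (sym (^ʳ-fromℕ n 0<x))
      (trans (cong (x ^ʳ_) (solve 2 (λ n s → n := n :- s :+ s) refl _ _)) (^ʳ-+ x codim s))

    e : ℝ
    e = dist k₀ z

    0≤e : 0# ≤ e
    0≤e = dist-nonNeg k₀ z

    -- The bound of `ℋ-upper` for one ball of radius 1 + D: in units of δ, a piece has diameter at
    -- most D, and a point touching it is within 1 of it.
    upperBase : ℝ
    upperBase = (fromℕ n * ((1# + D) + (1# + D))) ^ n

    upperConstant : ℝ
    upperConstant = upperBase ÷ r⁻ ^ʳ s

    0<1+D : 0# < 1# + D
    0<1+D = +-pos 0<1 0≤D

    0<upperBase : 0# < upperBase
    0<upperBase = ^-pos n (*-pos (fromℕ-pos n) (+-pos 0<1+D (<⇒≤ 0<1+D)))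

    0<upperConstant : 0# < upperConstant
    0<upperConstant = ÷-pos 0<upperBase (^ʳ-pos r⁻ s)

    module Refine {δ} (0<δ : 0# < δ) where
      -- Continues given nodes down to scale δ. Starting from the root or from the nodes near a
      -- ball, the global and the local upper bound become the same argument.
      refine : List Node → List Node
      refine = concatMap (λ w → proj₁ (cuts 0<δ w))

      refine-small : ∀ ws → All (λ v → ratio v ≤ δ) (refine ws)
      refine-small ws = Allₚ.concat⁺ (Allₚ.map⁺ (All.universal (λ w → cut-small (proj₂ (cuts 0<δ w))) ws))

      -- A node whose ratio is already at most δ is kept as it is, so it has to satisfy the lower
      -- bound beforehand.
      refine-large : ∀ {ws} → All (λ w → r⁻ * δ ≤ ratio w) ws → All (λ v → r⁻ * δ ≤ ratio v) (refine ws)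
      refine-large large = Allₚ.concat⁺ (Allₚ.map⁺ (All.map (λ {w} p → cut-large (<⇒≤ 0<δ) 0≤r⁻ r⁻≤r p (proj₂ (cuts 0<δ w))) large))

      refine-weight : ∀ ws → weight s (refine ws) ≡ weight s ws
      refine-weight []       = refl
      refine-weight (w ∷ ws) = trans (weight-++ s (proj₁ (cuts 0<δ w)) (refine ws))
        (cong₂ _+_ (cut-weight moran (proj₂ (cuts 0<δ w))) (refine-weight ws))

      Touches : Point n → Node → Set
      Touches y w = ∃[ k ] k ∈ K × dist (map w k) y < δ

      refine-touches : ∀ {y ws} → Any (Touches y) ws → Any (Touches y) (refine ws)
      refine-touches {y} = Anyₚ.concatMap⁺ (λ w → proj₁ (cuts 0<δ w)) ∘ Any.map λ {w} (k , k∈K , close) →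
        Any.map (λ {v} (k′ , k′∈K , eq) → k′ , k′∈K , subst (λ p → dist p y < δ) (sym eq) close)
          (cut-cover {K} K⊆ (proj₂ (cuts 0<δ w)) {k} k∈K)

      refine-count : ∀ {ws} → All (λ w → r⁻ * δ ≤ ratio w) ws → fromℕ (length (refine ws)) * δ ^ʳ s ≤ weight s ws ÷ r⁻ ^ʳ s
      refine-count {ws} large = x≤y÷z (^ʳ-pos r⁻ s) (begin
        r⁻ ^ʳ s * (fromℕ (length (refine ws)) * δ ^ʳ s) ≡⟨ solve 3 (λ x m y → x :* (m :* y) := m :* (x :* y)) refl _ _ _ ⟩
        fromℕ (length (refine ws)) * (r⁻ ^ʳ s * δ ^ʳ s) ≡⟨ cong (fromℕ (length (refine ws)) *_) (sym (^ʳ-distrib-* s 0<r⁻ 0<δ)) ⟩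
        fromℕ (length (refine ws)) * (r⁻ * δ) ^ʳ s
          ≤⟨ weight-lower s (refine ws) (All.map (^ʳ-monoˡ 0≤s (*-pos 0<r⁻ 0<δ)) (refine-large large)) ⟩
        weight s (refine ws)                       ≡⟨ refine-weight ws ⟩
        weight s ws                                       ∎)
        where open ≤-Reasoning

      ball-near : ∀ {y v} → ratio v ≤ δ → Touches y v → y ∈ Ball (map v k₀) (δ * (1# + D))
      ball-near {y} {v} v≤δ (k , k∈K , close) = begin-strict
        dist (map v k₀) y                            ≤⟨ dist-triangle (map v k₀) (map v k) y ⟩
        dist (map v k₀) (map v k) + dist (map v k) y
          <⟨ +-mono-≤-< (≤-respˡ (sym (similar v k₀ k)) (*-mono-≤ (<⇒≤ (0<ratio v)) 0≤D v≤δ (bounded k₀ k k₀∈K k∈K))) close ⟩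
        δ * D + δ                                    ≡⟨ solve 2 (λ δ D → δ :* D :+ δ := δ :* (con 1ℤ :+ D)) refl δ D ⟩
        δ * (1# + D)                                 ∎
        where open ≤-Reasoning

      upper : ∀ (ws : List Node) {A : Subset n} {m} → All (λ w → r⁻ * δ ≤ ratio w) ws →
        (∀ y → y ∈ A → Any (Touches y) ws) → weight s ws ≤ m → ℋ A ≤⁺ ⟨ upperConstant * (δ ^ʳ codim * m) ⟩
      upper ws {A} {m} large covers weight≤m = ≤⁺-trans (ℋ-upper points (*-pos 0<δ 0<1+D) (λ {y} y∈A → cover y y∈A)) [ estimate ]
        where
        open ≤-Reasoning
        vs = refine ws
        points = List.map (λ v → map v k₀) vs
        cover : ∀ y → y ∈ A → Any (λ p → y ∈ Ball p (δ * (1# + D))) points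
        cover y y∈A = Anyₚ.map⁺ (Any.map (λ {v} (v≤δ , touch) → ball-near {y} {v} v≤δ touch) (any-with-all (refine-small ws) (refine-touches {y} (covers y y∈A))))
        scale : (fromℕ n * (δ * (1# + D) + δ * (1# + D))) ^ n ≡ δ ^ n * upperBase
        scale = trans (cong (_^ n) (solve 3 (λ n δ Z → n :* (δ :* Z :+ δ :* Z) := δ :* (n :* (Z :+ Z))) refl _ _ _)) (^-distrib-* δ _ n)
        estimate : fromℕ (length points) * (fromℕ n * (δ * (1# + D) + δ * (1# + D))) ^ n ≤ upperConstant * (δ ^ʳ codim * m)
        estimate = begin
          fromℕ (length points) * (fromℕ n * (δ * (1# + D) + δ * (1# + D))) ^ n
            ≡⟨ cong₂ (λ k p → fromℕ k * p) (Listₚ.length-map (λ v → map v k₀) vs) (trans scale (cong (_* upperBase) (split-power 0<δ))) ⟩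
          fromℕ (length vs) * (δ ^ʳ codim * δ ^ʳ s * upperBase)
            ≡⟨ solve 4 (λ k c s g → k :* (c :* s :* g) := g :* c :* (k :* s)) refl _ _ _ _ ⟩
          upperBase * δ ^ʳ codim * (fromℕ (length vs) * δ ^ʳ s)
            ≤⟨ *-monoˡ-≤ (*-nonNeg (<⇒≤ 0<upperBase) (^ʳ-nonNeg δ codim)) (≤-trans (refine-count large) (*-monoʳ-≤ (<⇒≤ (⁻¹-pos (^ʳ-pos r⁻ s))) weight≤m)) ⟩
          upperBase * δ ^ʳ codim * (m ÷ r⁻ ^ʳ s)
            ≡⟨ solve 4 (λ g c m i → g :* c :* (m :* i) := g :* i :* (c :* m)) refl _ _ _ _ ⟩
          upperConstant * (δ ^ʳ codim * m) ∎

    global-upper : ∀ {δ} → 0# < δ → δ ≤ 1# → ℋ (Δ K δ) ≤⁺ ⟨ upperConstant * (δ ^ʳ codim * 1#) ⟩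
    global-upper {δ} 0<δ δ≤1 = Refine.upper 0<δ (rootNode ∷ [])
      (≤-respʳ (*-identityˡ 1#) (*-mono-≤ 0≤r⁻ 0≤1 (<⇒≤ r⁻<1) δ≤1) ∷ [])
      (λ y near → let k , k∈K , close = Δ-elim {F = K} {x = y} 0<δ near in here (k , k∈K , <-respˡ (dist-sym y k) close))
      (≤-reflexive (trans (+-identityʳ _) (1-^ʳ s)))

    -- In units of ρ: 2 from `Meets`, D + e from a point of the piece to the centre of its ball, and
    -- a for the radius of that ball.
    reach : ℝ
    reach = 2# + (D + e) + a

    0<reach : 0# < reach
    0<reach = +-pos (+-pos 0<2 (+-nonNeg 0≤D 0≤e)) (<⇒≤ 0<a)

    multiplicityBase : ℝ
    multiplicityBase = lowerConstant n * (a * r⁻) ^ n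

    0<multiplicityBase : 0# < multiplicityBase
    0<multiplicityBase = *-pos (lowerConstant-pos n) (^-pos n (*-pos 0<a 0<r⁻))

    -- The upper bound for the measure of a ball of radius `reach`, divided by the lower bound for a
    -- ball of radius a * r⁻; the powers of ρ cancel.
    multiplicity : ℝ
    multiplicity = (fromℕ n * (reach + reach)) ^ n ÷ multiplicityBase

    0<multiplicity : 0# < multiplicity
    0<multiplicity = ÷-pos (^-pos n (*-pos (fromℕ-pos n) (+-pos 0<reach (<⇒≤ 0<reach)))) 0<multiplicityBase

    centres-apart : ∀ {ρ} → 0# ≤ ρ → ∀ {ws} → All (λ w → r⁻ * ρ ≤ ratio w) ws →
      AllPairs (ImagesDisjoint O) ws →
      AllPairs (λ p q → a * (r⁻ * ρ) ≤ dist p q) (List.map (λ w → map w z) ws)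
    centres-apart 0≤ρ large disjoint = AllPairsₚ.map⁺ (AllPairs.map
      (λ {v} {w} (v-large , _ , v⟂w) → centres-separated {O} {z} {a} 0<a ball⊆O {v} {w} (≤-respˡ (*-comm _ _) (*-monoʳ-≤ (<⇒≤ 0<a) v-large)) v⟂w)
      (allPairs-with-all large disjoint))

    module Neighbours (x : Point n) {ρ} (0<ρ : 0# < ρ) (ρ≤1 : ρ ≤ 1#) where
      -- The radius is 2ρ because a point of `Ball x ρ ∩ Δ K δ` has a point of K within δ ≤ ρ.
      Meets : Node → Set
      Meets w = ∃[ k ] k ∈ K × dist x (map w k) < ρ + ρ

      meets? : ∀ w → Dec (Meets w)
      meets? w = lem

      all-nodes : ∃[ ws ] Cut ρ rootNode ws
      all-nodes = cuts 0<ρ rootNode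

      nodes : List Node
      nodes = List.filter meets? (proj₁ all-nodes)

      nodes-small : All (λ w → ratio w ≤ ρ) nodes
      nodes-small = Allₚ.filter⁺ meets? (cut-small (proj₂ all-nodes))

      nodes-large : All (λ w → r⁻ * ρ ≤ ratio w) nodes
      nodes-large = Allₚ.filter⁺ meets? (cut-large (<⇒≤ 0<ρ) 0≤r⁻ r⁻≤r
        (≤-respʳ (*-identityˡ 1#) (*-mono-≤ 0≤r⁻ 0≤1 (<⇒≤ r⁻<1) ρ≤1)) (proj₂ all-nodes))

      nodes-disjoint : AllPairs (ImagesDisjoint O) nodes
      nodes-disjoint = AllPairsₚ.filter⁺ meets? (cut-disjoint {O} φO⊆O disjoint (proj₂ all-nodes))

      centre-ball : ∀ {w} → ratio w ≤ ρ → Meets w → Ball (map w z) (a * (r⁻ * ρ)) ⊆ Ball x (reach * ρ)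
      centre-ball {w} w≤ρ (k , k∈K , close) {y} y∈ = begin-strict
        dist x y                      ≤⟨ ≤-trans (dist-triangle x (map w k) y) (+-monoʳ-≤ _ (dist-triangle (map w k) (map w z) y)) ⟩
        dist x (map w k) + (dist (map w k) (map w z) + dist (map w z) y)
          <⟨ +-mono-<-≤ close (+-mono-≤ (≤-respˡ (sym (similar w k z)) (*-mono-≤ (<⇒≤ (0<ratio w)) (+-nonNeg 0≤D 0≤e) w≤ρ k-z)) (≤-trans (<⇒≤ y∈) (*-monoˡ-≤ (<⇒≤ 0<a) r⁻ρ≤ρ))) ⟩
        ρ + ρ + (ρ * (D + e) + a * ρ)
          ≡⟨ solve 4 (λ ρ D e a → ρ :+ ρ :+ (ρ :* (D :+ e) :+ a :* ρ) := (con 1ℤ :+ con 1ℤ :+ (D :+ e) :+ a) :* ρ) refl ρ D e a ⟩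
        reach * ρ                     ∎
        where
        open ≤-Reasoning
        k-z : dist k z ≤ D + e
        k-z = ≤-trans (dist-triangle k k₀ z) (+-monoˡ-≤ e (bounded k k₀ k∈K k₀∈K))
        r⁻ρ≤ρ : r⁻ * ρ ≤ ρ
        r⁻ρ≤ρ = ≤-respʳ (*-identityˡ ρ) (*-monoʳ-≤ (<⇒≤ 0<ρ) (<⇒≤ r⁻<1))

      -- The disjoint balls around the centres lie in one ball of comparable radius.
      count : fromℕ (length nodes) ≤ multiplicity
      count = x≤y÷z 0<multiplicityBase (*-cancelˡ-≤ (^-pos n 0<ρ) (subst₂ _≤_ left right ([≤]-injective (≤⁺-trans
        (ℋ-lower centres (*-pos 0<a (*-pos 0<r⁻ 0<ρ)) (centres-apart (<⇒≤ 0<ρ) nodes-large nodes-disjoint)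
          (Allₚ.map⁺ (All.zipWith (λ {w} (w≤ρ , meets) {y} y∈ → centre-ball {w} w≤ρ meets {y} y∈) (nodes-small , Allₚ.all-filter meets? (proj₁ all-nodes)))))
        (ℋ-upper (x ∷ []) {A = Ball x (reach * ρ)} (*-pos 0<reach 0<ρ) (λ {y} y∈ → here y∈))))))
        where
        open ≡-Reasoning
        centres = List.map (λ w → map w z) nodes
        left : lowerConstant n * (fromℕ (length centres) * (a * (r⁻ * ρ)) ^ n) ≡ ρ ^ n * (multiplicityBase * fromℕ (length nodes))
        left = begin
          lowerConstant n * (fromℕ (length centres) * (a * (r⁻ * ρ)) ^ n)
            ≡⟨ cong₂ (λ k p → lowerConstant n * (fromℕ k * p)) (Listₚ.length-map (λ w → map w z) nodes) (trans (cong (_^ n) (sym (*-assoc a r⁻ ρ))) (^-distrib-* (a * r⁻) ρ n)) ⟩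
          lowerConstant n * (fromℕ (length nodes) * ((a * r⁻) ^ n * ρ ^ n))
            ≡⟨ solve 4 (λ c k p q → c :* (k :* (p :* q)) := q :* (c :* p :* k)) refl _ _ _ _ ⟩
          ρ ^ n * (multiplicityBase * fromℕ (length nodes)) ∎
        right : fromℕ 1 * (fromℕ n * (reach * ρ + reach * ρ)) ^ n ≡ ρ ^ n * (fromℕ n * (reach + reach)) ^ n
        right = begin
          fromℕ 1 * (fromℕ n * (reach * ρ + reach * ρ)) ^ n
            ≡⟨ trans (cong (_* (fromℕ n * (reach * ρ + reach * ρ)) ^ n) (+-identityʳ 1#)) (*-identityˡ _) ⟩
          (fromℕ n * (reach * ρ + reach * ρ)) ^ n
            ≡⟨ cong (_^ n) (solve 3 (λ n reach ρ → n :* (reach :* ρ :+ reach :* ρ) := ρ :* (n :* (reach :+ reach))) refl _ _ _) ⟩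
          (ρ * (fromℕ n * (reach + reach))) ^ n   ≡⟨ ^-distrib-* ρ _ n ⟩
          ρ ^ n * (fromℕ n * (reach + reach)) ^ n ∎

      nodes-weight : weight s nodes ≤ multiplicity * ρ ^ʳ s
      nodes-weight = ≤-trans (weight-upper s nodes (All.map (λ {w} → ^ʳ-monoˡ 0≤s (0<ratio w)) nodes-small))
        (*-monoʳ-≤ (^ʳ-nonNeg ρ s) count)

      local-upper : ∀ {δ} → 0# < δ → δ ≤ ρ → ℋ (Ball x ρ ∩ Δ K δ) ≤⁺ ⟨ upperConstant * (δ ^ʳ codim * (multiplicity * ρ ^ʳ s)) ⟩
      local-upper {δ} 0<δ δ≤ρ = Refine.upper 0<δ nodes
        (All.map (≤-trans (*-monoˡ-≤ 0≤r⁻ δ≤ρ)) nodes-large) touched nodes-weight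
        where
        touched : ∀ y → y ∈ (Ball x ρ ∩ Δ K δ) → Any (Refine.Touches 0<δ y) nodes
        touched y (y∈ball , near) =
          let k , k∈K , close = Δ-elim {F = K} {x = y} 0<δ near
              x-k = ≤-<-trans (dist-triangle x y k) (+-mono-< y∈ball (<-≤-trans close δ≤ρ))
          in Any.map (λ {w} (k′ , k′∈K , eq) → k′ , k′∈K , subst (λ p → dist p y < δ) (sym eq) (<-respˡ (dist-sym y k) close))
            (any-filter meets? (λ {w} (k′ , k′∈K , eq) → k′ , k′∈K , subst (λ p → dist x p < ρ + ρ) (sym eq) x-k)
              (cut-cover {K} K⊆ (proj₂ all-nodes) {k} k∈K))

    -- Normalised by `β-sum`. A piece of ratio at most β ρ has diameter at most β D ρ, and the balls
    -- at scale β δ reach at most β (e + a) δ from K; for δ ≤ ρ both together stay within ρ.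
    β : ℝ
    β = (1# + D + (e + a)) ⁻¹

    0<1+D+e+a : 0# < 1# + D + (e + a)
    0<1+D+e+a = +-pos 0<1+D (+-nonNeg 0≤e (<⇒≤ 0<a))

    0<β : 0# < β
    0<β = ⁻¹-pos 0<1+D+e+a

    β-sum : β + β * D + β * (e + a) ≡ 1#
    β-sum = trans (solve 3 (λ β D f → β :+ β :* D :+ β :* f := (con 1ℤ :+ D :+ f) :* β) refl _ _ _) (x*x⁻¹ 0<1+D+e+a)

    0≤βD : 0# ≤ β * D
    0≤βD = *-nonNeg (<⇒≤ 0<β) 0≤D

    0≤βf : 0# ≤ β * (e + a)
    0≤βf = *-nonNeg (<⇒≤ 0<β) (+-nonNeg 0≤e (<⇒≤ 0<a))

    β≤1 : β ≤ 1#
    β≤1 = ≤-respʳ β-sum (≤-trans (x≤x+y β 0≤βD) (x≤x+y _ 0≤βf))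

    βf≤1 : β * (e + a) ≤ 1#
    βf≤1 = ≤-respʳ β-sum (y≤x+y _ (+-nonNeg (<⇒≤ 0<β) 0≤βD))

    βDf≤1 : β * D + β * (e + a) ≤ 1#
    βDf≤1 = ≤-respʳ (trans (sym (+-assoc _ _ _)) β-sum) (y≤x+y _ (<⇒≤ 0<β))

    nodeConstant : ℝ
    nodeConstant = lowerConstant n * (a * (r⁻ * β)) ^ n ÷ β ^ʳ s

    0<nodeConstant : 0# < nodeConstant
    0<nodeConstant = ÷-pos (*-pos (lowerConstant-pos n) (^-pos n (*-pos 0<a (*-pos 0<r⁻ 0<β)))) (^ʳ-pos β s)

    module Below (w : Node) {δ} (0<δ : 0# < δ) (large : r⁻ * (β * δ) ≤ ratio w) where
      0<βδ : 0# < β * δ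
      0<βδ = *-pos 0<β 0<δ

      cut-below : ∃[ vs ] Cut (β * δ) w vs
      cut-below = cuts 0<βδ w

      vs : List Node
      vs = proj₁ cut-below

      centres : List (Point n)
      centres = List.map (λ v → map v z) vs

      centre-near : ∀ {v y} → ratio v ≤ β * δ → y ∈ Ball (map v z) (a * (r⁻ * (β * δ))) → dist (map v k₀) y < β * (e + a) * δ
      centre-near {v} {y} v≤ y∈ = begin-strict
        dist (map v k₀) y                            ≤⟨ dist-triangle (map v k₀) (map v z) y ⟩
        dist (map v k₀) (map v z) + dist (map v z) y <⟨ +-mono-≤-< (≤-respˡ (sym (similar v k₀ z)) (*-monoʳ-≤ 0≤e v≤)) y∈ ⟩
        β * δ * e + a * (r⁻ * (β * δ))               ≤⟨ +-monoʳ-≤ _ (*-monoˡ-≤ (<⇒≤ 0<a) (≤-respʳ (*-identityˡ (β * δ)) (*-monoʳ-≤ (<⇒≤ 0<βδ) (<⇒≤ r⁻<1)))) ⟩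
        β * δ * e + a * (β * δ)                      ≡⟨ solve 4 (λ β δ e a → β :* δ :* e :+ a :* (β :* δ) := β :* (e :+ a) :* δ) refl β δ e a ⟩
        β * (e + a) * δ                              ∎
        where open ≤-Reasoning

      -- The cut of w at scale β δ has at least (ratio w / (β δ)) ^ s nodes, each contributing a
      -- ball of radius a r⁻ β δ; `nodeConstant` is what remains once the powers of δ and of the
      -- ratio are split off. Containment is left to `contains`, so that the bound serves `Δ K δ` as
      -- well as its part in a ball.
      lower : ∀ {A : Subset n} → (∀ y k → k ∈ image (map w) K → dist k y < β * (e + a) * δ → y ∈ A) →
        ⟨ nodeConstant * (δ ^ʳ codim * ratio w ^ʳ s) ⟩ ≤⁺ ℋ A
      lower {A} contains = ≤⁺-trans [ estimate ] (ℋ-lower centres (*-pos 0<a (*-pos 0<r⁻ 0<βδ))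
        (centres-apart (<⇒≤ 0<βδ) (cut-large (<⇒≤ 0<βδ) 0≤r⁻ r⁻≤r large (proj₂ cut-below)) (cut-disjoint {O} φO⊆O disjoint (proj₂ cut-below)))
        (Allₚ.map⁺ (All.zipWith (λ {v} small×inside {y} y∈ → contains y (map v k₀) (proj₂ small×inside {map v k₀} (k₀ , k₀∈K , refl)) (centre-near {v} {y} (proj₁ small×inside) y∈))
          (cut-small (proj₂ cut-below) , cut-inside {K} φK⊆K (proj₂ cut-below)))))
        where
        open ≤-Reasoning
        c = lowerConstant n
        g = (a * (r⁻ * β)) ^ n
        0≤cg : 0# ≤ c * g
        0≤cg = <⇒≤ (*-pos (lowerConstant-pos n) (^-pos n (*-pos 0<a (*-pos 0<r⁻ 0<β))))
        many : ratio w ^ʳ s ÷ β ^ʳ s ≤ fromℕ (length vs) * δ ^ʳ s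
        many = x÷z≤y (^ʳ-pos β s) (begin
          ratio w ^ʳ s                          ≡⟨ cut-weight moran (proj₂ cut-below) ⟨
          weight s vs                           ≤⟨ weight-upper s vs (All.map (λ {v} → ^ʳ-monoˡ 0≤s (0<ratio v)) (cut-small (proj₂ cut-below))) ⟩
          fromℕ (length vs) * (β * δ) ^ʳ s      ≡⟨ cong (fromℕ (length vs) *_) (^ʳ-distrib-* s 0<β 0<δ) ⟩
          fromℕ (length vs) * (β ^ʳ s * δ ^ʳ s) ≡⟨ solve 3 (λ k b d → k :* (b :* d) := b :* (k :* d)) refl _ _ _ ⟩
          β ^ʳ s * (fromℕ (length vs) * δ ^ʳ s)          ∎)
        radius : (a * (r⁻ * (β * δ))) ^ n ≡ g * (δ ^ʳ codim * δ ^ʳ s)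
        radius = trans (cong (_^ n) (solve 4 (λ a r b d → a :* (r :* (b :* d)) := a :* (r :* b) :* d) refl a r⁻ β δ))
          (trans (^-distrib-* (a * (r⁻ * β)) δ n) (cong (g *_) (split-power 0<δ)))
        estimate : nodeConstant * (δ ^ʳ codim * ratio w ^ʳ s) ≤ lowerConstant n * (fromℕ (length centres) * (a * (r⁻ * (β * δ))) ^ n)
        estimate = begin
          nodeConstant * (δ ^ʳ codim * ratio w ^ʳ s)   ≡⟨ solve 4 (λ x i c w → x :* i :* (c :* w) := x :* c :* (w :* i)) refl _ _ _ _ ⟩
          c * g * δ ^ʳ codim * (ratio w ^ʳ s ÷ β ^ʳ s) ≤⟨ *-monoˡ-≤ (*-nonNeg 0≤cg (^ʳ-nonNeg δ codim)) many ⟩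
          c * g * δ ^ʳ codim * (fromℕ (length vs) * δ ^ʳ s)
            ≡⟨ solve 5 (λ c g d k s → c :* g :* d :* (k :* s) := c :* (k :* (g :* (d :* s)))) refl _ _ _ _ _ ⟩
          c * (fromℕ (length vs) * (g * (δ ^ʳ codim * δ ^ʳ s)))
            ≡⟨ cong₂ (λ k p → c * (fromℕ k * p)) (sym (Listₚ.length-map (λ v → map v z) vs)) (sym radius) ⟩
          c * (fromℕ (length centres) * (a * (r⁻ * (β * δ))) ^ n) ∎

    in-neighbourhood : ∀ {δ y k} → 0# < δ → k ∈ K → dist k y < β * (e + a) * δ → y ∈ Δ K δ
    in-neighbourhood {δ} {y} {k} 0<δ k∈K close = Δ-intro {F = K} {x = y} {y = k} k∈K
      (<-≤-trans (<-respˡ (dist-sym k y) close) (≤-respʳ (*-identityˡ δ) (*-monoʳ-≤ (<⇒≤ 0<δ) βf≤1)))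

    global-lower : ∀ {δ} → 0# < δ → δ ≤ 1# → ⟨ nodeConstant * (δ ^ʳ codim * 1#) ⟩ ≤⁺ ℋ (Δ K δ)
    global-lower {δ} 0<δ δ≤1 = subst (λ w → ⟨ nodeConstant * (δ ^ʳ codim * w) ⟩ ≤⁺ ℋ (Δ K δ)) (1-^ʳ s)
      (Below.lower rootNode 0<δ
        (≤-respʳ (trans (cong (1# *_) (*-identityˡ 1#)) (*-identityˡ 1#)) (*-mono-≤ 0≤r⁻ (*-nonNeg 0≤1 0≤1) (<⇒≤ r⁻<1) (*-mono-≤ (<⇒≤ 0<β) 0≤1 β≤1 δ≤1)))
        λ { y k (_ , k∈K , refl) close → in-neighbourhood {y = y} {k} 0<δ k∈K close })

    -- One piece through x from the cut at scale β ρ suffices: by the choice of β it and the small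
    -- balls near it stay inside `Ball x ρ`. Its ratio is at least r⁻ β ρ, the origin of the factor
    -- (r⁻ * β) ^ʳ s.
    local-lower : ∀ {ρ δ x} → 0# < ρ → ρ ≤ 1# → 0# < δ → δ ≤ ρ → x ∈ K →
      ⟨ nodeConstant * (r⁻ * β) ^ʳ s * (δ ^ʳ codim * ρ ^ʳ s) ⟩ ≤⁺ ℋ (Ball x ρ ∩ Δ K δ)
    local-lower {ρ} {δ} {x} 0<ρ ρ≤1 0<δ δ≤ρ x∈K = from-node (any-with-all
        (All.zip (cut-small cut , All.zip (cut-large (<⇒≤ 0<βρ) 0≤r⁻ r⁻≤r root-large cut , cut-inside {K} φK⊆K cut)))
        (cut-cover {K} K⊆ cut {x} x∈K))
      where
      open ≤-Reasoning
      0<βρ : 0# < β * ρ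
      0<βρ = *-pos 0<β 0<ρ
      cut = proj₂ (cuts 0<βρ rootNode)
      root-large : r⁻ * (β * ρ) ≤ 1#
      root-large = ≤-respʳ (trans (cong (1# *_) (*-identityˡ 1#)) (*-identityˡ 1#)) (*-mono-≤ 0≤r⁻ (*-nonNeg 0≤1 0≤1) (<⇒≤ r⁻<1) (*-mono-≤ (<⇒≤ 0<β) 0≤1 β≤1 ρ≤1))
      Good : Node → Set
      Good w = (ratio w ≤ β * ρ × r⁻ * (β * ρ) ≤ ratio w × image (map w) K ⊆ image (map rootNode) K) × x ∈ image (map w) K
      inside-ball : ∀ {w y k} → ratio w ≤ β * ρ → x ∈ image (map w) K → k ∈ image (map w) K → dist k y < β * (e + a) * δ → y ∈ Ball x ρ
      inside-ball {w} {y} {_} w≤ (x′ , x′∈K , refl) (k′ , k′∈K , refl) close = begin-strict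
        dist (map w x′) y           ≤⟨ dist-triangle (map w x′) (map w k′) y ⟩
        dist (map w x′) (map w k′) + dist (map w k′) y
          <⟨ +-mono-≤-< (≤-respˡ (sym (similar w x′ k′)) (*-mono-≤ (<⇒≤ (0<ratio w)) 0≤D w≤ (bounded x′ k′ x′∈K k′∈K))) close ⟩
        β * ρ * D + β * (e + a) * δ ≤⟨ +-monoʳ-≤ _ (*-monoˡ-≤ 0≤βf δ≤ρ) ⟩
        β * ρ * D + β * (e + a) * ρ ≡⟨ solve 4 (λ β ρ D f → β :* ρ :* D :+ β :* f :* ρ := (β :* D :+ β :* f) :* ρ) refl _ _ _ _ ⟩
        (β * D + β * (e + a)) * ρ   ≤⟨ *-monoʳ-≤ (<⇒≤ 0<ρ) βDf≤1 ⟩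
        1# * ρ                      ≡⟨ *-identityˡ ρ ⟩
        ρ                           ∎
      from-node : ∀ {ws} → Any Good ws → ⟨ nodeConstant * (r⁻ * β) ^ʳ s * (δ ^ʳ codim * ρ ^ʳ s) ⟩ ≤⁺ ℋ (Ball x ρ ∩ Δ K δ)
      from-node (there good) = from-node good
      from-node (here {x = w} ((w≤ , w≥ , inside) , x∈w)) = ≤⁺-trans [ bound ]
        (Below.lower w 0<δ (≤-trans (*-monoˡ-≤ 0≤r⁻ (*-monoˡ-≤ (<⇒≤ 0<β) δ≤ρ)) w≥) contained)
        where
        contained : ∀ y k → k ∈ image (map w) K → dist k y < β * (e + a) * δ → y ∈ (Ball x ρ ∩ Δ K δ)
        contained y k k∈w close = inside-ball {w} {y} {k} w≤ x∈w k∈w close ,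
          in-neighbourhood {y = y} {k} 0<δ (let k′ , k′∈K , eq = inside {k} k∈w in subst (_∈ K) eq k′∈K) close
        bound : nodeConstant * (r⁻ * β) ^ʳ s * (δ ^ʳ codim * ρ ^ʳ s) ≤ nodeConstant * (δ ^ʳ codim * ratio w ^ʳ s)
        bound = begin
          nodeConstant * (r⁻ * β) ^ʳ s * (δ ^ʳ codim * ρ ^ʳ s)
            ≡⟨ solve 4 (λ c b d p → c :* b :* (d :* p) := c :* (d :* (b :* p))) refl _ _ _ _ ⟩
          nodeConstant * (δ ^ʳ codim * ((r⁻ * β) ^ʳ s * ρ ^ʳ s))
            ≡⟨ cong (λ p → nodeConstant * (δ ^ʳ codim * p)) (trans (sym (^ʳ-distrib-* s (*-pos 0<r⁻ 0<β) 0<ρ)) (cong (_^ʳ s) (*-assoc r⁻ β ρ))) ⟩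
          nodeConstant * (δ ^ʳ codim * (r⁻ * (β * ρ)) ^ʳ s)
            ≤⟨ *-monoˡ-≤ (<⇒≤ 0<nodeConstant) (*-monoˡ-≤ (^ʳ-nonNeg δ codim) (^ʳ-monoˡ 0≤s (*-pos 0<r⁻ 0<βρ) w≥)) ⟩
          nodeConstant * (δ ^ʳ codim * ratio w ^ʳ s) ∎

  -- The box dimension

  -- Taking logarithms puts log h - σ log ξ between log c and log C, and the deviation from σ is
  -- this difference divided by log ξ = - T.
  power-law-exponent : ∀ {c C σ ξ h T} → 0# < c → 0# < C → 0# < T → log ξ ≡ - T →
    c * ξ ^ʳ σ ≤ h → h ≤ C * ξ ^ʳ σ → T * abs (log h ÷ log ξ - σ) ≤ abs (log c) + abs (log C)
  power-law-exponent {c} {C} {σ} {ξ} {h} {T} 0<c 0<C 0<T log-ξ lower upper = begin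
    T * abs (g - σ)           ≡⟨ cong (_* abs (g - σ)) (trans (sym (abs-nonNeg-≡ (<⇒≤ 0<T))) (sym (abs-neg T))) ⟩
    abs (- T) * abs (g - σ)   ≡⟨ trans (*-comm _ _) (sym (abs-* (g - σ) (- T))) ⟩
    abs ((g - σ) * - T)       ≡⟨ cong abs product ⟩
    abs (log h - σ * log ξ)   ≤⟨ deviation ⟩
    abs (log c) + abs (log C) ∎
    where
    open ≤-Reasoning
    g : ℝ
    g = log h ÷ log ξ
    0<lower : 0# < c * ξ ^ʳ σ
    0<lower = *-pos 0<c (^ʳ-pos ξ σ)
    log-product : ∀ {x} → 0# < x → log (x * ξ ^ʳ σ) ≡ log x + σ * log ξ
    log-product {x} 0<x = trans (log-* 0<x (^ʳ-pos ξ σ)) (cong (log x +_) (log-^ʳ ξ σ))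
    deviation : abs (log h - σ * log ξ) ≤ abs (log c) + abs (log C)
    deviation = abs-≤
      (≤-trans (≤-shift (≤-respʳ (log-product 0<C) (log-mono (<-≤-trans 0<lower lower) upper))
          (solve 3 (λ h c s → c :- (h :- s) := c :+ s :- h) refl _ _ _))
        (≤-trans (x≤abs (log C)) (y≤x+y _ (abs-nonNeg (log c)))))
      (≤-trans (≤-shift (≤-respˡ (log-product 0<c) (log-mono 0<lower lower))
          (solve 3 (λ h c s → :- c :- :- (h :- s) := h :- (c :+ s)) refl _ _ _))
        (≤-trans (-x≤abs (log c)) (x≤x+y _ (abs-nonNeg (log C)))))
    log-ξ≢0 : log ξ ≢ 0#
    log-ξ≢0 eq = <-irrefl (<-respʳ (trans (sym (-‿involutive T)) (trans (cong -_ (trans (sym log-ξ) eq)) -0#≈0#)) 0<T)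
    product : (g - σ) * - T ≡ log h - σ * log ξ
    product = trans (cong ((g - σ) *_) (sym log-ξ)) (trans
      (solve 4 (λ h i s l → (h :* i :- s) :* l := h :* (l :* i) :- s :* l) refl _ _ _ _)
      (cong (_- σ * log ξ) (trans (cong (log h *_) (*-inverseʳ (log ξ) log-ξ≢0)) (*-identityʳ _))))

  small-argument : ∀ {η} M → 0# < η → ∃[ T ] 0# < T × M < T × exp (- T) < η × exp (- T) ≤ 1#
  small-argument {η} M 0<η = T , 0<T , M<T ,
    <-respʳ (exp-log 0<η) (exp-strictMono (<-shift
      (+-mono-<-≤ (<-≤-trans 0<1 (y≤x+y 1# (abs-nonNeg M))) (-x≤abs (log η)))
      (solve 3 (λ b a l → l :- :- (b :+ a :+ con 1ℤ) := b :+ con 1ℤ :+ a :- (con 0ℤ :+ :- l)) refl _ _ _))) ,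
    ≤-respʳ exp-0 (exp-mono (≤-respʳ -0#≈0# (neg-mono-≤ (<⇒≤ 0<T))))
    where
    T : ℝ
    T = abs M + abs (log η) + 1#
    0<T : 0# < T
    0<T = <-respʳ (+-comm 1# _) (+-pos 0<1 (+-nonNeg (abs-nonNeg M) (abs-nonNeg (log η))))
    M<T : M < T
    M<T = ≤-<-trans (x≤abs M) (<-≤-trans (x<x+y _ 0<1) (+-monoˡ-≤ 1# (x≤x+y _ (abs-nonNeg (log η)))))

  -- The limit is evaluated along ξ = exp (- T), where the quotient of logarithms deviates from σ by
  -- at most (|log c| + |log C|) / T.
  exponent-unique : ∀ {H : ℝ → ℝ} {c C σ L} → 0# < c → 0# < C →
    (∀ ξ → 0# < ξ → ξ ≤ 1# → c * ξ ^ʳ σ ≤ H ξ × H ξ ≤ C * ξ ^ʳ σ) →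
    Limit₀₊ (λ ξ → log (H ξ) ÷ log ξ) L → L ≡ σ
  exponent-unique {H} {c} {C} {σ} {L} 0<c 0<C bounds limit = antisym
    (x≤y-of-0≤y-x (≤-respʳ (swap σ L) (0≤-x (vanish (x≤abs (L - σ))))))
    (x≤y-of-0≤y-x (≤-respʳ (-‿involutive (L - σ)) (0≤-x (vanish (-x≤abs (L - σ))))))
    where
    open ≤-Reasoning
    swap : ∀ σ L → - (L - σ) ≡ σ - L
    swap = solve 2 (λ σ L → :- (L :- σ) := σ :- L) refl
    B : ℝ
    B = abs (log c) + abs (log C)
    at : ∀ {ε T} → 0# < ε → 0# < T → B ÷ ε < T → exp (- T) ≤ 1# →
      abs (log (H (exp (- T))) ÷ log (exp (- T)) - L) < ε → abs (L - σ) ≤ ε + ε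
    at {ε} {T} 0<ε 0<T B/ε<T ξ≤1 near = begin
      abs (L - σ)               ≤⟨ abs-triangle L g σ ⟩
      abs (L - g) + abs (g - σ) ≤⟨ +-mono-≤ (≤-respˡ (abs-swap g L) (<⇒≤ near)) g-σ≤ ⟩
      ε + ε                     ∎
      where
      g : ℝ
      g = log (H (exp (- T))) ÷ log (exp (- T))
      g-σ≤ : abs (g - σ) ≤ ε
      g-σ≤ = *-cancelˡ-≤ 0<T (≤-trans
        (power-law-exponent 0<c 0<C 0<T (log-exp (- T)) (proj₁ (bounds (exp (- T)) (exp-pos (- T)) ξ≤1)) (proj₂ (bounds (exp (- T)) (exp-pos (- T)) ξ≤1)))
        (≤-respˡ (x*[y÷x] B 0<ε) (≤-respʳ (*-comm ε T) (*-monoˡ-≤ (<⇒≤ 0<ε) (<⇒≤ B/ε<T)))))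
    close : ∀ ε → 0# < ε → abs (L - σ) ≤ ε
    close ε 0<ε =
      let η , 0<η , near = limit (half ε) (half-pos 0<ε)
          T , 0<T , B/ε<T , ξ<η , ξ≤1 = small-argument (B ÷ half ε) 0<η
      in ≤-respʳ (half+half ε) (at (half-pos 0<ε) 0<T B/ε<T ξ≤1 (near (exp (- T)) (exp-pos (- T)) ξ<η))
    vanish : ∀ {x} → x ≤ abs (L - σ) → x ≤ 0#
    vanish x≤ = ≤-if-≤+ε λ ε 0<ε → ≤-trans x≤ (≤-respʳ (sym (+-identityˡ ε)) (close ε 0<ε))

  -- The upper bound excludes `⊤⁺`, so `toReal` is not at its default value.
  toReal-between : ∀ {a b x} → ⟨ a ⟩ ≤⁺ x → x ≤⁺ ⟨ b ⟩ → a ≤ toReal x × toReal x ≤ b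
  toReal-between [ a≤x ] [ x≤b ] = a≤x , x≤b

  -- The local scaling property

  attractor-local-scaling : ∀ {n l} → .{{NonZero n}} → (φ : Fin l → Point n → Point n) → (∀ i → IsContractingSimilarity (φ i)) →
    OpenSetCondition φ → (K : Subset n) → IsAttractor φ K → (d : ℝ) → IsBoxDimension K d → LocalScaling K (d ÷ fromℕ n)
  attractor-local-scaling {n} {l} φ contracting (O , (z , z∈O) , open-O , φO⊆O , disjoint) K ((k₀ , k₀∈K) , _ , K⊆ , ⊆K) d
    ((D , bounded) , L , limit , d≡n-L) =
    -- The radius bound 1 serves as r₁ because both local estimates hold for all ρ ≤ 1.
    nodeConstant * (r⁻ * β) ^ʳ s , upperConstant * multiplicity , 1# ,
    *-pos 0<nodeConstant (^ʳ-pos _ s) , *-pos 0<upperConstant 0<multiplicity , 0<1 ,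
    λ ρ δ x 0<ρ ρ<1 0<δ δ<ρ x∈K →
      subst (λ t → ⟨ nodeConstant * (r⁻ * β) ^ʳ s * (δ ^ʳ (fromℕ n - t) * ρ ^ʳ t) ⟩ ≤⁺ ℋ (Ball x ρ ∩ Δ K δ)) (sym exponent≡s)
        (local-lower 0<ρ (<⇒≤ ρ<1) 0<δ (<⇒≤ δ<ρ) x∈K) ,
      subst (λ t → ℋ (Ball x ρ ∩ Δ K δ) ≤⁺ ⟨ upperConstant * multiplicity * (δ ^ʳ (fromℕ n - t) * ρ ^ʳ t) ⟩) (sym exponent≡s)
        (≤⁺-respʳ (solve 4 (λ u m d p → u :* (d :* (m :* p)) := u :* m :* (d :* p)) refl _ _ _ _)
          (Neighbours.local-upper x 0<ρ (<⇒≤ ρ<1) 0<δ (<⇒≤ δ<ρ)))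
    where
    r : Fin l → ℝ
    r i = proj₁ (contracting i)
    0<r : ∀ i → 0# < r i
    0<r i = proj₁ (proj₂ (contracting i))
    r<1 : ∀ i → r i < 1#
    r<1 i = proj₁ (proj₂ (proj₂ (contracting i)))
    φ-similar : ∀ i → Similarity (r i) (φ i)
    φ-similar i = proj₂ (proj₂ (proj₂ (contracting i)))
    least = least-ratio r 0<r
    greatest = greatest-ratio r r<1
    -- The point k₀ of K lies in some φ i K, which supplies the index that makes Moran's equation
    -- solvable.
    dimension = Moran.solution r 0<r r<1 (proj₁ (K⊆ k₀∈K))
    r⁻ = proj₁ least
    s = proj₁ dimension
    ball = open-O z z∈O
    0≤D : 0# ≤ D
    0≤D = ≤-trans (dist-nonNeg k₀ k₀) (bounded k₀ k₀ k₀∈K k₀∈K)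
    open Attractor φ r 0<r φ-similar r⁻ (proj₁ greatest)
      (proj₁ (proj₂ least)) (proj₁ (proj₂ (proj₂ least))) (proj₂ (proj₂ (proj₂ least)))
      (proj₁ (proj₂ greatest)) (proj₁ (proj₂ (proj₂ greatest))) (proj₂ (proj₂ (proj₂ greatest)))
      O z (proj₁ ball) (proj₁ (proj₂ ball)) (proj₂ (proj₂ ball)) φO⊆O disjoint
      K K⊆ (λ i y∈ → ⊆K (i , y∈)) k₀ k₀∈K D 0≤D bounded s (proj₁ (proj₂ dimension)) (proj₂ (proj₂ dimension))
    L≡codim : L ≡ codim
    L≡codim = exponent-unique {λ δ → toReal (ℋ (Δ K δ))} 0<nodeConstant 0<upperConstant
      (λ δ 0<δ δ≤1 → let lower , upper = toReal-between (global-lower 0<δ δ≤1) (global-upper 0<δ δ≤1) in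
        ≤-respˡ (cong (nodeConstant *_) (*-identityʳ _)) lower , ≤-respʳ (cong (upperConstant *_) (*-identityʳ _)) upper)
      limit
    exponent≡s : (d ÷ fromℕ n) * fromℕ n ≡ s
    exponent≡s = trans ([y÷x]*x d (fromℕ-pos n)) (trans d≡n-L (trans (cong (λ t → fromℕ n - t) L≡codim)
      (solve 2 (λ n s → n :- (n :- s) := s) refl _ _)))

mainTheorem4 : (lem : ∀ {ℓ} → ExcludedMiddle ℓ) (R : CompleteOrderedField) →
    let open Analysis lem R in
    (n l : ℕ) → .{{NonZero n}} →
    (φ : Fin l → Point n → Point n) →
    (∀ i → IsContractingSimilarity (φ i)) →
    OpenSetCondition φ →
    (K : Subset n) → IsAttractor φ K →
    (d : CompleteOrderedField.Carrier R) → IsBoxDimension K d →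
    LocalScaling K (d ÷ fromℕ n)
mainTheorem4 lem R n l = Development.attractor-local-scaling lem R
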